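{- Let $N$ and $\nu$ be positive integers. Then, as formal power series in $q$, $$\sum_{n=1}^{\infty}\eta_{2\nu,N}(n)q^n=(q)_N\sum_{n=1}^{N}\frac{(-1)^{n-1}q^{\frac{n(3n-1)}{2}+\nu n}(1+q^n)}{(q)_{N+n}(q)_{N-n}(1-q^n)^{2\nu}}=(q)_N\sum_{\substack{n=-N\\ n\ne 0}}^{N}\frac{(-1)^{n-1}q^{\frac{n(3n+1)}{2}+\nu n}}{(q)_{N+n}(q)_{N-n}(1-q^n)^{2\nu}},$$ where $\eta_{2\nu,N}(n):=\sum_{m=-n}^{n}\binom{m+\nu-1}{2\nu}N_{S_1}(m,n)$.
   Context: $(a)_n=(a;q)_n=\prod_{i=0}^{n-1}(1-aq^i)$, $(a)_0=1$. Here $\binom{x}{k}=\frac{x(x-1)\cdots(x-k+1)}{k!}$ for any integer $x$. For a partition $\pi$, $|\pi|$ is the sum of its parts, $\#(\pi)$ its number of parts; the rank of a nonempty partition is its largest part minus its number of parts. A partition has Durfee square of size $j$ if $j$ is the largest integer such that it has at least $j$ parts that are $\ge j$. For $1\le j\le N$, let $S_1^{(j)}$ be the set of pairs $\vec\pi=(\pi_1,\pi_2)$ where $\pi_1$ is a (possibly empty) partition into distinct parts, all lying in $[N-j+1,N]$, and $\pi_2$ is a partition with Durfee square of size $j$. Set $|\vec\pi|=|\pi_1|+|\pi_2|$, weight $w_r(\vec\pi)=(-1)^{\#(\pi_1)}$, and $\mathrm{rank}(\vec\pi)=\mathrm{rank}(\pi_2)$. Define $$N_{S_1}(m,n)=\sum_{j=1}^{N}\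 \sum_{\vec\pi\in S_1^{(j)},\ |\vec\pi|=n,\ \mathrm{rank}(\vec\pi)=m} w_r(\vec\pi).$$ -}

module Defs where

open import Data.Bool using (Bool; true; false; if_then_else_; _∧_; not)
open import Data.Nat as ℕ using (ℕ; zero; suc; _!)
import Data.Nat.Properties as ℕP
open import Data.Integer as ℤ using (ℤ; +_; -[1+_]; _+_; _*_; _-_; -_; ∣_∣; _⊓_; _/ℕ_; 0ℤ; 1ℤ)
open import Data.List using (List; []; _∷_; map; concatMap; foldr; length; upTo; applyUpTo)
open import Data.Nat.ListAction using (sum)

ΣI : {A : Set} → (A → ℤ) → List A → ℤ
ΣI f []       = 0ℤ
ΣI f (x ∷ xs) = f x + ΣI f xs

from1To : ℕ → List ℕ
from1To n = applyUpTo suc n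

from0To : ℕ → List ℕ
from0To n = upTo (suc n)

sgn : ℕ → ℤ
sgn zero          = 1ℤ
sgn (suc zero)    = - 1ℤ
sgn (suc (suc k)) = sgn k

-- Generalised binomial coefficient  binom x k = x(x-1)…(x-k+1)/k!
-- for an integer x (the division is exact).

falling : ℤ → ℕ → ℤ
falling x zero    = 1ℤ
falling x (suc k) = falling x k * (x - + k)

binom : ℤ → ℕ → ℤ
binom x k = (falling x k /ℕ (k !)) {{ℕP._!≢0 k}}

listsOf : ℕ → ℕ → List (List ℕ)
listsOf b zero    = [] ∷ []
listsOf b (suc ℓ) = concatMap (λ x → map (x ∷_) (listsOf b ℓ)) (from1To b)

nonincreasing : List ℕ → Bool
nonincreasing []           = true
nonincreasing (x ∷ [])     = true
nonincreasing (x ∷ y ∷ xs) = (y ℕ.≤ᵇ x) ∧ nonincreasing (y ∷ xs)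

filterB : {A : Set} → (A → Bool) → List A → List A
filterB p []       = []
filterB p (x ∷ xs) = if p x then x ∷ filterB p xs else filterB p xs

-- all partitions of k: every partition of k has at most k parts,
-- each at most k, so we filter the lists of length ≤ k over {1,…,k}.
partitionsOf : ℕ → List (List ℕ)
partitionsOf k =
  filterB (λ π → nonincreasing π ∧ (sum π ℕ.≡ᵇ k))
          (concatMap (listsOf k) (from0To k))

sublists : List ℕ → List (List ℕ)
sublists []       = [] ∷ []
sublists (x ∷ xs) = map (x ∷_) (sublists xs) Data.List.++ sublists xs
  where import Data.List

-- partitions into distinct parts all lying in [N-j+1, N] (for 1 ≤ j ≤ N):
-- these are exactly the sublists of  N ∷ N-1 ∷ … ∷ N-j+1
distinctIn : ℕ → ℕ → List (List ℕ)
distinctIn N j = sublists (map (λ i → N ℕ.∸ i) (upTo j))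

countGE : ℕ → List ℕ → ℕ
countGE j []       = zero
countGE j (x ∷ xs) = if j ℕ.≤ᵇ x then suc (countGE j xs) else countGE j xs

atLeast : List ℕ → ℕ → Bool
atLeast π j = j ℕ.≤ᵇ countGE j π

-- π has Durfee square of size j: j is the largest integer such that π has
-- at least j parts ≥ j.  (The property "at least j parts ≥ j" is
-- downward closed in j, so "largest" is: holds at j, fails at j+1.)
hasDurfee : List ℕ → ℕ → Bool
hasDurfee π j = atLeast π j ∧ not (atLeast π (suc j))

-- rank = largest part − number of parts (largest part of the empty list := 0,
-- only used on nonempty partitions)
rank : List ℕ → ℤ
rank []       = 0ℤ
rank (x ∷ xs) = + x - + (length (x ∷ xs))

eqℤ : ℤ → ℤ → Bool
eqℤ a b = ℤ._≤ᵇ_ a b ∧ ℤ._≤ᵇ_ b a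

NS1 : (N : ℕ) → ℤ → ℕ → ℤ
NS1 N m n =
  ΣI (λ j →
    ΣI (λ π₁ →
      ΣI (λ k →
        ΣI (λ π₂ →
          if ((sum π₁ ℕ.+ k) ℕ.≡ᵇ n) ∧ hasDurfee π₂ j ∧ eqℤ (rank π₂) m
          then sgn (length π₁) else 0ℤ)
        (partitionsOf k))
      (from0To n))
    (distinctIn N j))
  (from1To N)

intRange : ℕ → List ℤ
intRange n = map (λ i → + i - + n) (from0To (n ℕ.+ n))

η : (ν N n : ℕ) → ℤ
η ν N n = ΣI (λ m → binom (m + + ν - 1ℤ) (2 ℕ.* ν) * NS1 N m n) (intRange n)

-- Formal power series over ℤ (coefficient functions) and
-- formal Laurent series over ℤ (q^s · f with f a power series).

PS : Set
PS = ℕ → ℤ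

sumTo : ℕ → (ℕ → ℤ) → ℤ
sumTo n h = ΣI h (from0To n)

_⊛_ : PS → PS → PS
(f ⊛ g) n = sumTo n (λ i → f i * g (n ℕ.∸ i))

-- Multiplicative inverse of a power series whose constant term c is a
-- unit (c = ±1, so c⁻¹ = c):  b₀ = c, b_k = -c Σ_{i=1}^{k} f_i b_{k-i}.
-- invUpTo f n k = b_k for k ≤ n.
invUpTo : PS → ℕ → PS
invUpTo f zero    k = f 0
invUpTo f (suc n) k =
  if k ℕ.≤ᵇ n then invUpTo f n k
  else - (f 0 * ΣI (λ i → f i * invUpTo f n (suc n ℕ.∸ i)) (from1To (suc n)))

invPS : PS → PS
invPS f n = invUpTo f n n

record Laurent : Set where
  constructor _·q^_
  field
    series : PS
    shift  : ℤ
open Laurent public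

coeff : Laurent → ℤ → ℤ
coeff (f ·q^ s) m with m - s
... | + k      = f k
... | -[1+ _ ] = 0ℤ

δ0 : PS
δ0 zero    = 1ℤ
δ0 (suc _) = 0ℤ

qpow : ℤ → Laurent
qpow a = δ0 ·q^ a

constL : ℤ → Laurent
constL c = (λ k → c * δ0 k) ·q^ 0ℤ

_⊕_ : Laurent → Laurent → Laurent
x ⊕ y = let s = shift x ⊓ shift y in
  (λ k → coeff x (s + + k) + coeff y (s + + k)) ·q^ s

⊖_ : Laurent → Laurent
⊖ x = (λ k → - series x k) ·q^ shift x

_⊗_ : Laurent → Laurent → Laurent
x ⊗ y = (series x ⊛ series y) ·q^ (shift x + shift y)

-- inverse, for a Laurent series q^s f whose f has unit constant term
invL : Laurent → Laurent
invL x = invPS (series x) ·q^ (- shift x)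

0L 1L : Laurent
0L = constL 0ℤ
1L = constL 1ℤ

_^L_ : Laurent → ℕ → Laurent
x ^L zero  = 1L
x ^L suc k = x ⊗ (x ^L k)

ΣL : {A : Set} → (A → Laurent) → List A → Laurent
ΣL f []       = 0L
ΣL f (x ∷ xs) = f x ⊕ ΣL f xs

ΠL : {A : Set} → (A → Laurent) → List A → Laurent
ΠL f []       = 1L
ΠL f (x ∷ xs) = f x ⊗ ΠL f xs

oneMinus : ℤ → Laurent
oneMinus a = 1L ⊕ (⊖ qpow a)

qPoch : ℕ → Laurent
qPoch k = ΠL (λ i → oneMinus (+ i)) (from1To k)

sgnℤ : ℤ → ℤ
sgnℤ n = sgn ∣ n ∣

etaSeries : (ν N : ℕ) → Laurent
etaSeries ν N = (λ { zero → 0ℤ ; (suc n) → η ν N (suc n) }) ·q^ 0ℤ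

middleSeries : (ν N : ℕ) → Laurent
middleSeries ν N = qPoch N ⊗ ΣL term (from1To N)
  where
  term : ℕ → Laurent
  term n =
    constL (sgn (n ℕ.∸ 1))
    ⊗ (qpow (+ ((n ℕ.* (3 ℕ.* n ℕ.∸ 1)) ℕ./ 2 ℕ.+ ν ℕ.* n))
    ⊗ ((1L ⊕ qpow (+ n))
    ⊗ (invL (qPoch (N ℕ.+ n))
    ⊗ (invL (qPoch (N ℕ.∸ n))
    ⊗ invL (oneMinus (+ n) ^L (2 ℕ.* ν))))))

-- (q)_N Σ_{n=-N, n≠0}^{N} (-1)^{n-1} q^{n(3n+1)/2+νn}
--        / ((q)_{N+n} (q)_{N-n} (1-q^n)^{2ν})
-- (for n < 0, 1-q^n is a Laurent polynomial, inverted in ℤ((q)))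
rightSeries : (ν N : ℕ) → Laurent
rightSeries ν N = qPoch N ⊗ ΣL term nonzeroRange
  where
  nonzeroRange : List ℤ
  nonzeroRange = concatMap (λ k → + k ∷ - (+ k) ∷ []) (from1To N)
  term : ℤ → Laurent
  term n =
    constL (sgnℤ (n - 1ℤ))
    ⊗ (qpow ((n * (+ 3 * n + 1ℤ)) /ℕ 2 + + ν * n)
    ⊗ (invL (qPoch ∣ + N + n ∣)
    ⊗ (invL (qPoch ∣ + N - n ∣)
    ⊗ invL (oneMinus n ^L (2 ℕ.* ν)))))

{-# OPTIONS --safe #-}
-- A partition with Durfee square j consists of the square, at most j parts to its right and
-- parts ≤ j below it; the rank is the first part on the right minus the number of parts below.
-- Hence the rank generating function is q^{j²} / ∏_{i≤j} (1 - z qⁱ)(1 - z⁻¹ qⁱ), and with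
-- y = z - 2 + z⁻¹ each factor is (1 - qⁱ)² - qⁱ y.  The functional zᵐ ↦ binom (m + ν - 1) (2ν)
-- sends yᵏ to 1 if k = ν and to 0 otherwise: its central second difference in m is the functional
-- for ν - 1.  So the 2ν-th symmetrized moment W_j(ν) is a coefficient of a power series in y and obeys
--   (1 - qʲ)² W_j(ν) = qʲ W_j(ν - 1) + q^{2j-1} W_{j-1}(ν).
-- With F_j(ν) = Σ_{n≥1} (-1)ⁿ⁻¹ (1 + qⁿ) q^{n(n-1)/2+νn} / ((q)_{j-n} (q)_{j+n} (1 - qⁿ)^{2ν}) (partial
-- fractions in y), the product q^{j²} F_j(ν) satisfies the same recurrence term by term because
-- (1 - qʲ)² - q^{j-n}(1 - qⁿ)² = (1 - q^{j-n})(1 - q^{j+n}), and F_j(0) telescopes to 1/(q)_j².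
-- The signed distinct parts contribute (q)_N / (q)_{N-j}, and the sum over j is evaluated by the
-- limiting q-Vandermonde sum Σ_j q^{j²} / ((q)_{N-j} (q)_{j-n} (q)_{j+n}) = q^{n²} / ((q)_{N-n} (q)_{N+n}).
module Submission where

open import Defs
open import Level using (0ℓ)
open import Algebra.Bundles using (CommutativeRing)
open import Algebra.Structures using (IsCommutativeRing)
import Algebra.Properties.AbelianGroup
open import Algebra.Solver.Ring.AlmostCommutativeRing using (_-Raw-AlmostCommutative⟶_; fromCommutativeRing)
open import Data.Bool using (Bool; true; false; if_then_else_; _∧_; not; T)
open import Data.Bool.Properties using (T-∧; T-≡)
open import Data.Integer as ℤ using (ℤ; 0ℤ; 1ℤ)
open import Data.Integer.DivMod using (a≡a%ℕn+[a/ℕn]*n; n%ℕd<d)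
import Data.Integer.Properties as ℤP
open import Data.Integer.Tactic.RingSolver using (solve-∀)
open import Data.List using (List; []; _∷_; map; _++_; _∷ʳ_; upTo; applyUpTo; concatMap; length)
import Data.List.Properties as ListP
open import Data.List.Membership.Propositional using (_∈_; find; lose)
open import Data.List.Membership.Propositional.Properties using (∈-map⁺; ∈-map⁻; ∈-++⁺ˡ; ∈-++⁺ʳ; ∈-++⁻; ∈-concatMap⁺; ∈-concatMap⁻; ∈-applyUpTo⁺; ∈-applyUpTo⁻; ∈-upTo⁺; ∈-upTo⁻)
open import Data.List.Membership.Propositional.Properties.WithK using (unique∧set⇒bag)
open import Data.List.Relation.Binary.BagAndSetEquality using (∼bag⇒↭)
open import Data.List.Relation.Binary.Permutation.Propositional as Perm using (_↭_)
open import Data.List.Relation.Unary.All as All using (All; []; _∷_)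
open import Data.List.Relation.Unary.All.Properties using (++⁻)
open import Data.List.Relation.Unary.AllPairs using ([]; _∷_)
open import Data.List.Relation.Unary.Any using (here; there)
open import Data.List.Relation.Unary.Unique.Propositional using (Unique)
import Data.List.Relation.Unary.Unique.Propositional.Properties as Unique
open import Data.Maybe using (Maybe; just; nothing)
open import Data.Nat as ℕ using (ℕ; zero; suc; _≤_; _<_; z≤n; s≤s; _!)
open import Data.Nat.DivMod using (m*n/n≡m)
open import Data.Nat.Induction using (<-wellFounded)
open import Data.Nat.ListAction using (sum)
open import Data.Nat.ListAction.Properties using (sum-++)
import Data.Nat.Properties as ℕP
open import Data.Nat.Tactic.RingSolver using () renaming (solve-∀ to solveℕ-∀)
open import Data.Product using (_×_; _,_; proj₁; proj₂; ∃)
open import Data.Sum as Sum using (_⊎_; inj₁; inj₂)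
open import Data.Unit using (tt)
open import Function using (_∘_; id; mk⇔; Equivalence)
open import Induction.WellFounded using (Acc; acc)
open import Relation.Nullary using (¬_; yes; no; contradiction)
import Relation.Binary.PropositionalEquality as ≡
open import Relation.Binary.PropositionalEquality using (_≡_)

-- The variable z never appears. Each series of pairs depends on a function `w` on ranks, with the
-- functional zᵐ ↦ w m already applied. Multiplication by z or z⁻¹ shifts the argument of `w`, so
-- each factor of the rank generating function becomes a linear recurrence between series in q
-- alone, and y becomes the central second difference of `w`. Power series are compared coefficient
-- by coefficient. The q-identities are therefore proved over an arbitrary commutative ring with
-- opaque elements for qⁿ and 1/(1 - qⁿ⁺¹), so that the ring solver never meets a convolution.
-- Reciprocals 1/(q)_k with k < 0 are read as 0, which gives all sums over n a common range. For the
-- Laurent series the obstacle is negative n. There the power of 1 - qⁿ in the denominator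
-- contributes enough positive powers of q to make every summand a power series, so both finite sums
-- reduce to one power series.

module QSeries (R : CommutativeRing 0ℓ 0ℓ)
  (hom : CommutativeRing.rawRing ℤP.+-*-commutativeRing -Raw-AlmostCommutative⟶ fromCommutativeRing R) where

  open CommutativeRing R hiding (zero)
  open import Relation.Binary.Reasoning.Setoid setoid
  open import Algebra.Properties.Semiring.Exp semiring using (_^_; ^-assocʳ; ^-congˡ)
  private module H = _-Raw-AlmostCommutative⟶_ hom

  -- Unlike hom, this sends 0ℤ and 1ℤ to 0# and 1# definitionally, as the solver needs.
  private
    ι : ℤ → Carrier
    ι (ℤ.+ 0)             = 0#
    ι (ℤ.+ 1)             = 1#
    ι (ℤ.+ (suc (suc n))) = H.⟦ ℤ.+ (suc (suc n)) ⟧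
    ι ℤ.-[1+ n ]          = H.⟦ ℤ.-[1+ n ] ⟧

    ι≈ : ∀ c → ι c ≈ H.⟦ c ⟧
    ι≈ (ℤ.+ 0)             = sym H.0-homo
    ι≈ (ℤ.+ 1)             = sym H.1-homo
    ι≈ (ℤ.+ (suc (suc n))) = refl
    ι≈ ℤ.-[1+ n ]          = refl

    ιhom : CommutativeRing.rawRing ℤP.+-*-commutativeRing -Raw-AlmostCommutative⟶ fromCommutativeRing R
    ιhom = record
      { ⟦_⟧    = ι
      ; +-homo = λ a b → trans (ι≈ (a ℤ.+ b)) (trans (H.+-homo a b) (sym (+-cong (ι≈ a) (ι≈ b))))
      ; *-homo = λ a b → trans (ι≈ (a ℤ.* b)) (trans (H.*-homo a b) (sym (*-cong (ι≈ a) (ι≈ b))))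
      ; -‿homo = λ a → trans (ι≈ (ℤ.- a)) (trans (H.-‿homo a) (sym (-‿cong (ι≈ a))))
      ; 0-homo = refl
      ; 1-homo = refl
      }


    weaklyDec : ∀ a b → Maybe (ι a ≈ ι b)
    weaklyDec a b with a ℤP.≟ b
    ... | yes ≡.refl = just refl
    ... | no _       = nothing

  open import Algebra.Solver.Ring (CommutativeRing.rawRing ℤP.+-*-commutativeRing) (fromCommutativeRing R) ιhom weaklyDec
    using (solve; _:+_; _:*_; _:-_; :-_; con; _:=_)

  -- Finite sums and units in a commutative ring.

  ΣR : ℕ → (ℕ → Carrier) → Carrier
  ΣR zero    f = 0#
  ΣR (suc n) f = f 0 + ΣR n (f ∘ suc)

  ΣR-cong< : ∀ n {f g} → (∀ i → i < n → f i ≈ g i) → ΣR n f ≈ ΣR n g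
  ΣR-cong< zero    h = refl
  ΣR-cong< (suc n) h = +-cong (h 0 (s≤s z≤n)) (ΣR-cong< n (λ i i<n → h (suc i) (s≤s i<n)))

  ΣR-cong : ∀ n {f g} → (∀ i → f i ≈ g i) → ΣR n f ≈ ΣR n g
  ΣR-cong n h = ΣR-cong< n (λ i _ → h i)

  ΣR-0 : ∀ n → ΣR n (λ _ → 0#) ≈ 0#
  ΣR-0 zero    = refl
  ΣR-0 (suc n) = trans (+-identityˡ _) (ΣR-0 n)

  ΣR-+ : ∀ n (f g : ℕ → Carrier) → ΣR n (λ i → f i + g i) ≈ ΣR n f + ΣR n g
  ΣR-+ zero    f g = sym (+-identityˡ 0#)
  ΣR-+ (suc n) f g = trans (+-congˡ (ΣR-+ n (f ∘ suc) (g ∘ suc)))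
    (solve 4 (λ a b c d → (a :+ b) :+ (c :+ d) := (a :+ c) :+ (b :+ d)) refl _ _ _ _)

  ΣR-*ˡ : ∀ n c (f : ℕ → Carrier) → ΣR n (λ i → c * f i) ≈ c * ΣR n f
  ΣR-*ˡ zero    c f = sym (zeroʳ c)
  ΣR-*ˡ (suc n) c f = trans (+-congˡ (ΣR-*ˡ n c (f ∘ suc))) (sym (distribˡ c _ _))

  ΣR-swap : ∀ m n (f : ℕ → ℕ → Carrier) → ΣR m (λ i → ΣR n (f i)) ≈ ΣR n (λ j → ΣR m (λ i → f i j))
  ΣR-swap zero    n f = sym (ΣR-0 n)
  ΣR-swap (suc m) n f = trans (+-congˡ (ΣR-swap m n (f ∘ suc))) (sym (ΣR-+ n (f 0) _))

  ΣR-last : ∀ n (f : ℕ → Carrier) → ΣR (suc n) f ≈ ΣR n f + f n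
  ΣR-last zero    f = trans (+-identityʳ _) (sym (+-identityˡ _))
  ΣR-last (suc n) f = trans (+-congˡ (ΣR-last n (f ∘ suc))) (sym (+-assoc _ _ _))

  ΣR-telescope : ∀ n (r : ℕ → Carrier) → ΣR n (λ i → r i - r (suc i)) ≈ r 0 - r n
  ΣR-telescope zero    r = sym (-‿inverseʳ (r 0))
  ΣR-telescope (suc n) r = trans (+-congˡ (ΣR-telescope n (r ∘ suc)))
    (solve 3 (λ a b c → (a :- b) :+ (b :- c) := a :- c) refl _ _ _)

  ΣR-drop : ∀ m n (f : ℕ → Carrier) → (∀ i → i < m → f i ≈ 0#) → ΣR (m ℕ.+ n) f ≈ ΣR n (λ i → f (m ℕ.+ i))
  ΣR-drop zero    n f h = refl
  ΣR-drop (suc m) n f h = trans (+-congʳ (h 0 (s≤s z≤n))) (trans (+-identityˡ _)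
    (ΣR-drop m n (f ∘ suc) (λ i i<m → h (suc i) (s≤s i<m))))

  inverse-unique : ∀ {a b c} → a * b ≈ 1# → a * c ≈ 1# → b ≈ c
  inverse-unique {a} {b} {c} ab ac = begin
    b           ≈⟨ *-identityʳ b ⟨
    b * 1#      ≈⟨ *-congˡ ac ⟨
    b * (a * c) ≈⟨ solve 3 (λ a b c → b :* (a :* c) := (a :* b) :* c) refl a b c ⟩
    (a * b) * c ≈⟨ *-congʳ ab ⟩
    1# * c      ≈⟨ *-identityˡ c ⟩
    c           ∎

  cancel-unit : ∀ {a v} → a * v ≈ 1# → ∀ {x y} → a * x ≈ y → x ≈ v * y
  cancel-unit {a} {v} av {x} {y} ax = begin
    x            ≈⟨ *-identityˡ x ⟨
    1# * x       ≈⟨ *-congʳ av ⟨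
    (a * v) * x  ≈⟨ solve 3 (λ a v x → (a :* v) :* x := v :* (a :* x)) refl a v x ⟩
    v * (a * x)  ≈⟨ *-congˡ ax ⟩
    v * y        ∎

  -- This is (1 - Qz)(1 - Qz⁻¹) = (1 - Q)² - Qy with y = z - 2 + z⁻¹, where `Y⁺` and `Y⁻` stand for
  -- zY and z⁻¹Y. The first three hypotheses remove the two factors, from `Y` to `V` to `Z`; the
  -- last one says that `Y′` is yY.
  second-difference : ∀ {Q Y Y⁺ Y⁻ V V⁺ Z Y′} → Y ≈ V + Q * Y⁻ → V ≈ Z + Q * V⁺ → Y⁺ ≈ V⁺ + Q * Y →
    Y⁺ + Y⁻ ≈ Y + Y + Y′ → (1# - Q) * (1# - Q) * Y ≈ Z + Q * Y′
  second-difference {Q} {Y} {Y⁺} {Y⁻} {V} {V⁺} {Z} {Y′} hY hV hY⁺ hΔ = begin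
    (1# - Q) * (1# - Q) * Y
      ≈⟨ solve 4 (λ Q Y P M → (con 1ℤ :- Q) :* (con 1ℤ :- Q) :* Y
           := ((Y :- Q :* M) :- Q :* (P :- Q :* Y)) :+ Q :* ((P :+ M) :- (Y :+ Y))) refl Q Y Y⁺ Y⁻ ⟩
    ((Y - Q * Y⁻) - Q * (Y⁺ - Q * Y)) + Q * ((Y⁺ + Y⁻) - (Y + Y))
      ≈⟨ +-cong (+-cong (move hY) (-‿cong (*-congˡ (move hY⁺)))) (*-congˡ (trans (+-congʳ (trans hΔ (+-comm _ _))) (move refl))) ⟩
    (V - Q * V⁺) + Q * Y′
      ≈⟨ +-congʳ (move hV) ⟩
    Z + Q * Y′ ∎
    where
    move : ∀ {a b c} → a ≈ b + c → a - c ≈ b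
    move {a} {b} {c} h = trans (+-congʳ h) (solve 2 (λ b c → (b :+ c) :- c := b) refl b c)

  unit-pow : ∀ {a b} → a * b ≈ 1# → ∀ k → a ^ k * b ^ k ≈ 1#
  unit-pow         ab zero    = *-identityˡ 1#
  unit-pow {a} {b} ab (suc k) = begin
    a * a ^ k * (b * b ^ k)    ≈⟨ solve 4 (λ a b c d → a :* c :* (b :* d) := (a :* b) :* (c :* d)) refl a b _ _ ⟩
    a * b * (a ^ k * b ^ k)    ≈⟨ *-cong ab (unit-pow ab k) ⟩
    1# * 1#                    ≈⟨ *-identityˡ 1# ⟩
    1#                         ∎

  pow-double : ∀ a ν → a ^ (2 ℕ.* ν) ≈ (a * a) ^ ν
  pow-double a ν = trans (sym (^-assocʳ a 2 ν)) (^-congˡ ν (*-congˡ (*-identityʳ a)))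

  neg*neg : ∀ a b → (- a) * (- b) ≈ a * b
  neg*neg = solve 2 (λ a b → (:- a) :* (:- b) := a :* b) refl

  pow-double-neg : ∀ a ν → (- a) ^ (2 ℕ.* ν) ≈ a ^ (2 ℕ.* ν)
  pow-double-neg a ν = trans (pow-double (- a) ν) (trans (^-congˡ ν (neg*neg a a)) (sym (pow-double a ν)))

  subtract-multiple : ∀ p f x → p * f - p * (x * f) ≈ (1# - x) * p * f
  subtract-multiple = solve 3 (λ p f x → p :* f :- p :* (x :* f) := (con 1ℤ :- x) :* p :* f) refl

  -- The number n(n - 1)/2, not n(n + 1)/2.
  tri : ℕ → ℕ
  tri zero    = 0
  tri (suc n) = n ℕ.+ tri n

  alt : ℕ → Carrier
  alt zero    = 1#
  alt (suc n) = - alt n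

  -- q n stands for qⁿ and v n for 1/(1 - qⁿ⁺¹).
  module Identities (q v : ℕ → Carrier) (q-zero : q 0 ≈ 1#)
    (q-+ : ∀ a b → q (a ℕ.+ b) ≈ q a * q b)
    (v-inv : ∀ n → (1# - q (suc n)) * v n ≈ 1#) where

    -- Reciprocals of q-factorials and the partial fraction sums.

    u : ℕ → Carrier
    u n = 1# - q n

    e : ℕ → Carrier
    e zero    = 1#
    e (suc k) = v k * e k

    -- ē j n is 1/(q)_{j-n}, read as 0 when n > j.
    ē : ℕ → ℕ → Carrier
    ē j       zero    = e j
    ē zero    (suc n) = 0#
    ē (suc j) (suc n) = ē j n

    u*e : ∀ k → u (suc k) * e (suc k) ≈ e k
    u*e k = trans (sym (*-assoc _ _ _)) (trans (*-congʳ (v-inv k)) (*-identityˡ _))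

    ē-above : ∀ {j n} → j < n → ē j n ≈ 0#
    ē-above {zero}  {suc n} _       = refl
    ē-above {suc j} {suc n} (s≤s p) = ē-above p

    ē-+ : ∀ n d → ē (n ℕ.+ d) n ≡ e d
    ē-+ zero    d = ≡.refl
    ē-+ (suc n) d = ē-+ n d

    ē-∸ : ∀ {N n} → n ≤ N → ē N n ≡ e (N ℕ.∸ n)
    ē-∸ z≤n     = ≡.refl
    ē-∸ (s≤s p) = ē-∸ p

    ē-+ₗ : ∀ n d i → ē (n ℕ.+ d) (n ℕ.+ i) ≡ ē d i
    ē-+ₗ zero    d i = ≡.refl
    ē-+ₗ (suc n) d i = ē-+ₗ n d i

    q-suc-+ : ∀ j n → q (suc (j ℕ.+ n)) ≈ q j * q (suc n)
    q-suc-+ j n = trans (reflexive (≡.cong q (≡.sym (ℕP.+-suc j n)))) (q-+ j (suc n))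

    -- Comes from 1/(q)_{j-n-1} = (1 - q^{j-n})/(q)_{j-n}. The factor qⁿ removes the difference j -
    -- n from the exponent, so the equation also makes sense for n ≥ j, where both sides are 0.
    ē-down : ∀ j n → q n * ē j (suc n) ≈ (q n - q j) * ē j n
    ē-down zero zero = trans (zeroʳ _) (sym (trans (*-congʳ (-‿inverseʳ _)) (zeroˡ _)))
    ē-down (suc j) zero = begin
      q 0 * e j                          ≈⟨ *-cong q-zero (sym (u*e j)) ⟩
      1# * ((1# - q (suc j)) * e (suc j)) ≈⟨ *-identityˡ _ ⟩
      (1# - q (suc j)) * e (suc j)       ≈⟨ *-congʳ (+-congʳ q-zero) ⟨
      (q 0 - q (suc j)) * e (suc j)      ∎
    ē-down zero (suc n) = trans (zeroʳ _) (sym (zeroʳ _))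
    ē-down (suc j) (suc n) = begin
      q (suc n) * ē j (suc n)          ≈⟨ *-congʳ (q-+ 1 n) ⟩
      q 1 * q n * ē j (suc n)          ≈⟨ *-assoc _ _ _ ⟩
      q 1 * (q n * ē j (suc n))        ≈⟨ *-congˡ (ē-down j n) ⟩
      q 1 * ((q n - q j) * ē j n)      ≈⟨ solve 4 (λ a b c d → a :* ((b :- c) :* d) := (a :* b :- a :* c) :* d) refl _ _ _ _ ⟩
      (q 1 * q n - q 1 * q j) * ē j n  ≈⟨ *-congʳ (+-cong (q-+ 1 n) (-‿cong (q-+ 1 j))) ⟨
      (q (suc n) - q (suc j)) * ē j n  ∎

    -- The argument n of c, x and qTerm, like the summation variable of F, stands for the index n + 1.
    c : ℕ → Carrier
    c n = alt n * (1# + q (suc n)) * q (tri (suc n))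

    x : ℕ → Carrier
    x n = q (suc n) * (v n * v n)

    F : ℕ → ℕ → ℕ → Carrier
    F J j ν = ΣR J (λ n → c n * x n ^ ν * (ē j (suc n) * e (j ℕ.+ suc n)))

    -- With P = q^{j+1} and Q = q^{n+1} the core is Q(1 - P)² = P(1 - Q)² + (Q - P)(1 - PQ). Here (1
    -- - Q)² cancels against V², 1 - PQ against the top factor `K` of `e`, and Q - P is absorbed by
    -- `ē-down`, so that j + 1 drops to j in both reciprocals.
    F-term : ∀ j n → u (suc j) * u (suc j) * (x n * (ē (suc j) (suc n) * e (suc j ℕ.+ suc n)))
      ≈ q (suc j) * (ē (suc j) (suc n) * e (suc j ℕ.+ suc n)) + x n * (ē j (suc n) * e (j ℕ.+ suc n))
    F-term j n = begin
      (1# - P) * (1# - P) * (Q * (V * V) * (E * (K * k)))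
        ≈⟨ solve 6 (λ P Q V E K k →
             (con 1ℤ :- P) :* (con 1ℤ :- P) :* (Q :* (V :* V) :* (E :* (K :* k)))
             := P :* (E :* (K :* k)) :* (((con 1ℤ :- Q) :* V) :* ((con 1ℤ :- Q) :* V))
                :+ V :* V :* (((Q :- P) :* E) :* k) :* ((con 1ℤ :- P :* Q) :* K)) refl P Q V E K k ⟩
      P * (E * (K * k)) * (((1# - Q) * V) * ((1# - Q) * V)) + V * V * (((Q - P) * E) * k) * ((1# - P * Q) * K)
        ≈⟨ +-cong (*-congˡ (*-cong (v-inv n) (v-inv n)))
             (*-cong (*-congˡ (*-congʳ (sym (ē-down (suc j) (suc n))))) K-inv) ⟩
      P * (E * (K * k)) * (1# * 1#) + V * V * ((Q * E′) * k) * 1#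
        ≈⟨ solve 7 (λ P Q V E E′ K k → P :* (E :* (K :* k)) :* (con 1ℤ :* con 1ℤ) :+ V :* V :* ((Q :* E′) :* k) :* con 1ℤ
             := P :* (E :* (K :* k)) :+ Q :* (V :* V) :* (E′ :* k)) refl P Q V E E′ K k ⟩
      P * (E * (K * k)) + Q * (V * V) * (E′ * k) ∎
      where
      P = q (suc j); Q = q (suc n); V = v n
      E = ē (suc j) (suc n); E′ = ē j (suc n)
      K = v (j ℕ.+ suc n); k = e (j ℕ.+ suc n)
      K-inv : (1# - P * Q) * K ≈ 1#
      K-inv = trans (*-congʳ (+-congˡ (-‿cong (sym (q-+ (suc j) (suc n)))))) (v-inv (j ℕ.+ suc n))

    F-step : ∀ J j ν → u (suc j) * u (suc j) * F J (suc j) (suc ν) ≈ q (suc j) * F J (suc j) ν + F J j (suc ν)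
    F-step J j ν = begin
      U * F J (suc j) (suc ν)
        ≈⟨ ΣR-*ˡ J U _ ⟨
      ΣR J (λ n → U * (c n * (x n * x n ^ ν) * A n))
        ≈⟨ ΣR-cong J (λ n → trans
             (solve 5 (λ U c x y A → U :* (c :* (x :* y) :* A) := c :* y :* (U :* (x :* A))) refl U (c n) (x n) (x n ^ ν) (A n))
             (trans (*-congˡ (F-term j n))
             (solve 6 (λ c y P A x B → c :* y :* (P :* A :+ x :* B) := P :* (c :* y :* A) :+ c :* (x :* y) :* B) refl
               (c n) (x n ^ ν) (q (suc j)) (A n) (x n) (B n)))) ⟩
      ΣR J (λ n → q (suc j) * (c n * x n ^ ν * A n) + c n * (x n * x n ^ ν) * B n)
        ≈⟨ ΣR-+ J _ _ ⟩
      ΣR J (λ n → q (suc j) * (c n * x n ^ ν * A n)) + F J j (suc ν)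
        ≈⟨ +-congʳ (ΣR-*ˡ J _ _) ⟩
      q (suc j) * F J (suc j) ν + F J j (suc ν) ∎
      where
      U = u (suc j) * u (suc j)
      A B : ℕ → Carrier
      A n = ē (suc j) (suc n) * e (suc j ℕ.+ suc n)
      B n = ē j (suc n) * e (j ℕ.+ suc n)

    -- Each summand is a difference of consecutive values of `r`, by (1 + Q)(1 - P) = (1 - PQ) + (Q
    -- - P): the first part cancels a factor of `e`, the second raises m through `ē-down`. Since j <
    -- J, `r` vanishes at the upper end.
    F-zero : ∀ J j → j < J → F J (suc j) 0 ≈ e (suc j) * e (suc j)
    F-zero J j j<J = begin
      F J (suc j) 0                        ≈⟨ ΣR-cong J term ⟩
      ΣR J (λ m → r m - r (suc m))         ≈⟨ ΣR-telescope J r ⟩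
      r 0 - r J                            ≈⟨ +-congˡ (-‿cong r-end) ⟩
      r 0 - 0#                             ≈⟨ +-cong r-start (-‿cong refl) ⟩
      e (suc j) * e (suc j) - 0#           ≈⟨ solve 1 (λ a → a :- con 0ℤ := a) refl _ ⟩
      e (suc j) * e (suc j)                ∎
      where
      r : ℕ → Carrier
      r m = alt m * q (tri (suc m)) * (ē (suc j) (suc m) * e (suc j ℕ.+ m)) * v j
      r-end : r J ≈ 0#
      r-end = trans (*-congʳ (*-congˡ (*-congʳ (ē-above j<J))))
        (solve 3 (λ a b c → a :* (con 0ℤ :* b) :* c := con 0ℤ) refl _ _ _)
      r-start : r 0 ≈ e (suc j) * e (suc j)
      r-start = begin
        1# * q 0 * (e j * e (suc j ℕ.+ 0)) * v j
          ≈⟨ *-congʳ (*-cong (trans (*-identityˡ _) q-zero) (*-congˡ (reflexive (≡.cong (e ∘ suc) (ℕP.+-identityʳ j))))) ⟩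
        1# * (e j * e (suc j)) * v j
          ≈⟨ solve 3 (λ a b c → con 1ℤ :* (a :* b) :* c := (c :* a) :* b) refl _ _ _ ⟩
        v j * e j * e (suc j) ∎
      term : ∀ m → c m * 1# * (ē (suc j) (suc m) * e (suc j ℕ.+ suc m)) ≈ r m - r (suc m)
      term m = begin
        a * (1# + Q) * t * 1# * (E * e (suc j ℕ.+ suc m))
          ≈⟨ *-congˡ (*-congˡ ek) ⟩
        a * (1# + Q) * t * 1# * (E * (K * k))
          -- The factor (1 - P) / (1 - P) is inserted to make the numerator (1 + Q)(1 - P), which
          -- can be split.
          ≈⟨ trans (solve 1 (λ z → z := z :* con 1ℤ) refl _) (*-congˡ (sym (v-inv j))) ⟩
        a * (1# + Q) * t * 1# * (E * (K * k)) * ((1# - P) * v j)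
          ≈⟨ solve 8 (λ a Q t E K k P V → a :* (con 1ℤ :+ Q) :* t :* con 1ℤ :* (E :* (K :* k)) :* ((con 1ℤ :- P) :* V)
               := a :* t :* (E :* (((con 1ℤ :- P :* Q) :* K) :* k)) :* V :+ a :* t :* (((Q :- P) :* E) :* (K :* k)) :* V)
               refl a Q t E K k P (v j) ⟩
        a * t * (E * (((1# - P * Q) * K) * k)) * v j + a * t * (((Q - P) * E) * (K * k)) * v j
          ≈⟨ +-cong (*-congʳ (*-congˡ (*-congˡ (*-congʳ K-inv)))) (*-congʳ (*-congˡ (*-congʳ (sym (ē-down (suc j) (suc m)))))) ⟩
        a * t * (E * (1# * k)) * v j + a * t * ((Q * E₂) * (K * k)) * v j
          ≈⟨ solve 8 (λ a Q t E E₂ K k V → a :* t :* (E :* (con 1ℤ :* k)) :* V :+ a :* t :* ((Q :* E₂) :* (K :* k)) :* V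
               := a :* t :* (E :* k) :* V :- (:- a) :* (Q :* t) :* (E₂ :* (K :* k)) :* V) refl a Q t E E₂ K k (v j) ⟩
        a * t * (E * k) * v j - (- a) * (Q * t) * (E₂ * (K * k)) * v j
          ≈⟨ +-congˡ (-‿cong (*-congʳ (*-cong (*-congˡ (sym (q-+ (suc m) (tri (suc m))))) (*-congˡ (sym ek))))) ⟩
        r m - r (suc m) ∎
        where
        a = alt m; Q = q (suc m); t = q (tri (suc m)); P = q (suc j)
        E = ē (suc j) (suc m); E₂ = ē (suc j) (suc (suc m))
        K = v (suc j ℕ.+ m); k = e (suc j ℕ.+ m)
        ek : e (suc j ℕ.+ suc m) ≈ K * k
        ek = reflexive (≡.cong e (ℕP.+-suc (suc j) m))
        K-inv : (1# - P * Q) * K ≈ 1#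
        K-inv = trans (*-congʳ (+-congˡ (-‿cong (sym (q-suc-+ (suc j) m))))) (v-inv (suc j ℕ.+ m))

    -- The limiting q-Vandermonde sum.

    chuSum : ℕ → ℕ → ℕ → Carrier
    chuSum K M a = ΣR K (λ i → q (i ℕ.* (i ℕ.+ a)) * (ē M i * e i * e (i ℕ.+ a)))

    -- The q-Pascal rule for Gaussian binomial coefficients, divided by (q)_M: 1 - q^{M+1} splits
    -- into (q^{i+1} - q^{M+1}) + (1 - q^{i+1}).
    s-suc : ∀ M i → u (suc M) * (ē M i * e (suc i)) ≈ q (suc i) * (ē M (suc i) * e (suc i)) + ē M i * e i
    s-suc M i = begin
      u (suc M) * (ē M i * e (suc i))
        ≈⟨ solve 4 (λ S E f Q → (con 1ℤ :- S) :* (E :* f) := ((Q :- S) :* E) :* f :+ E :* ((con 1ℤ :- Q) :* f)) refl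
             (q (suc M)) (ē M i) (e (suc i)) (q (suc i)) ⟩
      ((q (suc i) - q (suc M)) * ē M i) * e (suc i) + ē M i * (u (suc i) * e (suc i))
        ≈⟨ +-cong (*-congʳ (sym (ē-down (suc M) (suc i)))) (*-congˡ (u*e i)) ⟩
      (q (suc i) * ē M (suc i)) * e (suc i) + ē M i * e i
        ≈⟨ +-congʳ (*-assoc _ _ _) ⟩
      q (suc i) * (ē M (suc i) * e (suc i)) + ē M i * e i ∎

    -- Trades a unit of M for a unit of a. The q-Pascal rule splits summand i + 1 into a piece that
    -- keeps its index, `A (suc i)`, and a piece `B i` that moves to index i. There `A i` and `B i`
    -- carry the weights 1 - g and g with g = q^{i+a+1}, so they add up to one summand for a + 1.
    chuSum-step : ∀ M a → u (suc M) * chuSum (2 ℕ.+ M) (suc M) a ≈ chuSum (suc M) M (suc a)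
    chuSum-step M a = begin
      U * (f 0 + ΣR K (f ∘ suc))
        ≈⟨ distribˡ U _ _ ⟩
      U * f 0 + U * ΣR K (f ∘ suc)
        ≈⟨ +-cong head (trans (sym (ΣR-*ˡ K U (f ∘ suc))) (ΣR-cong K step)) ⟩
      A 0 + ΣR K (λ i → A (suc i) + B i)
        ≈⟨ +-congˡ (ΣR-+ K (A ∘ suc) B) ⟩
      A 0 + (ΣR K (A ∘ suc) + ΣR K B)
        ≈⟨ +-assoc _ _ _ ⟨
      ΣR (suc K) A + ΣR K B
        ≈⟨ +-congʳ (trans (ΣR-last K A) (trans (+-congˡ A-last) (+-identityʳ _))) ⟩
      ΣR K A + ΣR K B
        ≈⟨ ΣR-+ K A B ⟨
      ΣR K (λ i → A i + B i)
        ≈⟨ ΣR-cong K merge ⟩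
      chuSum K M (suc a) ∎
      where
      K = suc M
      U = u (suc M)
      f A B : ℕ → Carrier
      f i = q (i ℕ.* (i ℕ.+ a)) * (ē (suc M) i * e i * e (i ℕ.+ a))
      A i = q (i ℕ.* (i ℕ.+ a)) * (q i * (ē M i * e i)) * e (i ℕ.+ a)
      B i = q (suc i ℕ.* (suc i ℕ.+ a)) * (ē M i * e i) * e (suc (i ℕ.+ a))
      head : U * f 0 ≈ A 0
      head = begin
        U * (q 0 * (e (suc M) * 1# * e a))
          ≈⟨ solve 4 (λ U z m a → U :* (z :* (m :* con 1ℤ :* a)) := z :* (con 1ℤ :* ((U :* m) :* con 1ℤ)) :* a) refl _ _ _ _ ⟩
        q 0 * (1# * (U * e (suc M) * 1#)) * e a
          ≈⟨ *-congʳ (*-congˡ (*-cong (sym q-zero) (*-congʳ (u*e M)))) ⟩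
        q 0 * (q 0 * (e M * 1#)) * e a ∎
      step : ∀ i → U * f (suc i) ≈ A (suc i) + B i
      step i = begin
        U * (z * (ē M i * e (suc i) * w))
          ≈⟨ solve 4 (λ U z s w → U :* (z :* (s :* w)) := z :* (U :* s) :* w) refl _ _ _ _ ⟩
        z * (U * (ē M i * e (suc i))) * w
          ≈⟨ *-congʳ (*-congˡ (s-suc M i)) ⟩
        z * (q (suc i) * (ē M (suc i) * e (suc i)) + ē M i * e i) * w
          ≈⟨ solve 4 (λ z a b w → z :* (a :+ b) :* w := z :* a :* w :+ z :* b :* w) refl _ _ _ _ ⟩
        A (suc i) + B i ∎
        where
        z = q (suc i ℕ.* (suc i ℕ.+ a))
        w = e (suc i ℕ.+ a)
      A-last : A K ≈ 0#
      A-last = trans (*-congʳ (*-congˡ (*-congˡ (*-congʳ (ē-above (ℕP.n<1+n M))))))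
        (solve 4 (λ a b c d → a :* (b :* (con 0ℤ :* c)) :* d := con 0ℤ) refl _ _ _ _)
      merge : ∀ i → A i + B i ≈ q (i ℕ.* (i ℕ.+ suc a)) * (ē M i * e i * e (i ℕ.+ suc a))
      merge i = begin
        z * (q i * s) * e (i ℕ.+ a) + q (suc i ℕ.* (suc i ℕ.+ a)) * s * w
          ≈⟨ +-cong (*-congˡ (sym (u*e (i ℕ.+ a)))) (*-congʳ (*-congʳ (trans (reflexive (≡.cong q (expand i a)))
               (trans (q-+ (suc (i ℕ.+ a)) _) (*-congˡ (q-+ (i ℕ.* (i ℕ.+ a)) i)))))) ⟩
        z * (q i * s) * ((1# - g) * w) + g * (z * q i) * s * w
          ≈⟨ solve 5 (λ z y s g w → z :* (y :* s) :* ((con 1ℤ :- g) :* w) :+ g :* (z :* y) :* s :* w := (z :* y) :* (s :* w)) refl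
               z (q i) s g w ⟩
        (z * q i) * (s * w)
          ≈⟨ *-cong (trans (sym (q-+ (i ℕ.* (i ℕ.+ a)) i)) (reflexive (≡.cong q (expand′ i a))))
               (*-congˡ (reflexive (≡.cong e (≡.sym (ℕP.+-suc i a))))) ⟩
        q (i ℕ.* (i ℕ.+ suc a)) * (ē M i * e i * e (i ℕ.+ suc a)) ∎
        where
        z = q (i ℕ.* (i ℕ.+ a)); s = ē M i * e i; w = e (suc (i ℕ.+ a)); g = q (suc (i ℕ.+ a))
        expand : ∀ i a → suc i ℕ.* (suc i ℕ.+ a) ≡ suc (i ℕ.+ a) ℕ.+ (i ℕ.* (i ℕ.+ a) ℕ.+ i)
        expand = solveℕ-∀
        expand′ : ∀ i a → i ℕ.* (i ℕ.+ a) ℕ.+ i ≡ i ℕ.* (i ℕ.+ suc a)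
        expand′ = solveℕ-∀

    -- Induction on M for all a at once, because each step raises a.
    chuSum-value : ∀ M a → chuSum (suc M) M a ≈ e M * e (M ℕ.+ a)
    chuSum-value zero a = begin
      q 0 * (1# * 1# * e a) + 0#  ≈⟨ +-congʳ (*-congʳ q-zero) ⟩
      1# * (1# * 1# * e a) + 0#   ≈⟨ solve 1 (λ a → con 1ℤ :* (con 1ℤ :* con 1ℤ :* a) :+ con 0ℤ := con 1ℤ :* a) refl _ ⟩
      1# * e a                    ∎
    chuSum-value (suc M) a = begin
      chuSum (2 ℕ.+ M) (suc M) a             ≈⟨ cancel-unit (v-inv M) (trans (chuSum-step M a) (chuSum-value M (suc a))) ⟩
      v M * (e M * e (M ℕ.+ suc a))     ≈⟨ *-assoc _ _ _ ⟨
      v M * e M * e (M ℕ.+ suc a)       ≈⟨ *-congˡ (reflexive (≡.cong e (ℕP.+-suc M a))) ⟩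
      v M * e M * e (suc M ℕ.+ a)       ∎

    -- Summands with j < n vanish. For j = n + i the exponent is n² + i(i + 2n), so the rest is
    -- `chuSum` with M = N - n and a = 2n.
    bailey : ∀ {N n} → n ≤ N →
      ΣR (suc N) (λ j → q (j ℕ.* j) * (ē N j * (ē j n * e (j ℕ.+ n)))) ≈ q (n ℕ.* n) * (ē N n * e (N ℕ.+ n))
    bailey {N} {n} n≤N with d , ≡.refl ← ℕP.m≤n⇒∃[o]m+o≡n n≤N = begin
      ΣR (suc (n ℕ.+ d)) g
        ≈⟨ reflexive (≡.cong (λ m → ΣR m g) (≡.sym (ℕP.+-suc n d))) ⟩
      ΣR (n ℕ.+ suc d) g
        ≈⟨ ΣR-drop n (suc d) g (λ i i<n → trans (*-congˡ (*-congˡ (*-congʳ (ē-above i<n))))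
             (solve 3 (λ a b c → a :* (b :* (con 0ℤ :* c)) := con 0ℤ) refl _ _ _)) ⟩
      ΣR (suc d) (λ i → g (n ℕ.+ i))
        ≈⟨ ΣR-cong (suc d) term ⟩
      ΣR (suc d) (λ i → q (n ℕ.* n) * (q (i ℕ.* (i ℕ.+ (n ℕ.+ n))) * (ē d i * e i * e (i ℕ.+ (n ℕ.+ n)))))
        ≈⟨ ΣR-*ˡ (suc d) _ (λ i → q (i ℕ.* (i ℕ.+ (n ℕ.+ n))) * (ē d i * e i * e (i ℕ.+ (n ℕ.+ n)))) ⟩
      q (n ℕ.* n) * chuSum (suc d) d (n ℕ.+ n)
        ≈⟨ *-congˡ (chuSum-value d (n ℕ.+ n)) ⟩
      q (n ℕ.* n) * (e d * e (d ℕ.+ (n ℕ.+ n)))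
        ≈⟨ *-congˡ (*-cong (reflexive (≡.sym (ē-+ n d))) (reflexive (≡.cong e (reorder d n)))) ⟩
      q (n ℕ.* n) * (ē (n ℕ.+ d) n * e (n ℕ.+ d ℕ.+ n)) ∎
      where
      g : ℕ → Carrier
      g j = q (j ℕ.* j) * (ē (n ℕ.+ d) j * (ē j n * e (j ℕ.+ n)))
      reorder : ∀ d n → d ℕ.+ (n ℕ.+ n) ≡ n ℕ.+ d ℕ.+ n
      reorder = solveℕ-∀
      square : ∀ n i → (n ℕ.+ i) ℕ.* (n ℕ.+ i) ≡ n ℕ.* n ℕ.+ i ℕ.* (i ℕ.+ (n ℕ.+ n))
      square = solveℕ-∀
      term : ∀ i → g (n ℕ.+ i) ≈ q (n ℕ.* n) * (q (i ℕ.* (i ℕ.+ (n ℕ.+ n))) * (ē d i * e i * e (i ℕ.+ (n ℕ.+ n))))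
      term i = begin
        g (n ℕ.+ i)
          ≈⟨ *-cong (trans (reflexive (≡.cong q (square n i))) (q-+ (n ℕ.* n) _))
               (*-cong (reflexive (ē-+ₗ n d i)) (*-cong (reflexive (ē-+ n i)) (reflexive (≡.cong e (≡.sym (reorder i n)))))) ⟩
        (q (n ℕ.* n) * q (i ℕ.* (i ℕ.+ (n ℕ.+ n)))) * (ē d i * (e i * e (i ℕ.+ (n ℕ.+ n))))
          ≈⟨ solve 5 (λ a b c d e → (a :* b) :* (c :* (d :* e)) := a :* (b :* (c :* d :* e))) refl _ _ _ _ _ ⟩
        q (n ℕ.* n) * (q (i ℕ.* (i ℕ.+ (n ℕ.+ n))) * (ē d i * e i * e (i ℕ.+ (n ℕ.+ n)))) ∎

    q-square : ∀ j → q (suc j ℕ.* suc j) ≈ q (suc (j ℕ.+ j)) * q (j ℕ.* j)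
    q-square j = trans (reflexive (≡.cong q (expand j))) (q-+ (suc (j ℕ.+ j)) _)
      where
      expand : ∀ j → suc j ℕ.* suc j ≡ suc (j ℕ.+ j) ℕ.+ j ℕ.* j
      expand = solveℕ-∀

    -- Puts the Durfee square back into a recurrence for the pairs beside and below it: (j + 1)² -
    -- j² = 2j + 1 is the extra exponent at the term of the smaller square.
    Durfee-step : ∀ j {Z Y Y′ : Carrier} → u (suc j) * u (suc j) * Y ≈ Z + q (suc j) * Y′ →
      u (suc j) * u (suc j) * (q (suc j ℕ.* suc j) * Y) ≈ q (suc j) * (q (suc j ℕ.* suc j) * Y′) + q (suc (j ℕ.+ j)) * (q (j ℕ.* j) * Z)
    Durfee-step j {Z} {Y} {Y′} h = begin
      U * (S * Y)                                                  ≈⟨ solve 3 (λ U S Y → U :* (S :* Y) := S :* (U :* Y)) refl U S Y ⟩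
      S * (U * Y)                                                  ≈⟨ *-congˡ h ⟩
      S * (Z + q (suc j) * Y′)                                     ≈⟨ solve 4 (λ S Z q Y → S :* (Z :+ q :* Y) := q :* (S :* Y) :+ S :* Z) refl S Z (q (suc j)) Y′ ⟩
      q (suc j) * (S * Y′) + S * Z                                 ≈⟨ +-congˡ (trans (*-congʳ (q-square j)) (*-assoc _ _ _)) ⟩
      q (suc j) * (S * Y′) + q (suc (j ℕ.+ j)) * (q (j ℕ.* j) * Z) ∎
      where
      U = u (suc j) * u (suc j)
      S = q (suc j ℕ.* suc j)

    -- q-factorials and the summands of the finite sums.

    poch : ℕ → Carrier
    poch zero    = 1#
    poch (suc k) = u (suc k) * poch k

    poch*e : ∀ k → poch k * e k ≈ 1#
    poch*e zero    = *-identityˡ 1#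
    poch*e (suc k) = begin
      u (suc k) * poch k * (v k * e k)    ≈⟨ solve 4 (λ u p v e → u :* p :* (v :* e) := (u :* v) :* (p :* e)) refl _ _ _ _ ⟩
      u (suc k) * v k * (poch k * e k)    ≈⟨ *-cong (v-inv k) (poch*e k) ⟩
      1# * 1#                             ≈⟨ *-identityˡ 1# ⟩
      1#                                  ∎

    prodU : List ℕ → Carrier
    prodU []       = 1#
    prodU (n ∷ ns) = u n * prodU ns

    prodU-∷ʳ : ∀ ns n → prodU (ns ∷ʳ n) ≈ u n * prodU ns
    prodU-∷ʳ []       n = refl
    prodU-∷ʳ (m ∷ ns) n = trans (*-congˡ (prodU-∷ʳ ns n)) (solve 3 (λ a b c → a :* (b :* c) := b :* (a :* c)) refl _ _ _)

    prodU-from1To : ∀ k → prodU (applyUpTo suc k) ≈ poch k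
    prodU-from1To zero    = refl
    prodU-from1To (suc k) = trans (reflexive (≡.cong prodU (≡.sym (ListP.applyUpTo-∷ʳ suc k))))
      (trans (prodU-∷ʳ (applyUpTo suc k) (suc k)) (*-congˡ (prodU-from1To k)))

    prodU-top : ∀ N j → j ≤ N → prodU (applyUpTo (N ℕ.∸_) j) ≈ poch N * ē N j
    prodU-top N       zero    _       = sym (poch*e N)
    prodU-top (suc N) (suc j) (s≤s p) = trans (*-congˡ (prodU-top N j p)) (sym (*-assoc _ _ _))

    qTerm : ℕ → ℕ → ℕ → Carrier
    qTerm N ν n = c n * x n ^ ν * (q (suc n ℕ.* suc n) * (ē N (suc n) * e (N ℕ.+ suc n)))

    -- The isolated `1#` is the series of a `qpow` whose exponent has been moved to the front. With
    -- k = n + 1 that exponent is k(k - 1)/2 + k² + νk: the first part belongs to `c`, the last to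
    -- `x`, and k² comes from `bailey`.
    middle-term : ∀ ν n {s e₁ e₂ V : Carrier} → s ≈ alt n → V ≈ (v n * v n) ^ ν →
      q (tri (suc n) ℕ.+ suc n ℕ.* suc n ℕ.+ ν ℕ.* suc n) * (s * (1# * ((1# + q (suc n)) * (e₁ * (e₂ * V)))))
      ≈ c n * x n ^ ν * (q (suc n ℕ.* suc n) * (e₂ * e₁))
    middle-term ν n {s} {e₁} {e₂} {V} s≈ V≈ = begin
      q (t ℕ.+ S ℕ.+ ν ℕ.* suc n) * (s * (1# * ((1# + Q) * (e₁ * (e₂ * V)))))
        ≈⟨ *-cong (trans (q-+ (t ℕ.+ S) _) (*-congʳ (q-+ t S))) (*-cong s≈ (*-congˡ (*-congˡ (*-congˡ (*-congˡ V≈))))) ⟩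
      q t * q S * q (ν ℕ.* suc n) * (alt n * (1# * ((1# + Q) * (e₁ * (e₂ * (v n * v n) ^ ν)))))
        ≈⟨ solve 8 (λ t S P a Q e₁ e₂ V → t :* S :* P :* (a :* (con 1ℤ :* ((con 1ℤ :+ Q) :* (e₁ :* (e₂ :* V)))))
             := a :* (con 1ℤ :+ Q) :* t :* (P :* V) :* (S :* (e₂ :* e₁))) refl _ _ _ _ _ _ _ _ ⟩
      alt n * (1# + Q) * q t * (q (ν ℕ.* suc n) * (v n * v n) ^ ν) * (q S * (e₂ * e₁))
        ≈⟨ *-congʳ (*-congˡ (x-pow ν)) ⟨
      c n * x n ^ ν * (q S * (e₂ * e₁)) ∎
      where
      t = tri (suc n); S = suc n ℕ.* suc n; Q = q (suc n)
      x-pow : ∀ ν → x n ^ ν ≈ q (ν ℕ.* suc n) * (v n * v n) ^ ν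
      x-pow zero    = sym (trans (*-identityʳ _) q-zero)
      x-pow (suc ν) = begin
        Q * (v n * v n) * x n ^ ν                             ≈⟨ *-congˡ (x-pow ν) ⟩
        Q * (v n * v n) * (q (ν ℕ.* suc n) * (v n * v n) ^ ν) ≈⟨ solve 4 (λ Q w p z → Q :* w :* (p :* z) := Q :* p :* (w :* z)) refl _ _ _ _ ⟩
        Q * q (ν ℕ.* suc n) * (v n * v n) ^ suc ν             ≈⟨ *-congʳ (q-+ (suc n) (ν ℕ.* suc n)) ⟨
        q (suc ν ℕ.* suc n) * (v n * v n) ^ suc ν             ∎

    -- With k = n + 1, the exponents at k and -k differ by k, so the two terms combine to the factor
    -- 1 + qᵏ. The reciprocals trade places because the change of sign exchanges N + k and N - k.
    right-terms : ∀ E n {s s′ e₁ e₂ V V′ : Carrier} → s′ ≈ s → V′ ≈ V →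
      q (E ℕ.+ suc n) * (s * (1# * (e₁ * (e₂ * V)))) + q E * (s′ * (1# * (e₂ * (e₁ * V′))))
      ≈ q E * (s * (1# * ((1# + q (suc n)) * (e₁ * (e₂ * V)))))
    right-terms E n s≈ V≈ = trans
      (+-cong (*-congʳ (q-+ E (suc n))) (*-congˡ (*-cong s≈ (*-congˡ (*-congˡ (*-congˡ V≈))))))
      (solve 6 (λ E Q s e₁ e₂ V → E :* Q :* (s :* (con 1ℤ :* (e₁ :* (e₂ :* V)))) :+ E :* (s :* (con 1ℤ :* (e₂ :* (e₁ :* V))))
        := E :* (s :* (con 1ℤ :* ((con 1ℤ :+ Q) :* (e₁ :* (e₂ :* V)))))) refl _ _ _ _ _ _)

    -- Solution of the recurrence for the moments.

    module Recurrence (W : ℕ → ℕ → Carrier) (W-00 : W 0 0 ≈ 1#) (W-0suc : ∀ ν → W 0 (suc ν) ≈ 0#)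
      (W-suc0 : ∀ j → u (suc j) * u (suc j) * W (suc j) 0 ≈ q (suc (j ℕ.+ j)) * W j 0)
      (W-sucsuc : ∀ j ν → u (suc j) * u (suc j) * W (suc j) (suc ν) ≈ q (suc j) * W (suc j) ν + q (suc (j ℕ.+ j)) * W j (suc ν))
      where

      uu-inv : ∀ j → u (suc j) * u (suc j) * (v j * v j) ≈ 1#
      uu-inv j = begin
        u (suc j) * u (suc j) * (v j * v j)    ≈⟨ solve 2 (λ u v → u :* u :* (v :* v) := (u :* v) :* (u :* v)) refl _ _ ⟩
        u (suc j) * v j * (u (suc j) * v j)    ≈⟨ *-cong (v-inv j) (v-inv j) ⟩
        1# * 1#                                ≈⟨ *-identityˡ 1# ⟩
        1#                                     ∎

      W-zero : ∀ j → W j 0 ≈ q (j ℕ.* j) * (e j * e j)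
      W-zero zero = begin
        W 0 0            ≈⟨ W-00 ⟩
        1#               ≈⟨ solve 0 (con 1ℤ := con 1ℤ :* (con 1ℤ :* con 1ℤ)) refl ⟩
        1# * (1# * 1#)   ≈⟨ *-congʳ q-zero ⟨
        q 0 * (1# * 1#)  ∎
      W-zero (suc j) = begin
        W (suc j) 0                                                ≈⟨ cancel-unit (uu-inv j) (W-suc0 j) ⟩
        v j * v j * (q (suc (j ℕ.+ j)) * W j 0)                    ≈⟨ *-congˡ (*-congˡ (W-zero j)) ⟩
        v j * v j * (q (suc (j ℕ.+ j)) * (q (j ℕ.* j) * (e j * e j)))
          ≈⟨ solve 4 (λ v a b e → v :* v :* (a :* (b :* (e :* e))) := (a :* b) :* ((v :* e) :* (v :* e))) refl _ _ _ _ ⟩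
        (q (suc (j ℕ.+ j)) * q (j ℕ.* j)) * (e (suc j) * e (suc j)) ≈⟨ *-congʳ (q-square j) ⟨
        q (suc j ℕ.* suc j) * (e (suc j) * e (suc j))              ∎

      -- At j = ν = 0 the formula fails: W 0 0 is 1 and the sum `F` is 0. Hence the split into ν + 1
      -- with any j, here, and j + 1 with any ν, in `W≈F-suc`; the recurrence at (j + 1, ν + 1)
      -- refers only to these two ranges.
      W≈F : ∀ J j ν → j ≤ J → W j (suc ν) ≈ q (j ℕ.* j) * F J j (suc ν)

      W≈F-suc : ∀ J j ν → j < J → W (suc j) ν ≈ q (suc j ℕ.* suc j) * F J (suc j) ν
      W≈F-suc J j zero    j<J = trans (W-zero (suc j)) (*-congˡ (sym (F-zero J j j<J)))
      W≈F-suc J j (suc ν) j<J = W≈F J (suc j) ν j<J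

      W≈F J zero ν _ = begin
        W 0 (suc ν)           ≈⟨ W-0suc ν ⟩
        0#                    ≈⟨ zeroʳ _ ⟨
        q 0 * 0#              ≈⟨ *-congˡ (ΣR-0 J) ⟨
        q 0 * ΣR J (λ _ → 0#) ≈⟨ *-congˡ (ΣR-cong J (λ n → solve 2 (λ a b → con 0ℤ := a :* (con 0ℤ :* b)) refl _ _)) ⟩
        q 0 * F J 0 (suc ν)   ∎
      W≈F J (suc j) ν j<J = begin
        W (suc j) (suc ν)
          ≈⟨ cancel-unit (uu-inv j) (W-sucsuc j ν) ⟩
        v j * v j * (q (suc j) * W (suc j) ν + q (suc (j ℕ.+ j)) * W j (suc ν))
          ≈⟨ *-congˡ (+-cong (*-congˡ (W≈F-suc J j ν j<J)) (*-congˡ (W≈F J j ν (ℕP.<⇒≤ j<J)))) ⟩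
        v j * v j * (q (suc j) * (q (suc j ℕ.* suc j) * F J (suc j) ν) + q (suc (j ℕ.+ j)) * (q (j ℕ.* j) * F J j (suc ν)))
          ≈⟨ *-congˡ (+-congˡ (trans (sym (*-assoc _ _ _)) (*-congʳ (sym (q-square j))))) ⟩
        v j * v j * (q (suc j) * (q (suc j ℕ.* suc j) * F J (suc j) ν) + q (suc j ℕ.* suc j) * F J j (suc ν))
          ≈⟨ solve 5 (λ v a s f g → v :* (a :* (s :* f) :+ s :* g) := s :* (v :* (a :* f :+ g))) refl _ _ _ _ _ ⟩
        q (suc j ℕ.* suc j) * (v j * v j * (q (suc j) * F J (suc j) ν + F J j (suc ν)))
          ≈⟨ *-congˡ (cancel-unit (uu-inv j) (F-step J j ν)) ⟨
        q (suc j ℕ.* suc j) * F J (suc j) (suc ν) ∎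

      ΣW : ∀ N ν → ΣR N (λ j → ē N (suc j) * W (suc j) (suc ν))
        ≈ ΣR N (qTerm N (suc ν))
      ΣW N ν = begin
        ΣR N (λ j → ē N (suc j) * W (suc j) (suc ν))
          -- The range of `F` is taken to be N for every j, which makes the double sum rectangular.
          ≈⟨ ΣR-cong< N (λ j j<N → *-congˡ (W≈F N (suc j) ν j<N)) ⟩
        ΣR N (λ j → ē N (suc j) * (q (suc j ℕ.* suc j) * F N (suc j) (suc ν)))
          ≈⟨ ΣR-cong N (λ j → trans (sym (*-assoc _ _ _)) (sym (ΣR-*ˡ N _ _))) ⟩
        ΣR N (λ j → ΣR N (λ n → ē N (suc j) * q (suc j ℕ.* suc j) * (y n * (ē (suc j) (suc n) * e (suc j ℕ.+ suc n)))))
          ≈⟨ ΣR-swap N N _ ⟩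
        ΣR N (λ n → ΣR N (λ j → ē N (suc j) * q (suc j ℕ.* suc j) * (y n * (ē (suc j) (suc n) * e (suc j ℕ.+ suc n)))))
          ≈⟨ ΣR-cong N (λ n → trans (ΣR-cong N (λ j →
               solve 4 (λ a b c d → a :* b :* (c :* d) := c :* (b :* (a :* d))) refl _ _ _ _)) (ΣR-*ˡ N (y n) (G n ∘ suc))) ⟩
        ΣR N (λ n → y n * ΣR N (G n ∘ suc))
          -- In `bailey` the sum starts at j = 0, here at j = 1; the extra term contains
          -- `ē 0 (suc n)`, which is 0.
          ≈⟨ ΣR-cong< N (λ n n<N → *-congˡ (trans (sym (G-zero n)) (bailey n<N))) ⟩
        ΣR N (λ n → y n * (q (suc n ℕ.* suc n) * (ē N (suc n) * e (N ℕ.+ suc n)))) ∎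
        where
        y : ℕ → Carrier
        y n = c n * x n ^ suc ν
        G : ℕ → ℕ → Carrier
        G n j = q (j ℕ.* j) * (ē N j * (ē j (suc n) * e (j ℕ.+ suc n)))
        G-zero : ∀ n → ΣR (suc N) (G n) ≈ ΣR N (G n ∘ suc)
        G-zero n = solve 4 (λ a b c d → a :* (b :* (con 0ℤ :* c)) :+ d := d) refl _ _ _ _

open import Relation.Binary.PropositionalEquality using (_≢_; refl; sym; trans; cong; cong₂; subst; _≗_; module ≡-Reasoning)

-- Finite integer sums over lists.

module IntegerSums where
  open import Data.Integer using (_+_; _*_; -_)

  ΣI-cong∈ : {A : Set} {f g : A → ℤ} (xs : List A) → (∀ {x} → x ∈ xs → f x ≡ g x) → ΣI f xs ≡ ΣI g xs
  ΣI-cong∈ []       h = refl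
  ΣI-cong∈ (x ∷ xs) h = cong₂ _+_ (h (here refl)) (ΣI-cong∈ xs (h ∘ there))

  ΣI-cong : {A : Set} {f g : A → ℤ} → (∀ x → f x ≡ g x) → (xs : List A) → ΣI f xs ≡ ΣI g xs
  ΣI-cong h xs = ΣI-cong∈ xs (λ {x} _ → h x)

  ΣI-map : {A B : Set} (f : B → ℤ) (g : A → B) (xs : List A) → ΣI f (map g xs) ≡ ΣI (f ∘ g) xs
  ΣI-map f g []       = refl
  ΣI-map f g (x ∷ xs) = cong (f (g x) +_) (ΣI-map f g xs)

  ΣI-applyUpTo : (f : ℕ → ℤ) (g : ℕ → ℕ) (n : ℕ) → ΣI f (applyUpTo g n) ≡ ΣI (f ∘ g) (upTo n)
  ΣI-applyUpTo f g zero    = refl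
  ΣI-applyUpTo f g (suc n) = cong (f (g 0) +_)
    (trans (ΣI-applyUpTo f (g ∘ suc) n) (sym (ΣI-applyUpTo (f ∘ g) suc n)))

  ΣI-++ : {A : Set} (f : A → ℤ) (xs ys : List A) → ΣI f (xs ++ ys) ≡ ΣI f xs + ΣI f ys
  ΣI-++ f []       ys = sym (ℤP.+-identityˡ _)
  ΣI-++ f (x ∷ xs) ys = trans (cong (f x +_) (ΣI-++ f xs ys)) (sym (ℤP.+-assoc (f x) _ _))

  ΣI-0 : {A : Set} (xs : List A) → ΣI (λ _ → 0ℤ) xs ≡ 0ℤ
  ΣI-0 []       = refl
  ΣI-0 (x ∷ xs) = trans (ℤP.+-identityˡ _) (ΣI-0 xs)

  private
    interchange : ∀ a b c d → (a + b) + (c + d) ≡ (a + c) + (b + d)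
    interchange = solve-∀

  ΣI-+ : {A : Set} (f g : A → ℤ) (xs : List A) → ΣI (λ x → f x + g x) xs ≡ ΣI f xs + ΣI g xs
  ΣI-+ f g []       = refl
  ΣI-+ f g (x ∷ xs) = trans (cong (f x + g x +_) (ΣI-+ f g xs)) (interchange (f x) (g x) _ _)

  ΣI-*ˡ : {A : Set} (c : ℤ) (f : A → ℤ) (xs : List A) → ΣI (λ x → c * f x) xs ≡ c * ΣI f xs
  ΣI-*ˡ c f []       = sym (ℤP.*-zeroʳ c)
  ΣI-*ˡ c f (x ∷ xs) = trans (cong (c * f x +_) (ΣI-*ˡ c f xs)) (sym (ℤP.*-distribˡ-+ c (f x) _))

  ΣI-swap : {A B : Set} (f : A → B → ℤ) (xs : List A) (ys : List B) →
    ΣI (λ x → ΣI (f x) ys) xs ≡ ΣI (λ y → ΣI (λ x → f x y) xs) ys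
  ΣI-swap f []       ys = sym (ΣI-0 ys)
  ΣI-swap f (x ∷ xs) ys = trans (cong (ΣI (f x) ys +_) (ΣI-swap f xs ys)) (sym (ΣI-+ (f x) _ ys))

open IntegerSums

-- The commutative ring of power series.

module PowerSeries where
  open import Data.Integer using (_+_; _*_; -_)

  _⊞_ : PS → PS → PS
  (f ⊞ g) n = f n + g n

  neg : PS → PS
  neg f n = - f n

  const : ℤ → PS
  const c n = c * δ0 n

  zeroPS : PS
  zeroPS _ = 0ℤ

  tail : PS → PS
  tail f n = f (suc n)

  ⊛-zero : ∀ f g → (f ⊛ g) 0 ≡ f 0 * g 0
  ⊛-zero f g = ℤP.+-identityʳ _

  ⊛-suc : ∀ f g n → (f ⊛ g) (suc n) ≡ f 0 * g (suc n) + (tail f ⊛ g) n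
  ⊛-suc f g n = cong (f 0 * g (suc n) +_) (ΣI-applyUpTo (λ i → f i * g (suc n ℕ.∸ i)) suc (suc n))

  ⊛-cong : ∀ {f f′ g g′} → f ≗ f′ → g ≗ g′ → (f ⊛ g) ≗ (f′ ⊛ g′)
  ⊛-cong p r n = ΣI-cong (λ i → cong₂ _*_ (p i) (r (n ℕ.∸ i))) (upTo (suc n))

  private
    rotate : ∀ a b c → a + (b + c) ≡ b + (a + c)
    rotate = solve-∀

    shuffle : ∀ a b c d e → a * b * c + (a * d + e) ≡ a * (b * c + d) + e
    shuffle = solve-∀

  -- The mirror image of `⊛-suc`, splitting off the last summand instead of the first; the two
  -- together give commutativity by induction.
  ⊛-suc′ : ∀ f g n → (f ⊛ g) (suc n) ≡ f (suc n) * g 0 + (f ⊛ tail g) n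
  ⊛-suc′ f g zero = begin
    (f ⊛ g) 1                              ≡⟨ ⊛-suc f g 0 ⟩
    f 0 * g 1 + (tail f ⊛ g) 0             ≡⟨ cong (f 0 * g 1 +_) (⊛-zero (tail f) g) ⟩
    f 0 * g 1 + f 1 * g 0                  ≡⟨ ℤP.+-comm (f 0 * g 1) _ ⟩
    f 1 * g 0 + f 0 * g 1                  ≡⟨ cong (f 1 * g 0 +_) (⊛-zero f (tail g)) ⟨
    f 1 * g 0 + (f ⊛ tail g) 0             ∎
    where open ≡-Reasoning
  ⊛-suc′ f g (suc n) = begin
    (f ⊛ g) (2 ℕ.+ n)                                               ≡⟨ ⊛-suc f g (suc n) ⟩
    f 0 * g (2 ℕ.+ n) + (tail f ⊛ g) (suc n)                        ≡⟨ cong (f 0 * g (2 ℕ.+ n) +_) (⊛-suc′ (tail f) g n) ⟩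
    f 0 * g (2 ℕ.+ n) + (f (2 ℕ.+ n) * g 0 + (tail f ⊛ tail g) n)   ≡⟨ rotate (f 0 * g (2 ℕ.+ n)) (f (2 ℕ.+ n) * g 0) _ ⟩
    f (2 ℕ.+ n) * g 0 + (f 0 * g (2 ℕ.+ n) + (tail f ⊛ tail g) n)   ≡⟨ cong (f (2 ℕ.+ n) * g 0 +_) (⊛-suc f (tail g) n) ⟨
    f (2 ℕ.+ n) * g 0 + (f ⊛ tail g) (suc n)                        ∎
    where open ≡-Reasoning

  ⊛-comm : ∀ f g → (f ⊛ g) ≗ (g ⊛ f)
  ⊛-comm f g zero    = trans (⊛-zero f g) (trans (ℤP.*-comm (f 0) (g 0)) (sym (⊛-zero g f)))
  ⊛-comm f g (suc n) = trans (⊛-suc f g n) (trans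
    (cong₂ _+_ (ℤP.*-comm (f 0) (g (suc n))) (⊛-comm (tail f) g n))
    (sym (⊛-suc′ g f n)))

  ⊛-distribʳ : ∀ h f g → ((f ⊞ g) ⊛ h) ≗ ((f ⊛ h) ⊞ (g ⊛ h))
  ⊛-distribʳ h f g n = trans
    (ΣI-cong (λ i → ℤP.*-distribʳ-+ (h (n ℕ.∸ i)) (f i) (g i)) (upTo (suc n)))
    (ΣI-+ (λ i → f i * h (n ℕ.∸ i)) (λ i → g i * h (n ℕ.∸ i)) (upTo (suc n)))

  ⊛-scaleˡ : ∀ c f g n → ((λ k → c * f k) ⊛ g) n ≡ c * (f ⊛ g) n
  ⊛-scaleˡ c f g n = trans
    (ΣI-cong (λ i → ℤP.*-assoc c (f i) (g (n ℕ.∸ i))) (upTo (suc n)))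
    (ΣI-*ˡ c (λ i → f i * g (n ℕ.∸ i)) (upTo (suc n)))

  -- Induction on the coefficient avoids reindexing a double sum: `tail (f ⊛ g)` is f 0 times
  -- `tail g` plus `tail f ⊛ g`, and the induction hypothesis applies to `tail f`.
  ⊛-assoc : ∀ f g h → ((f ⊛ g) ⊛ h) ≗ (f ⊛ (g ⊛ h))
  ⊛-assoc f g h zero = begin
    ((f ⊛ g) ⊛ h) 0    ≡⟨ ⊛-zero (f ⊛ g) h ⟩
    (f ⊛ g) 0 * h 0    ≡⟨ cong (_* h 0) (⊛-zero f g) ⟩
    f 0 * g 0 * h 0    ≡⟨ ℤP.*-assoc (f 0) (g 0) (h 0) ⟩
    f 0 * (g 0 * h 0)  ≡⟨ cong (f 0 *_) (⊛-zero g h) ⟨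
    f 0 * (g ⊛ h) 0    ≡⟨ ⊛-zero f (g ⊛ h) ⟨
    (f ⊛ (g ⊛ h)) 0    ∎
    where open ≡-Reasoning
  ⊛-assoc f g h (suc n) = begin
    ((f ⊛ g) ⊛ h) (suc n)
      ≡⟨ ⊛-suc (f ⊛ g) h n ⟩
    (f ⊛ g) 0 * h (suc n) + (tail (f ⊛ g) ⊛ h) n
      ≡⟨ cong₂ _+_ (cong (_* h (suc n)) (⊛-zero f g)) (⊛-cong {g = h} (⊛-suc f g) (λ _ → refl) n) ⟩
    f 0 * g 0 * h (suc n) + (((λ k → f 0 * tail g k) ⊞ (tail f ⊛ g)) ⊛ h) n
      ≡⟨ cong (f 0 * g 0 * h (suc n) +_) (⊛-distribʳ h (λ k → f 0 * tail g k) (tail f ⊛ g) n) ⟩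
    f 0 * g 0 * h (suc n) + (((λ k → f 0 * tail g k) ⊛ h) n + ((tail f ⊛ g) ⊛ h) n)
      ≡⟨ cong (f 0 * g 0 * h (suc n) +_) (cong₂ _+_ (⊛-scaleˡ (f 0) (tail g) h n) (⊛-assoc (tail f) g h n)) ⟩
    f 0 * g 0 * h (suc n) + (f 0 * (tail g ⊛ h) n + (tail f ⊛ (g ⊛ h)) n)
      ≡⟨ shuffle (f 0) (g 0) (h (suc n)) _ _ ⟩
    f 0 * (g 0 * h (suc n) + (tail g ⊛ h) n) + (tail f ⊛ (g ⊛ h)) n
      ≡⟨ cong (λ z → f 0 * z + (tail f ⊛ (g ⊛ h)) n) (⊛-suc g h n) ⟨
    f 0 * (g ⊛ h) (suc n) + (tail f ⊛ (g ⊛ h)) n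
      ≡⟨ ⊛-suc f (g ⊛ h) n ⟨
    (f ⊛ (g ⊛ h)) (suc n) ∎
    where open ≡-Reasoning

  ⊛-zeroˡ : ∀ f → (zeroPS ⊛ f) ≗ zeroPS
  ⊛-zeroˡ f n = ΣI-0 (upTo (suc n))

  ⊛-identityˡ : ∀ f → (δ0 ⊛ f) ≗ f
  ⊛-identityˡ f zero    = trans (⊛-zero δ0 f) (ℤP.*-identityˡ (f 0))
  ⊛-identityˡ f (suc n) = trans (⊛-suc δ0 f n) (trans
    (cong₂ _+_ (ℤP.*-identityˡ (f (suc n))) (⊛-zeroˡ f n)) (ℤP.+-identityʳ _))

  ⊛-const : ∀ c f n → (const c ⊛ f) n ≡ c * f n
  ⊛-const c f n = trans (⊛-scaleˡ c δ0 f n) (cong (c *_) (⊛-identityˡ f n))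

  isCommutativeRing : IsCommutativeRing _≗_ _⊞_ _⊛_ neg zeroPS δ0
  isCommutativeRing = record
    { isRing = record
      { +-isAbelianGroup = record
        { isGroup = record
          { isMonoid = record
            { isSemigroup = record
              { isMagma = record
                { isEquivalence = record
                  { refl  = λ _ → refl
                  ; sym   = λ p n → sym (p n)
                  ; trans = λ p r n → trans (p n) (r n)
                  }
                ; ∙-cong = λ p r n → cong₂ _+_ (p n) (r n)
                }
              ; assoc = λ f g h n → ℤP.+-assoc (f n) (g n) (h n)
              }
            ; identity = (λ f n → ℤP.+-identityˡ (f n)) , (λ f n → ℤP.+-identityʳ (f n))
            }
          ; inverse = (λ f n → ℤP.+-inverseˡ (f n)) , (λ f n → ℤP.+-inverseʳ (f n))
          ; ⁻¹-cong = λ p n → cong -_ (p n)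
          }
        ; comm = λ f g n → ℤP.+-comm (f n) (g n)
        }
      ; *-cong = ⊛-cong
      ; *-assoc = ⊛-assoc
      ; *-identity = ⊛-identityˡ , (λ f n → trans (⊛-comm f δ0 n) (⊛-identityˡ f n))
      ; distrib = (λ h f g n → trans (⊛-comm h (f ⊞ g) n) (trans (⊛-distribʳ h f g n)
                     (cong₂ _+_ (⊛-comm f h n) (⊛-comm g h n))))
                , ⊛-distribʳ
      }
    ; *-comm = ⊛-comm
    }

  psRing : CommutativeRing 0ℓ 0ℓ
  psRing = record { isCommutativeRing = isCommutativeRing }

  constHom : CommutativeRing.rawRing ℤP.+-*-commutativeRing -Raw-AlmostCommutative⟶ fromCommutativeRing psRing
  constHom = record
    { ⟦_⟧    = const
    ; +-homo = λ a b n → ℤP.*-distribʳ-+ (δ0 n) a b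
    ; *-homo = λ a b n → trans (ℤP.*-assoc a b (δ0 n)) (sym (⊛-const a (const b) n))
    ; -‿homo = λ a n → sym (ℤP.neg-distribˡ-* a (δ0 n))
    ; 0-homo = λ n → ℤP.*-zeroˡ (δ0 n)
    ; 1-homo = λ n → ℤP.*-identityˡ (δ0 n)
    }

open PowerSeries

-- Binomial coefficients and the moment weights.

module Binomials where
  open import Data.Integer using (_+_; _*_; -_; _-_; +_; -[1+_]; ∣_∣; _/ℕ_; _%ℕ_)

  -- The remainder r satisfies (b - d) n = r and 0 ≤ r < n, which forces b - d = 0, for negative b
  -- as well.
  *-/ℕ-cancel : ∀ b n .{{_ : ℕ.NonZero n}} → (b * + n) /ℕ n ≡ b
  *-/ℕ-cancel b n = sym (ℤP.i-j≡0⇒i≡j b d (ℤP.∣i∣≡0⇒i≡0 (small ∣ b - d ∣ (subst (_< n) (sym eq) (n%ℕd<d (b * + n) n)))))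
    where
    d = (b * + n) /ℕ n
    r = (b * + n) %ℕ n
    small : ∀ k → k ℕ.* n < n → k ≡ 0
    small zero    _ = refl
    small (suc k) p = contradiction p (ℕP.≤⇒≯ (ℕP.m≤m+n n (k ℕ.* n)))
    collect : ∀ b d n r → b * n ≡ r + d * n → (b - d) * n ≡ r
    collect b d n r p = trans (expand b d n) (trans (cong (_- d * n) p) (simp r (d * n)))
      where
      expand : ∀ b d n → (b - d) * n ≡ b * n - d * n
      expand = solve-∀
      simp : ∀ r z → r + z - z ≡ r
      simp = solve-∀
    eq : ∣ b - d ∣ ℕ.* n ≡ r
    eq = trans (sym (ℤP.abs-* (b - d) (+ n))) (cong ∣_∣ (collect b d (+ n) (+ r) (a≡a%ℕn+[a/ℕn]*n (b * + n) n)))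

  falling-suc : ∀ x k → falling (1ℤ + x) (suc k) ≡ (1ℤ + x) * falling x k
  falling-suc x zero = base x
    where
    base : ∀ x → 1ℤ * (1ℤ + x - + 0) ≡ (1ℤ + x) * 1ℤ
    base = solve-∀
  falling-suc x (suc k) = trans (cong₂ _*_ (falling-suc x k) (step x (+ k))) (ℤP.*-assoc (1ℤ + x) (falling x k) _)
    where
    step : ∀ x k → 1ℤ + x - (1ℤ + k) ≡ x - k
    step = solve-∀

  falling-pascal : ∀ x k → falling (1ℤ + x) (suc k) ≡ falling x (suc k) + + (suc k) * falling x k
  falling-pascal x k = trans (falling-suc x k) (ring x (+ k) (falling x k))
    where
    ring : ∀ x k f → (1ℤ + x) * f ≡ f * (x - k) + (1ℤ + k) * f
    ring = solve-∀

  falling-vanish : ∀ n d → falling (+ n) (suc (d ℕ.+ n)) ≡ 0ℤ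
  falling-vanish n zero    = trans (cong (falling (+ n) n *_) (ℤP.+-inverseʳ (+ n))) (ℤP.*-zeroʳ (falling (+ n) n))
  falling-vanish n (suc d) = cong (_* (+ n - + (suc (d ℕ.+ n)))) (falling-vanish n d)

  Divides : ℤ → ℕ → Set
  Divides x k = ∃ λ b → falling x k ≡ b * + (k !)

  suc!* : ∀ k b → b * + (suc k !) ≡ + suc k * (b * + (k !))
  suc!* k b = trans (cong (b *_) (ℤP.pos-* (suc k) (k !))) (ring b (+ suc k) (+ (k !)))
    where
    ring : ∀ b s f → b * (s * f) ≡ s * (b * f)
    ring = solve-∀

  step-up : ∀ x k → Divides x (suc k) → Divides x k → Divides (1ℤ + x) (suc k)
  step-up x k (b , p) (b′ , p′) = b + b′ , (begin
    falling (1ℤ + x) (suc k)                        ≡⟨ falling-pascal x k ⟩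
    falling x (suc k) + + suc k * falling x k       ≡⟨ cong₂ _+_ p (cong (+ suc k *_) p′) ⟩
    b * + (suc k !) + + suc k * (b′ * + (k !))      ≡⟨ cong (λ z → b * + (suc k !) + z) (suc!* k b′) ⟨
    b * + (suc k !) + b′ * + (suc k !)              ≡⟨ ℤP.*-distribʳ-+ (+ (suc k !)) b b′ ⟨
    (b + b′) * + (suc k !)                          ∎)
    where open ≡-Reasoning

  -- Pascal's rule solved for the smaller argument, which is how negative x are reached.
  step-down : ∀ x k → Divides (1ℤ + x) (suc k) → Divides x k → Divides x (suc k)
  step-down x k (b , p) (b′ , p′) = b - b′ , (begin
    falling x (suc k)                                                            ≡⟨ isolate (falling x (suc k)) (+ suc k * falling x k) ⟩
    (falling x (suc k) + + suc k * falling x k) - + suc k * falling x k          ≡⟨ cong (_- + suc k * falling x k) (falling-pascal x k) ⟨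
    falling (1ℤ + x) (suc k) - + suc k * falling x k                             ≡⟨ cong₂ _-_ p (cong (+ suc k *_) p′) ⟩
    b * + (suc k !) - + suc k * (b′ * + (k !))                                   ≡⟨ cong (λ z → b * + (suc k !) - z) (suc!* k b′) ⟨
    b * + (suc k !) - b′ * + (suc k !)                                           ≡⟨ ring b b′ (+ (suc k !)) ⟩
    (b - b′) * + (suc k !)                                                       ∎)
    where
    open ≡-Reasoning
    isolate : ∀ a c → a ≡ (a + c) - c
    isolate = solve-∀
    ring : ∀ b b′ f → b * f - b′ * f ≡ (b - b′) * f
    ring = solve-∀

  -- Shows that the division in `binom` is exact. At x = 0 and k > 0 the product contains the factor
  -- 0; from there Pascal's rule leads upwards and downwards.
  divides : ∀ x k → Divides x k
  divides x zero = 1ℤ , refl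
  divides (+ zero) (suc k) = 0ℤ , subst (λ z → falling 0ℤ (suc z) ≡ 0ℤ) (ℕP.+-identityʳ k) (falling-vanish 0 k)
  divides (+ suc n) (suc k) = step-up (+ n) k (divides (+ n) (suc k)) (divides (+ n) k)
  divides -[1+ zero ] (suc k) = step-down -[1+ 0 ] k (divides (+ 0) (suc k)) (divides -[1+ 0 ] k)
  divides -[1+ suc n ] (suc k) = step-down -[1+ suc n ] k (divides -[1+ n ] (suc k)) (divides -[1+ suc n ] k)

  falling≡binom*! : ∀ x k → falling x k ≡ binom x k * + (k !)
  falling≡binom*! x k with divides x k
  ... | b , p = trans p (cong (_* + (k !)) (sym (trans
    (cong (λ z → (z /ℕ (k !)) {{ℕP._!≢0 k}}) p) (*-/ℕ-cancel b (k !) {{ℕP._!≢0 k}}))))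

  cancel-! : ∀ k {a b} → a * + (k !) ≡ b * + (k !) → a ≡ b
  cancel-! k {a} {b} = ℤP.*-cancelʳ-≡ a b (+ (k !)) {{ℕP._!≢0 k}}

  binom-pascal : ∀ x k → binom (1ℤ + x) (suc k) ≡ binom x (suc k) + binom x k
  binom-pascal x k = cancel-! (suc k) (begin
    binom (1ℤ + x) (suc k) * + (suc k !)                        ≡⟨ falling≡binom*! (1ℤ + x) (suc k) ⟨
    falling (1ℤ + x) (suc k)                                    ≡⟨ falling-pascal x k ⟩
    falling x (suc k) + + suc k * falling x k                   ≡⟨ cong₂ _+_ (falling≡binom*! x (suc k)) (cong (+ suc k *_) (falling≡binom*! x k)) ⟩
    binom x (suc k) * + (suc k !) + + suc k * (binom x k * + (k !)) ≡⟨ cong (λ z → binom x (suc k) * + (suc k !) + z) (suc!* k (binom x k)) ⟨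
    binom x (suc k) * + (suc k !) + binom x k * + (suc k !)     ≡⟨ ℤP.*-distribʳ-+ (+ (suc k !)) (binom x (suc k)) (binom x k) ⟨
    (binom x (suc k) + binom x k) * + (suc k !)                 ∎)
    where open ≡-Reasoning

  momentWeight : ℕ → ℤ → ℤ
  momentWeight ν m = binom (m + + ν - 1ℤ) (2 ℕ.* ν)

  -- The coefficient is 0 because 0 ≤ ν < 2ν + 2. It settles the moments of the empty partition,
  -- whose rank is 0.
  momentWeight-suc-0 : ∀ ν → momentWeight (suc ν) 0ℤ ≡ 0ℤ
  momentWeight-suc-0 ν = cancel-! (2 ℕ.* suc ν) (begin
    binom (0ℤ + + suc ν - 1ℤ) (2 ℕ.* suc ν) * + ((2 ℕ.* suc ν) !) ≡⟨ falling≡binom*! (0ℤ + + suc ν - 1ℤ) (2 ℕ.* suc ν) ⟨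
    falling (0ℤ + + suc ν - 1ℤ) (2 ℕ.* suc ν)                     ≡⟨ cong₂ falling (int (+ ν)) (nat ν) ⟩
    falling (+ ν) (suc (suc ν ℕ.+ ν))                             ≡⟨ falling-vanish ν (suc ν) ⟩
    0ℤ                                                            ∎)
    where
    open ≡-Reasoning
    int : ∀ n → 0ℤ + (1ℤ + n) - 1ℤ ≡ n
    int = solve-∀
    nat : ∀ n → 2 ℕ.* suc n ≡ suc (suc n ℕ.+ n)
    nat = solveℕ-∀

  private
    double : ∀ n → 2 ℕ.* suc n ≡ 2 ℕ.+ 2 ℕ.* n
    double = solveℕ-∀
    top : ∀ m n → m + 1ℤ + (1ℤ + n) - 1ℤ ≡ 1ℤ + (1ℤ + (m + n - 1ℤ))
    top = solve-∀
    mid : ∀ m n → m + (1ℤ + n) - 1ℤ ≡ 1ℤ + (m + n - 1ℤ)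
    mid = solve-∀
    bot : ∀ m n → m - 1ℤ + (1ℤ + n) - 1ℤ ≡ m + n - 1ℤ
    bot = solve-∀

  -- With y = m + ν - 1 the three weights on the level ν + 1 have upper arguments y + 2, y + 1 and y
  -- and the same lower argument 2ν + 2; Pascal's rule turns their second difference into the
  -- coefficient of y with lower argument 2ν.
  momentWeight-Δ : ∀ ν m → momentWeight (suc ν) (m + 1ℤ) + momentWeight (suc ν) (m - 1ℤ)
    ≡ momentWeight (suc ν) m + momentWeight (suc ν) m + momentWeight ν m
  momentWeight-Δ ν m = trans (cong₂ _+_ (cong₂ binom (top m (+ ν)) (double ν)) (cong₂ binom (bot m (+ ν)) (double ν)))
        (trans main (cong (λ z → z + z + momentWeight ν m) (sym (cong₂ binom (mid m (+ ν)) (double ν)))))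
    where
    open ≡-Reasoning
    B = binom
    k = 2 ℕ.* ν
    y = m + + ν - 1ℤ
    ring : ∀ a b c d → a + (b + c) + d ≡ a + (d + b) + c
    ring = solve-∀
    main : B (1ℤ + (1ℤ + y)) (2 ℕ.+ k) + B y (2 ℕ.+ k) ≡ B (1ℤ + y) (2 ℕ.+ k) + B (1ℤ + y) (2 ℕ.+ k) + B y k
    main = begin
      B (1ℤ + (1ℤ + y)) (2 ℕ.+ k) + B y (2 ℕ.+ k)              ≡⟨ cong (_+ B y (2 ℕ.+ k)) (binom-pascal (1ℤ + y) (suc k)) ⟩
      B (1ℤ + y) (2 ℕ.+ k) + B (1ℤ + y) (suc k) + B y (2 ℕ.+ k) ≡⟨ cong (λ z → B (1ℤ + y) (2 ℕ.+ k) + z + B y (2 ℕ.+ k)) (binom-pascal y k) ⟩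
      B (1ℤ + y) (2 ℕ.+ k) + (B y (suc k) + B y k) + B y (2 ℕ.+ k) ≡⟨ ring (B (1ℤ + y) (2 ℕ.+ k)) (B y (suc k)) (B y k) (B y (2 ℕ.+ k)) ⟩
      B (1ℤ + y) (2 ℕ.+ k) + (B y (2 ℕ.+ k) + B y (suc k)) + B y k ≡⟨ cong (λ z → B (1ℤ + y) (2 ℕ.+ k) + z + B y k) (binom-pascal y (suc k)) ⟨
      B (1ℤ + y) (2 ℕ.+ k) + B (1ℤ + y) (2 ℕ.+ k) + B y k      ∎

open Binomials

-- Multiplication by qᵐ, see `q-⊛`, in the form in which counting by size produces it.
delay : ℕ → PS → PS
delay zero    f n       = f n
delay (suc m) f zero    = 0ℤ
delay (suc m) f (suc n) = delay m f n

delay-cong : ∀ m {f g} → f ≗ g → delay m f ≗ delay m g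
delay-cong zero    h n       = h n
delay-cong (suc m) h zero    = refl
delay-cong (suc m) h (suc n) = delay-cong m h n

-- Enumerations without repetition.

module Enumerations where
  open import Data.Integer using (_+_)

  ΣI-↭ : {A : Set} (f : A → ℤ) {xs ys : List A} → xs ↭ ys → ΣI f xs ≡ ΣI f ys
  ΣI-↭ f Perm.refl         = refl
  ΣI-↭ f (Perm.prep x p)   = cong (f x +_) (ΣI-↭ f p)
  ΣI-↭ f (Perm.swap x y p) = trans (cong (λ z → f x + (f y + z)) (ΣI-↭ f p)) (rotate (f x) (f y) _)
    where
    rotate : ∀ a b c → a + (b + c) ≡ b + (a + c)
    rotate = solve-∀
  ΣI-↭ f (Perm.trans p r)  = trans (ΣI-↭ f p) (ΣI-↭ f r)

  -- Makes sums depend on the predicate alone: by `ΣI-enum`, lists generated in different ways need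
  -- never be compared entry by entry.
  record Enum {A : Set} (P : A → Set) : Set where
    field
      list     : List A
      unique   : Unique list
      sound    : ∀ {x} → x ∈ list → P x
      complete : ∀ {x} → P x → x ∈ list
  open Enum public

  unique-map : {A B : Set} {f : A → B} {xs : List A} →
    (∀ {x y} → x ∈ xs → y ∈ xs → f x ≡ f y → x ≡ y) → Unique xs → Unique (map f xs)
  unique-map inj []       = []
  unique-map {f = f} {x ∷ xs} inj (x∉ ∷ u) =
    All.tabulate (λ z∈ eq → let y , y∈ , z≡ = ∈-map⁻ f z∈ in
      All.lookup x∉ y∈ (inj (here refl) (there y∈) (trans eq z≡)))
    ∷ unique-map (λ p r → inj (there p) (there r)) u

  module _ {A : Set} {P Q : A → Set} where
    -- Duplicate-free lists with the same members are equal as bags, hence permutations of each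
    -- other.
    ΣI-enum : (f : A → ℤ) (E : Enum P) (E′ : Enum Q) → (∀ {x} → P x → Q x) → (∀ {x} → Q x → P x) →
      ΣI f (list E) ≡ ΣI f (list E′)
    ΣI-enum f E E′ to from = ΣI-↭ f (∼bag⇒↭ (unique∧set⇒bag (unique E) (unique E′)
      (mk⇔ (complete E′ ∘ to ∘ sound E) (complete E ∘ from ∘ sound E′))))

    enum-⇔ : (∀ {x} → P x → Q x) → (∀ {x} → Q x → P x) → Enum P → Enum Q
    enum-⇔ to from E = record
      { list = list E ; unique = unique E ; sound = to ∘ sound E ; complete = complete E ∘ from }

    enum-⊎ : Enum P → Enum Q → (∀ {x} → P x → ¬ Q x) → Enum (λ x → P x ⊎ Q x)
    enum-⊎ E E′ disjoint = record
      { list     = list E ++ list E′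
      ; unique   = Unique.++⁺ (unique E) (unique E′) (λ (p , r) → disjoint (sound E p) (sound E′ r))
      ; sound    = λ x∈ → Sum.map (sound E) (sound E′) (∈-++⁻ (list E) x∈)
      ; complete = λ { (inj₁ p) → ∈-++⁺ˡ (complete E p) ; (inj₂ r) → ∈-++⁺ʳ (list E) (complete E′ r) }
      }

  Image : {A B : Set} → (A → B) → (A → Set) → B → Set
  Image φ P y = ∃ λ x → P x × y ≡ φ x

  enum-image : {A B : Set} {P : A → Set} (φ : A → B) → (∀ {x y} → P x → P y → φ x ≡ φ y → x ≡ y) →
    Enum P → Enum (Image φ P)
  enum-image φ inj E = record
    { list     = map φ (list E)
    ; unique   = unique-map (λ p r → inj (sound E p) (sound E r)) (unique E)
    ; sound    = λ y∈ → let x , x∈ , eq = ∈-map⁻ φ y∈ in x , sound E x∈ , eq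
    ; complete = λ { (x , p , refl) → ∈-map⁺ φ (complete E p) }
    }

  enum-∅ : {A : Set} {P : A → Set} → (∀ {x} → ¬ P x) → Enum P
  enum-∅ none = record { list = [] ; unique = [] ; sound = λ () ; complete = λ p → contradiction p none }

  -- The counterpart of `delay` for predicates: r is the size left after a piece of size m has been
  -- taken away.
  Delayed : {A : Set} → ℕ → (ℕ → A → Set) → ℕ → A → Set
  Delayed m Q n x = ∃ λ r → m ℕ.+ r ≡ n × Q r x

  -- Asks for enumerations only at sizes r with m + r = n, so that a recursion on the size can
  -- supply them.
  enum-delayed : {A : Set} {Q : ℕ → A → Set} (m n : ℕ) → (∀ r → m ℕ.+ r ≡ n → Enum (Q r)) → Enum (Delayed m Q n)
  enum-delayed zero    n       E = enum-⇔ (λ p → n , refl , p) (λ { (_ , refl , p) → p }) (E n refl)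
  enum-delayed (suc m) zero    E = enum-∅ (λ { (_ , () , _) })
  enum-delayed (suc m) (suc n) E =
    enum-⇔ (λ { (r , eq , p) → r , cong suc eq , p }) (λ { (r , eq , p) → r , ℕP.suc-injective eq , p })
      (enum-delayed m n (λ r eq → E r (cong suc eq)))

  ΣI-delayed : {A : Set} {Q : ℕ → A → Set} (f : A → ℤ) (m n : ℕ) (E : ∀ r → Enum (Q r)) →
    ΣI f (list (enum-delayed m n (λ r _ → E r))) ≡ delay m (λ r → ΣI f (list (E r))) n
  ΣI-delayed f zero    n       E = refl
  ΣI-delayed f (suc m) zero    E = refl
  ΣI-delayed f (suc m) (suc n) E = ΣI-delayed f m n E

open Enumerations

-- Pairs of partitions around a Durfee square.

module DurfeePairs where
  open import Data.Integer using (_+_; _-_; +_)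

  -- The rows to the right of a Durfee square of size j, padded with zeros to j entries, and
  -- the rows below it; each is generated by the step matching one factor of the generating function.
  data Right : ℕ → List ℕ → Set where
    nil : Right 0 []
    low : ∀ {j λs} → Right j λs → Right (suc j) (λs ∷ʳ 0)
    up  : ∀ {j λs} → Right (suc j) λs → Right (suc j) (map suc λs)

  data Below : ℕ → List ℕ → Set where
    nil  : Below 0 []
    low  : ∀ {b μs} → Below b μs → Below (suc b) μs
    part : ∀ {b μs} → Below (suc b) μs → Below (suc b) (suc b ∷ μs)

  -- A Durfee square needs j = b, but the bounds are kept independent: the two factors of the
  -- generating function are removed one after the other, and between them stand the pairs with
  -- bounds j + 1 and j.
  Pair : ℕ → ℕ → ℕ → List ℕ × List ℕ → Set
  Pair j b n (λs , μs) = Right j λs × Below b μs × sum λs ℕ.+ sum μs ≡ n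

  addPart : ℕ → List ℕ × List ℕ → List ℕ × List ℕ
  addPart b (λs , μs) = λs , b ∷ μs

  addZero addColumn : List ℕ × List ℕ → List ℕ × List ℕ
  addZero   (λs , μs) = λs ∷ʳ 0 , μs
  addColumn (λs , μs) = map suc λs , μs

  top : List ℕ → ℕ
  top []      = 0
  top (x ∷ _) = x

  below-bounded : ∀ {b μs} → Below b μs → ∀ {x} → x ∈ μs → x ≤ b
  below-bounded (low B)  x∈          = ℕP.m≤n⇒m≤1+n (below-bounded B x∈)
  below-bounded (part B) (here refl) = ℕP.≤-refl
  below-bounded (part B) (there x∈)  = below-bounded B x∈

  sum-∷ʳ0 : ∀ λs → sum (λs ∷ʳ 0) ≡ sum λs
  sum-∷ʳ0 λs = trans (sum-++ λs (0 ∷ [])) (ℕP.+-identityʳ (sum λs))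

  sum-map-+ : ∀ c λs → sum (map (c ℕ.+_) λs) ≡ length λs ℕ.* c ℕ.+ sum λs
  sum-map-+ c []       = refl
  sum-map-+ c (x ∷ λs) = trans (cong (c ℕ.+ x ℕ.+_) (sum-map-+ c λs)) (ring c x (length λs ℕ.* c) (sum λs))
    where
    ring : ∀ c x l s → c ℕ.+ x ℕ.+ (l ℕ.+ s) ≡ (c ℕ.+ l) ℕ.+ (x ℕ.+ s)
    ring = solveℕ-∀

  right-length : ∀ {j λs} → Right j λs → length λs ≡ j
  right-length nil                = refl
  right-length (low {λs = λs} R)  = trans (ListP.length-++ λs) (trans (ℕP.+-comm _ 1) (cong suc (right-length R)))
  right-length (up {λs = λs} R)   = trans (ListP.length-map suc λs) (right-length R)

  sum-map-suc : ∀ {j λs} → Right j λs → sum (map suc λs) ≡ j ℕ.+ sum λs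
  sum-map-suc {j} {λs} R = trans (sum-map-+ 1 λs) (cong (ℕ._+ sum λs) (trans (ℕP.*-identityʳ _) (right-length R)))

  ∷ʳ0≢map-suc : ∀ xs ys → xs ∷ʳ 0 ≢ map suc ys
  ∷ʳ0≢map-suc []       (y ∷ ys) ()
  ∷ʳ0≢map-suc (x ∷ xs) (y ∷ ys) eq = ∷ʳ0≢map-suc xs ys (ListP.∷-injectiveʳ eq)

  module _ (j b n : ℕ) where
    -- The disjoint alternatives behind the geometric series 1/(1 - z⁻¹ q^{b+1}) and 1/(1 - z
    -- q^{j+1}): no part b + 1, respectively no full column, is present, or one of them is taken
    -- away.
    PartSplit ColumnSplit : List ℕ × List ℕ → Set
    PartSplit p = Pair j b n p ⊎ Image (addPart (suc b)) (Delayed (suc b) (Pair j (suc b)) n) p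
    ColumnSplit p = Image addZero (Pair j b n) p ⊎ Image addColumn (Delayed (suc j) (Pair (suc j) b) n) p

    private
      swapSum : ∀ a s m → s ℕ.+ (a ℕ.+ m) ≡ a ℕ.+ (s ℕ.+ m)
      swapSum = solveℕ-∀

    partSplit⁺ : ∀ {p} → PartSplit p → Pair j (suc b) n p
    partSplit⁺ (inj₁ (R , B , eq)) = R , low B , eq
    partSplit⁺ (inj₂ ((λs , μs) , (r , eq , R , B , eq′) , refl)) =
      R , part B , trans (swapSum (suc b) (sum λs) (sum μs)) (trans (cong (suc b ℕ.+_) eq′) eq)

    partSplit⁻ : ∀ {p} → Pair j (suc b) n p → PartSplit p
    partSplit⁻ (R , low B , eq) = inj₁ (R , B , eq)
    partSplit⁻ (R , part {μs = μs} B , eq) =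
      inj₂ (_ , (_ , trans (sym (swapSum (suc b) _ (sum μs))) eq , R , B , refl) , refl)

    columnSplit⁺ : ∀ {p} → ColumnSplit p → Pair (suc j) b n p
    columnSplit⁺ (inj₁ ((λs , μs) , (R , B , eq) , refl)) = low R , B , trans (cong (ℕ._+ sum μs) (sum-∷ʳ0 λs)) eq
    columnSplit⁺ (inj₂ ((λs , μs) , (r , eq , R , B , eq′) , refl)) = up R , B ,
      trans (cong (ℕ._+ sum μs) (sum-map-suc R)) (trans (ℕP.+-assoc (suc j) (sum λs) (sum μs)) (trans (cong (suc j ℕ.+_) eq′) eq))

    columnSplit⁻ : ∀ {p} → Pair (suc j) b n p → ColumnSplit p
    columnSplit⁻ {_ , μs} (low {λs = λs} R , B , eq) =
      inj₁ (_ , (R , B , trans (cong (ℕ._+ sum μs) (sym (sum-∷ʳ0 λs))) eq) , refl)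
    columnSplit⁻ {_ , μs} (up {λs = λs} R , B , eq) =
      inj₂ (_ , (_ , trans (sym (ℕP.+-assoc (suc j) (sum λs) (sum μs))) (trans (cong (ℕ._+ sum μs) (sym (sum-map-suc R))) eq)
                   , R , B , refl) , refl)

    enum-partSplit : Enum (Pair j b n) → Enum (Delayed (suc b) (Pair j (suc b)) n) → Enum PartSplit
    enum-partSplit E E′ = enum-⊎ E (enum-image (addPart (suc b)) (λ { _ _ refl → refl }) E′)
      λ { (_ , B , _) (_ , _ , refl) → ℕP.1+n≰n (below-bounded B (here refl)) }

    enum-columnSplit : Enum (Pair j b n) → Enum (Delayed (suc j) (Pair (suc j) b) n) → Enum ColumnSplit
    enum-columnSplit E E′ = enum-⊎
      (enum-image addZero (λ {x} {y} _ _ eq →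
        cong₂ _,_ (ListP.∷ʳ-injectiveˡ (proj₁ x) (proj₁ y) (cong proj₁ eq)) (cong proj₂ eq)) E)
      (enum-image addColumn (λ _ _ eq → cong₂ _,_ (ListP.map-injective ℕP.suc-injective (cong proj₁ eq)) (cong proj₂ eq)) E′)
      λ { ((λs , _) , _ , eq) ((λs′ , _) , _ , eq′) → ∷ʳ0≢map-suc λs λs′ (cong proj₁ (trans (sym eq) eq′)) }

  private
    smaller : ∀ {m n r} → suc m ℕ.+ r ≡ n → r < n
    smaller {m} {n} {r} refl = s≤s (ℕP.m≤n+m r m)

    -- Taking away a part or a column lowers n, which `Acc` records; the other alternative lowers b
    -- or j structurally. Columns are used only when b = 0.
    enumPair-acc : ∀ n → Acc _<_ n → ∀ j b → Enum (Pair j b n)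
    enumPair-acc zero    (acc rs) zero zero = record
      { list = ([] , []) ∷ [] ; unique = [] ∷ [] ; sound = λ { (here refl) → nil , nil , refl }
      ; complete = λ { (nil , nil , _) → here refl } }
    enumPair-acc (suc n) (acc rs) zero zero = enum-∅ λ { (nil , nil , ()) }
    enumPair-acc n (acc rs) (suc j) zero = enum-⇔ (columnSplit⁺ j 0 n) (columnSplit⁻ j 0 n) (enum-columnSplit j 0 n
      (enumPair-acc n (acc rs) j 0) (enum-delayed (suc j) n (λ r eq → enumPair-acc r (rs (smaller eq)) (suc j) 0)))
    enumPair-acc n (acc rs) j (suc b) = enum-⇔ (partSplit⁺ j b n) (partSplit⁻ j b n) (enum-partSplit j b n
      (enumPair-acc n (acc rs) j b) (enum-delayed (suc b) n (λ r eq → enumPair-acc r (rs (smaller eq)) j (suc b))))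

  enumPair : ∀ j b n → Enum (Pair j b n)
  enumPair j b n = enumPair-acc n (<-wellFounded n) j b

  weight : (ℤ → ℤ) → List ℕ × List ℕ → ℤ
  weight w (λs , μs) = w (+ top λs - + length μs)

  pairSeries : ℕ → ℕ → (ℤ → ℤ) → PS
  pairSeries j b w n = ΣI (weight w) (list (enumPair j b n))

  pairSeries-part : ∀ j b w → pairSeries j (suc b) w ≗ (pairSeries j b w ⊞ delay (suc b) (pairSeries j (suc b) (λ m → w (m - 1ℤ))))
  pairSeries-part j b w n = begin
    ΣI (weight w) (list (enumPair j (suc b) n))
      ≡⟨ ΣI-enum (weight w) (enumPair j (suc b) n) (enum-partSplit j b n (enumPair j b n) D) (partSplit⁻ j b n) (partSplit⁺ j b n) ⟩
    ΣI (weight w) (list (enumPair j b n) ++ map (addPart (suc b)) (list D))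
      ≡⟨ ΣI-++ (weight w) (list (enumPair j b n)) _ ⟩
    pairSeries j b w n + ΣI (weight w) (map (addPart (suc b)) (list D))
      ≡⟨ cong (λ z → pairSeries j b w n + z) (trans (ΣI-map (weight w) (addPart (suc b)) (list D))
           (ΣI-cong (λ p → cong w (ring (+ top (proj₁ p)) (+ length (proj₂ p)))) (list D))) ⟩
    pairSeries j b w n + ΣI (weight (λ m → w (m - 1ℤ))) (list D)
      ≡⟨ cong (λ z → pairSeries j b w n + z) (ΣI-delayed (weight (λ m → w (m - 1ℤ))) (suc b) n (enumPair j (suc b))) ⟩
    pairSeries j b w n + delay (suc b) (pairSeries j (suc b) (λ m → w (m - 1ℤ))) n ∎
    where
    open ≡-Reasoning
    D = enum-delayed (suc b) n (λ r _ → enumPair j (suc b) r)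
    ring : ∀ t l → t - (1ℤ + l) ≡ t - l - 1ℤ
    ring = solve-∀

  -- For b > 0 the list of `enumPair` is built by removing parts. The recurrence for columns holds
  -- all the same, because the sum depends only on the enumerated predicate.
  pairSeries-column : ∀ j b w → pairSeries (suc j) b w ≗ (pairSeries j b w ⊞ delay (suc j) (pairSeries (suc j) b (λ m → w (m + 1ℤ))))
  pairSeries-column j b w n = begin
    ΣI (weight w) (list (enumPair (suc j) b n))
      ≡⟨ ΣI-enum (weight w) (enumPair (suc j) b n) (enum-columnSplit j b n (enumPair j b n) D) (columnSplit⁻ j b n) (columnSplit⁺ j b n) ⟩
    ΣI (weight w) (map addZero (list (enumPair j b n)) ++ map addColumn (list D))
      ≡⟨ ΣI-++ (weight w) (map addZero (list (enumPair j b n))) _ ⟩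
    ΣI (weight w) (map addZero (list (enumPair j b n))) + ΣI (weight w) (map addColumn (list D))
      ≡⟨ cong₂ _+_
           (trans (ΣI-map (weight w) addZero (list (enumPair j b n))) (ΣI-cong (λ p → cong (λ t → w (+ t - + length (proj₂ p))) (top-∷ʳ0 (proj₁ p))) (list (enumPair j b n))))
           (trans (ΣI-map (weight w) addColumn (list D)) (ΣI-cong∈ (list D) (λ p∈ → column (sound D p∈)))) ⟩
    pairSeries j b w n + ΣI (weight (λ m → w (m + 1ℤ))) (list D)
      ≡⟨ cong (λ z → pairSeries j b w n + z) (ΣI-delayed (weight (λ m → w (m + 1ℤ))) (suc j) n (enumPair (suc j) b)) ⟩
    pairSeries j b w n + delay (suc j) (pairSeries (suc j) b (λ m → w (m + 1ℤ))) n ∎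
    where
    open ≡-Reasoning
    D = enum-delayed (suc j) n (λ r _ → enumPair (suc j) b r)
    top-∷ʳ0 : ∀ λs → top (λs ∷ʳ 0) ≡ top λs
    top-∷ʳ0 []       = refl
    top-∷ʳ0 (x ∷ λs) = refl
    ring : ∀ t l → 1ℤ + t - l ≡ t - l + 1ℤ
    ring = solve-∀
    column : ∀ {p} → Delayed (suc j) (Pair (suc j) b) n p → weight w (addColumn p) ≡ weight (λ m → w (m + 1ℤ)) p
    -- There are j + 1 rows, so a first row exists and the added column lengthens it by 1.
    column {[]     , μs} (_ , _ , R , _) with () ← right-length R
    column {x ∷ λs , μs} _ = cong w (ring (+ x) (+ length μs))

  pairSeries-0-0 : ∀ w n → pairSeries 0 0 w n ≡ w 0ℤ ℤ.* δ0 n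
  pairSeries-0-0 w zero    = trans (ℤP.+-identityʳ (w 0ℤ)) (sym (ℤP.*-identityʳ (w 0ℤ)))
  pairSeries-0-0 w (suc n) = sym (ℤP.*-zeroʳ (w 0ℤ))

open DurfeePairs

-- Partitions and their Durfee squares.

module Partitions where
  open import Data.Integer using (_+_; _-_; +_)

  data Desc : ℕ → List ℕ → Set where
    []  : ∀ {b} → Desc b []
    _∷_ : ∀ {b x xs} → x ≤ b → Desc x xs → Desc b (x ∷ xs)

  desc-weaken : ∀ {b b′ xs} → b ≤ b′ → Desc b xs → Desc b′ xs
  desc-weaken p []      = []
  desc-weaken p (r ∷ d) = ℕP.≤-trans r p ∷ d

  desc-bounded : ∀ {b xs} → Desc b xs → All (_≤ b) xs
  desc-bounded []      = []
  desc-bounded (p ∷ d) = p ∷ All.map (λ r → ℕP.≤-trans r p) (desc-bounded d)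

  desc-++⁻ : ∀ {b} xs {y ys} → Desc b (xs ++ y ∷ ys) → Desc b xs × All (y ≤_) xs × Desc y ys × y ≤ b
  desc-++⁻ []       (p ∷ d) = [] , [] , d , p
  desc-++⁻ (x ∷ xs) (p ∷ d) with dx , ay , dy , y≤x ← desc-++⁻ xs d =
    p ∷ dx , y≤x ∷ ay , dy , ℕP.≤-trans y≤x p

  desc-++⁻ˡ : ∀ {b} xs {ys} → Desc b (xs ++ ys) → Desc b xs
  desc-++⁻ˡ []       d       = []
  desc-++⁻ˡ (x ∷ xs) (p ∷ d) = p ∷ desc-++⁻ˡ xs d

  desc-++⁺ : ∀ {b c xs ys} → c ≤ b → Desc b xs → All (c ≤_) xs → Desc c ys → Desc b (xs ++ ys)
  desc-++⁺ p []      []      d′ = desc-weaken p d′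
  desc-++⁺ p (r ∷ d) (s ∷ a) d′ = r ∷ desc-++⁺ s d a d′

  desc-map : ∀ {f : ℕ → ℕ} → (∀ {x y} → x ≤ y → f x ≤ f y) → ∀ {b xs} → Desc b xs → Desc (f b) (map f xs)
  desc-map mono []      = []
  desc-map mono (p ∷ d) = mono p ∷ desc-map mono d

  right⇒desc : ∀ {j λs} → Right j λs → ∃ λ b → Desc b λs
  right⇒desc nil     = 0 , []
  right⇒desc (low R) with b , d ← right⇒desc R = b , desc-++⁺ z≤n d (All.tabulate (λ _ → z≤n)) (z≤n ∷ [])
  right⇒desc (up R)  with b , d ← right⇒desc R = suc b , desc-map s≤s d

  -- If the last entry of a decreasing list is positive, all are, so the outcomes match `low` and
  -- `up`. In the second one the bound goes down, and 1 ≤ b makes this a genuine decrease.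
  last-zero-or-suc : ∀ {b} x xs → Desc b (x ∷ xs) →
    (∃ λ ys → x ∷ xs ≡ ys ∷ʳ 0 × Desc b ys) ⊎ (∃ λ ys → x ∷ xs ≡ map suc ys × Desc (ℕ.pred b) ys × 1 ≤ b)
  last-zero-or-suc zero    [] _        = inj₁ ([] , refl , [])
  last-zero-or-suc (suc x) [] (p ∷ _)  = inj₂ (x ∷ [] , refl , ℕP.pred-mono-≤ p ∷ [] , ℕP.≤-trans (s≤s z≤n) p)
  last-zero-or-suc x (y ∷ xs) (p ∷ d) with last-zero-or-suc y xs d
  ... | inj₁ (ys , eq , d′) = inj₁ (x ∷ ys , cong (x ∷_) eq , p ∷ d′)
  last-zero-or-suc (suc x) (y ∷ xs) (p ∷ d) | inj₂ (ys , eq , d′ , _) =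
    inj₂ (x ∷ ys , cong (suc x ∷_) eq , ℕP.pred-mono-≤ p ∷ d′ , ℕP.≤-trans (s≤s z≤n) p)

  -- The bound b ensures termination: `low` lowers j, while `up` keeps j and lowers b.
  desc⇒right : ∀ j b {xs} → Desc b xs → length xs ≡ j → Right j xs
  desc⇒right zero    b {[]}     d len = nil
  desc⇒right (suc j) b {x ∷ xs} d len with last-zero-or-suc x xs d
  ... | inj₁ (ys , eq , d′) = subst (Right (suc j)) (sym eq) (low (desc⇒right j b d′ (ℕP.suc-injective (begin
    suc (length ys)       ≡⟨ ℕP.+-comm 1 _ ⟩
    length ys ℕ.+ 1       ≡⟨ ListP.length-++ ys ⟨
    length (ys ∷ʳ 0)      ≡⟨ cong length eq ⟨
    suc (length xs)       ≡⟨ len ⟩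
    suc j                 ∎))))
    where open ≡-Reasoning
  desc⇒right (suc j) (suc b) {x ∷ xs} d len | inj₂ (ys , eq , d′ , _) =
    subst (Right (suc j)) (sym eq) (up (desc⇒right (suc j) b d′
      (trans (sym (ListP.length-map suc ys)) (trans (cong length (sym eq)) len))))

  below⇒desc : ∀ {b μs} → Below b μs → Desc b μs × All (1 ≤_) μs
  below⇒desc nil      = [] , []
  below⇒desc (low B)  with d , a ← below⇒desc B = desc-weaken (ℕP.n≤1+n _) d , a
  below⇒desc (part B) with d , a ← below⇒desc B = ℕP.≤-refl ∷ d , s≤s z≤n ∷ a

  desc⇒below : ∀ b {μs} → Desc b μs → All (1 ≤_) μs → Below b μs
  desc⇒below zero    []      _ = nil
  desc⇒below zero    (p ∷ _) (r ∷ _) = contradiction (ℕP.≤-trans r p) (λ ())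
  desc⇒below (suc b) []      _ = low (desc⇒below b [] [])
  desc⇒below (suc b) (p ∷ d) (r ∷ a) = Sum.[
      (λ x<1+b → low (desc⇒below b (ℕP.≤-pred x<1+b ∷ d) (r ∷ a)))
    , (λ x≡1+b → subst (λ z → Below (suc b) (z ∷ _)) (sym x≡1+b) (part (desc⇒below (suc b) (subst (λ z → Desc z _) x≡1+b d) a)))
    ]′ (ℕP.m≤n⇒m<n∨m≡n p)

  IsPartition : ℕ → List ℕ → Set
  IsPartition k π = Desc k π × All (1 ≤_) π × sum π ≡ k

  nonincreasing⇒desc : ∀ x xs → T (nonincreasing (x ∷ xs)) → Desc x xs
  nonincreasing⇒desc x []       t = []
  nonincreasing⇒desc x (y ∷ xs) t with p , r ← Equivalence.to T-∧ t = ℕP.≤ᵇ⇒≤ y x p ∷ nonincreasing⇒desc y xs r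

  desc⇒nonincreasing : ∀ {b xs} → Desc b xs → T (nonincreasing xs)
  desc⇒nonincreasing []          = tt
  desc⇒nonincreasing (p ∷ [])    = tt
  desc⇒nonincreasing (p ∷ r ∷ d) = Equivalence.from T-∧ (ℕP.≤⇒≤ᵇ r , desc⇒nonincreasing (r ∷ d))

  ∈-from1To⁻ : ∀ {b x} → x ∈ from1To b → 1 ≤ x × x ≤ b
  ∈-from1To⁻ x∈ with _ , i<b , refl ← ∈-applyUpTo⁻ suc x∈ = s≤s z≤n , i<b

  ∈-from1To⁺ : ∀ {b x} → 1 ≤ x → x ≤ b → x ∈ from1To b
  ∈-from1To⁺ (s≤s _) p = ∈-applyUpTo⁺ suc p

  ∈-listsOf⁻ : ∀ b ℓ {xs} → xs ∈ listsOf b ℓ → length xs ≡ ℓ × All (1 ≤_) xs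
  ∈-listsOf⁻ b zero    (here refl) = refl , []
  ∈-listsOf⁻ b (suc ℓ) xs∈
    with x , x∈ , xs∈′ ← find (∈-concatMap⁻ (λ x → map (x ∷_) (listsOf b ℓ)) {xs = from1To b} xs∈)
    with ys , ys∈ , refl ← ∈-map⁻ (x ∷_) xs∈′
    with len , pos ← ∈-listsOf⁻ b ℓ ys∈ = cong suc len , proj₁ (∈-from1To⁻ x∈) ∷ pos

  ∈-listsOf⁺ : ∀ b xs → All (1 ≤_) xs → All (_≤ b) xs → xs ∈ listsOf b (length xs)
  ∈-listsOf⁺ b []       []      []      = here refl
  ∈-listsOf⁺ b (x ∷ xs) (p ∷ a) (r ∷ c) = ∈-concatMap⁺ (λ x → map (x ∷_) (listsOf b (length xs)))
    (lose (∈-from1To⁺ p r) (∈-map⁺ (x ∷_) (∈-listsOf⁺ b xs a c)))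

  unique-concatMap : {A B : Set} (f : A → List B) → (∀ x → Unique (f x)) →
    (∀ {x y z} → z ∈ f x → z ∈ f y → x ≡ y) → ∀ {xs} → Unique xs → Unique (concatMap f xs)
  unique-concatMap f uf inj []       = []
  unique-concatMap f uf inj {x ∷ xs} (x∉ ∷ u) = Unique.++⁺ (uf x) (unique-concatMap f uf inj u)
    λ (z∈ , z∈′) → let y , y∈ , z∈″ = find (∈-concatMap⁻ f {xs = xs} z∈′) in All.lookup x∉ y∈ (inj z∈ z∈″)

  unique-listsOf : ∀ b ℓ → Unique (listsOf b ℓ)
  unique-listsOf b zero    = [] ∷ []
  unique-listsOf b (suc ℓ) = unique-concatMap _ (λ x → Unique.map⁺ ListP.∷-injectiveʳ (unique-listsOf b ℓ))
    (λ {x} {y} z∈ z∈′ → same (∈-map⁻ (x ∷_) z∈) (∈-map⁻ (y ∷_) z∈′))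
    (Unique.applyUpTo⁺₁ suc b (λ i<j _ eq → ℕP.<⇒≢ i<j (ℕP.suc-injective eq)))
    where
    same : ∀ {x y z} → (∃ λ u → u ∈ listsOf b ℓ × z ≡ x ∷ u) → (∃ λ u → u ∈ listsOf b ℓ × z ≡ y ∷ u) → x ≡ y
    same (_ , _ , refl) (_ , _ , eq) = ListP.∷-injectiveˡ eq

  ∈-filterB⁻ : {A : Set} (p : A → Bool) (xs : List A) {x : A} → x ∈ filterB p xs → x ∈ xs × T (p x)
  ∈-filterB⁻ p (y ∷ xs) x∈ with p y in eq
  ∈-filterB⁻ p (y ∷ xs) (here refl) | true = here refl , subst T (sym eq) tt
  ∈-filterB⁻ p (y ∷ xs) (there x∈)  | true with r , t ← ∈-filterB⁻ p xs x∈ = there r , t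
  ∈-filterB⁻ p (y ∷ xs) x∈          | false with r , t ← ∈-filterB⁻ p xs x∈ = there r , t

  ∈-filterB⁺ : {A : Set} (p : A → Bool) (xs : List A) {x : A} → x ∈ xs → T (p x) → x ∈ filterB p xs
  ∈-filterB⁺ p (y ∷ xs) x∈ t with p y in eq
  ∈-filterB⁺ p (y ∷ xs) (here refl) t | true  = here refl
  ∈-filterB⁺ p (y ∷ xs) (there x∈)  t | true  = there (∈-filterB⁺ p xs x∈ t)
  ∈-filterB⁺ p (y ∷ xs) (here refl) t | false = contradiction (subst T eq t) (λ ())
  ∈-filterB⁺ p (y ∷ xs) (there x∈)  t | false = ∈-filterB⁺ p xs x∈ t

  unique-filterB : {A : Set} (p : A → Bool) {xs : List A} → Unique xs → Unique (filterB p xs)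
  unique-filterB p []       = []
  unique-filterB p {x ∷ xs} (x∉ ∷ u) with p x
  ... | true  = All.tabulate (λ y∈ → All.lookup x∉ (proj₁ (∈-filterB⁻ p xs y∈))) ∷ unique-filterB p u
  ... | false = unique-filterB p u

  ΣI-filterB : {A : Set} (p : A → Bool) (f : A → ℤ) (xs : List A) →
    ΣI (λ x → if p x then f x else 0ℤ) xs ≡ ΣI f (filterB p xs)
  ΣI-filterB p f []       = refl
  ΣI-filterB p f (x ∷ xs) with p x
  ... | true  = cong (λ z → f x + z) (ΣI-filterB p f xs)
  ... | false = trans (ℤP.+-identityˡ _) (ΣI-filterB p f xs)

  length≤sum : ∀ {xs} → All (1 ≤_) xs → length xs ≤ sum xs
  length≤sum []      = z≤n
  length≤sum (p ∷ a) = ℕP.+-mono-≤ p (length≤sum a)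

  ∈-partitionsOf⁻ : ∀ k {π} → π ∈ partitionsOf k → IsPartition k π
  ∈-partitionsOf⁻ k {π} π∈
    with π∈′ , t ← ∈-filterB⁻ (λ π → nonincreasing π ∧ (sum π ℕ.≡ᵇ k)) (concatMap (listsOf k) (from0To k)) π∈
    with ℓ , _ , π∈″ ← find (∈-concatMap⁻ (listsOf k) {xs = from0To k} π∈′)
    with t₁ , t₂ ← Equivalence.to T-∧ t
    with _ , pos ← ∈-listsOf⁻ k ℓ π∈″
    with sm ← ℕP.≡ᵇ⇒≡ (sum π) k t₂ = desc π t₁ sm , pos , sm
    where
    desc : ∀ π → T (nonincreasing π) → sum π ≡ k → Desc k π
    desc []      _ _    = []
    desc (x ∷ π) t refl = ℕP.m≤m+n x (sum π) ∷ nonincreasing⇒desc x π t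

  ∈-partitionsOf⁺ : ∀ k {π} → IsPartition k π → π ∈ partitionsOf k
  ∈-partitionsOf⁺ k {π} (d , pos , sm) = ∈-filterB⁺ (λ π → nonincreasing π ∧ (sum π ℕ.≡ᵇ k)) (concatMap (listsOf k) (from0To k))
    (∈-concatMap⁺ (listsOf k) (lose (∈-applyUpTo⁺ id (s≤s (subst (length π ≤_) sm (length≤sum pos))))
      (∈-listsOf⁺ k π pos (desc-bounded d))))
    (Equivalence.from T-∧ (desc⇒nonincreasing d , ℕP.≡⇒≡ᵇ (sum π) k sm))

  unique-partitionsOf : ∀ k → Unique (partitionsOf k)
  unique-partitionsOf k = unique-filterB _ (unique-concatMap (listsOf k) (unique-listsOf k)
    (λ {x} {y} z∈ z∈′ → trans (sym (proj₁ (∈-listsOf⁻ k x z∈))) (proj₁ (∈-listsOf⁻ k y z∈′))) (Unique.upTo⁺ (suc k)))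

  countGE-++ : ∀ {c xs} ys → All (c ≤_) xs → countGE c (xs ++ ys) ≡ length xs ℕ.+ countGE c ys
  countGE-++ ys [] = refl
  countGE-++ {c} {x ∷ xs} ys (p ∷ a) with c ℕ.≤ᵇ x in eq
  ... | true  = cong suc (countGE-++ ys a)
  ... | false = contradiction (subst T eq (ℕP.≤⇒≤ᵇ p)) (λ ())

  countGE-small : ∀ {c ys} → All (_< c) ys → countGE c ys ≡ 0
  countGE-small [] = refl
  countGE-small {c} {y ∷ ys} (p ∷ a) with c ℕ.≤ᵇ y in eq
  ... | true  = contradiction (ℕP.≤ᵇ⇒≤ c y (subst T (sym eq) tt)) (ℕP.<⇒≱ p)
  ... | false = countGE-small a

  countGE-++-≤ : ∀ c xs ys → countGE c (xs ++ ys) ≤ length xs ℕ.+ countGE c ys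
  countGE-++-≤ c []       ys = ℕP.≤-refl
  countGE-++-≤ c (x ∷ xs) ys with c ℕ.≤ᵇ x
  ... | true  = s≤s (countGE-++-≤ c xs ys)
  ... | false = ℕP.m≤n⇒m≤1+n (countGE-++-≤ c xs ys)

  -- In a decreasing list a first entry below c forces all entries below c, so that none is counted;
  -- hence the large entries form a prefix.
  take-large : ∀ j c {b} π → Desc b π → j ≤ countGE c π →
    ∃ λ xs → ∃ λ ys → π ≡ xs ++ ys × length xs ≡ j × All (c ≤_) xs
  take-large zero    c π d p = [] , π , refl , refl , []
  take-large (suc j) c (x ∷ π) (_ ∷ d) p with c ℕ.≤ᵇ x in eq
  ... | true with xs , ys , refl , len , a ← take-large j c π d (ℕP.≤-pred p) =
    x ∷ xs , ys , refl , cong suc len , ℕP.≤ᵇ⇒≤ c x (subst T (sym eq) tt) ∷ a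
  ... | false = contradiction (subst (suc j ≤_) (countGE-small (All.map (λ r → ℕP.≤-<-trans r x<c) (desc-bounded d))) p) (λ ())
    where
    x<c : x < c
    x<c = ℕP.≰⇒> (λ r → subst T eq (ℕP.≤⇒≤ᵇ r))

  DurfeeSplit : ℕ → List ℕ → Set
  DurfeeSplit j π = ∃ λ xs → ∃ λ ys → π ≡ xs ++ ys × length xs ≡ j × All (j ≤_) xs × All (_≤ j) ys

  split⇒hasDurfee : ∀ {j π} → DurfeeSplit j π → T (hasDurfee π j)
  split⇒hasDurfee {j} (xs , ys , refl , refl , a , c) = Equivalence.from T-∧
    ( ℕP.≤⇒≤ᵇ (subst (j ≤_) (sym (countGE-++ ys a)) (ℕP.m≤m+n j _))
    , ¬T⇒T-not (λ t → ℕP.<⇒≱ (s≤s (ℕP.≤-trans (countGE-++-≤ (suc j) xs ys)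
        (ℕP.≤-reflexive (trans (cong (j ℕ.+_) (countGE-small (All.map s≤s c))) (ℕP.+-identityʳ j)))))
        (ℕP.≤ᵇ⇒≤ (suc j) _ t)))
    where
    ¬T⇒T-not : ∀ {b} → ¬ T b → T (not b)
    ¬T⇒T-not {true}  f = f tt
    ¬T⇒T-not {false} f = tt

  hasDurfee⇒split : ∀ {j b π} → Desc b π → T (hasDurfee π j) → DurfeeSplit j π
  hasDurfee⇒split {j} {b} {π} d t with t₁ , t₂ ← Equivalence.to T-∧ t
    with take-large j j π d (ℕP.≤ᵇ⇒≤ j (countGE j π) t₁)
  ... | xs , [] , refl , len , a = xs , [] , refl , len , a , []
  ... | xs , y ∷ ys , refl , len , a with desc-++⁻ xs d
  ...   | _ , y≤xs , dy , _ = xs , y ∷ ys , refl , len , a , y≤j ∷ All.map (λ r → ℕP.≤-trans r y≤j) (desc-bounded dy)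
    where
    T-not⇒¬T : ∀ {b} → T (not b) → ¬ T b
    T-not⇒¬T {false} _ ()
    y≤j : y ≤ j
    -- Otherwise `xs` and y would be j + 1 parts that are at least j + 1, against the second half of
    -- `hasDurfee`.
    y≤j = ℕP.≮⇒≥ (λ j<y → T-not⇒¬T t₂ (ℕP.≤⇒≤ᵇ (begin
      suc j                                    ≡⟨ trans (cong suc (sym len)) (ℕP.+-comm 1 _) ⟩
      length xs ℕ.+ 1                          ≤⟨ ℕP.+-monoʳ-≤ (length xs) (s≤s z≤n) ⟩
      length xs ℕ.+ suc (countGE (suc j) ys)   ≡⟨ cong (length xs ℕ.+_) (countGE-++ {suc j} {y ∷ []} ys (j<y ∷ [])) ⟨
      length xs ℕ.+ countGE (suc j) (y ∷ ys)   ≡⟨ countGE-++ (y ∷ ys) (All.map (ℕP.≤-trans j<y) y≤xs) ⟨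
      countGE (suc j) (xs ++ y ∷ ys)           ∎)))
      where open ℕP.≤-Reasoning

  assemble : ℕ → List ℕ × List ℕ → List ℕ
  assemble j (λs , μs) = map (j ℕ.+_) λs ++ μs

  HasDurfee : ℕ → ℕ → List ℕ → Set
  HasDurfee j k π = IsPartition k π × T (hasDurfee π j)

  DurfeeImage : ℕ → ℕ → List ℕ → Set
  DurfeeImage j k = Image (assemble j) (Delayed (j ℕ.* j) (Pair j j) k)

  sum-assemble : ∀ {j λs μs} → Right j λs → sum (assemble j (λs , μs)) ≡ j ℕ.* j ℕ.+ (sum λs ℕ.+ sum μs)
  sum-assemble {j} {λs} {μs} R = begin
    sum (map (j ℕ.+_) λs ++ μs)                 ≡⟨ sum-++ (map (j ℕ.+_) λs) μs ⟩
    sum (map (j ℕ.+_) λs) ℕ.+ sum μs            ≡⟨ cong (ℕ._+ sum μs) (sum-map-+ j λs) ⟩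
    length λs ℕ.* j ℕ.+ sum λs ℕ.+ sum μs       ≡⟨ cong (λ l → l ℕ.* j ℕ.+ sum λs ℕ.+ sum μs) (right-length R) ⟩
    j ℕ.* j ℕ.+ sum λs ℕ.+ sum μs               ≡⟨ ℕP.+-assoc (j ℕ.* j) _ _ ⟩
    j ℕ.* j ℕ.+ (sum λs ℕ.+ sum μs)             ∎
    where open ≡-Reasoning

  all-shifted : ∀ j λs → All (j ≤_) (map (j ℕ.+_) λs)
  all-shifted j []       = []
  all-shifted j (x ∷ λs) = ℕP.m≤m+n j x ∷ all-shifted j λs

  -- Any bound can be exchanged for the sum, which is the bound that `IsPartition` asks for.
  desc-sum : ∀ {b xs} → Desc b xs → Desc (sum xs) xs
  desc-sum []                    = []
  desc-sum (_∷_ {xs = xs} p d)   = ℕP.m≤m+n _ (sum xs) ∷ d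

  image⇒durfee : ∀ {j k π} → DurfeeImage j k π → HasDurfee j k π
  image⇒durfee {j} ((λs , μs) , (r , refl , R , B , refl) , refl)
    with b , d ← right⇒desc R | dμ , pos ← below⇒desc B =
      ( subst (λ k → Desc k (assemble j (λs , μs))) (sum-assemble {μs = μs} R) (desc-sum (desc-++⁺ (ℕP.m≤m+n j b) (desc-map (ℕP.+-monoʳ-≤ j) d) (all-shifted j λs) dμ))
      , positive j R pos
      , sum-assemble R )
    , split⇒hasDurfee (map (j ℕ.+_) λs , μs , refl , trans (ListP.length-map (j ℕ.+_) λs) (right-length R) , all-shifted j λs , desc-bounded dμ)
    where
    positive : ∀ j {λs μs} → Right j λs → All (1 ≤_) μs → All (1 ≤_) (map (j ℕ.+_) λs ++ μs)
    positive zero nil a = a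
    positive (suc j) {λs} R a = go λs
      where
      go : ∀ λs → All (1 ≤_) (map (suc j ℕ.+_) λs ++ _)
      go []       = a
      go (x ∷ λs) = s≤s z≤n ∷ go λs

  durfee⇒image : ∀ {j k π} → HasDurfee j k π → DurfeeImage j k π
  durfee⇒image {j} {k} ((d , pos , sm) , t) with hasDurfee⇒split d t
  ... | xs , ys , refl , len , a , c =
    (λs , ys) , (sum λs ℕ.+ sum ys , trans (sym (sum-assemble R)) (trans (cong (λ z → sum (z ++ ys)) eq) sm) , R , desc⇒below j (dys xs d) (proj₂ (++⁻ xs pos)) , refl)
    , cong (_++ ys) (sym eq)
    where
    λs = map (ℕ._∸ j) xs
    R : Right j λs
    R = desc⇒right j (k ℕ.∸ j) (desc-map (ℕP.∸-monoˡ-≤ j) (desc-++⁻ˡ xs d)) (trans (ListP.length-map (ℕ._∸ j) xs) len)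
    unshift : ∀ {xs} → All (j ≤_) xs → map (j ℕ.+_) (map (ℕ._∸ j) xs) ≡ xs
    unshift []      = refl
    unshift (p ∷ a) = cong₂ _∷_ (ℕP.m+[n∸m]≡n p) (unshift a)
    eq : map (j ℕ.+_) λs ≡ xs
    eq = unshift a
    dys : ∀ {b} xs → Desc b (xs ++ ys) → Desc j ys
    dys (x ∷ xs) (_ ∷ d) = dys xs d
    dys []       d       = tighten c d
      where
      tighten : ∀ {b ys} → All (_≤ j) ys → Desc b ys → Desc j ys
      tighten []      []      = []
      tighten (p ∷ _) (_ ∷ d) = p ∷ d

  shifted-++-injective : ∀ j xs xs′ {ys ys′} → length xs ≡ length xs′ →
    map (j ℕ.+_) xs ++ ys ≡ map (j ℕ.+_) xs′ ++ ys′ → xs ≡ xs′ × ys ≡ ys′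
  shifted-++-injective j []       []         _   eq = refl , eq
  shifted-++-injective j (x ∷ xs) (x′ ∷ xs′) len eq
    with p , r ← shifted-++-injective j xs xs′ (ℕP.suc-injective len) (ListP.∷-injectiveʳ eq) =
      cong₂ _∷_ (ℕP.+-cancelˡ-≡ j x x′ (ListP.∷-injectiveˡ eq)) p , r

  assemble-injective : ∀ {j k x y} → Delayed (j ℕ.* j) (Pair j j) k x → Delayed (j ℕ.* j) (Pair j j) k y →
    assemble j x ≡ assemble j y → x ≡ y
  assemble-injective {j} (_ , _ , R , _) (_ , _ , R′ , _) eq
    with p , r ← shifted-++-injective j _ _ (trans (right-length R) (sym (right-length R′))) eq = cong₂ _,_ p r

  rank-assemble : ∀ {j k p} → Delayed (j ℕ.* j) (Pair j j) k p → rank (assemble j p) ≡ + top (proj₁ p) - + length (proj₂ p)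
  -- Both lists are empty here, and the default value 0 of `rank` is the right one.
  rank-assemble {zero} (_ , _ , nil , nil , _) = refl
  rank-assemble {suc j} {p = [] , μs} (_ , _ , R , _) with () ← right-length R
  rank-assemble {suc j} {p = x ∷ λs , μs} (_ , _ , R , _) = begin
    + (suc j ℕ.+ x) - + suc (length (map (suc j ℕ.+_) λs ++ μs))
      ≡⟨ cong (λ l → + (suc j ℕ.+ x) - + suc l) (trans (ListP.length-++ (map (suc j ℕ.+_) λs))
           (cong (ℕ._+ length μs) (trans (ListP.length-map (suc j ℕ.+_) λs) (ℕP.suc-injective (right-length R))))) ⟩
    + (suc j ℕ.+ x) - + (suc j ℕ.+ length μs)
      ≡⟨ cancel (+ suc j) (+ x) (+ length μs) ⟩
    + x - + length μs ∎
    where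
    open ≡-Reasoning
    cancel : ∀ j x l → j + x - (j + l) ≡ x - l
    cancel = solve-∀

  durfeeSeries : ℕ → (ℤ → ℤ) → PS
  durfeeSeries j w k = ΣI (λ π → if hasDurfee π j then w (rank π) else 0ℤ) (partitionsOf k)

  durfeeSeries-pair : ∀ j w → durfeeSeries j w ≗ delay (j ℕ.* j) (pairSeries j j w)
  durfeeSeries-pair j w k = begin
    durfeeSeries j w k
      ≡⟨ ΣI-filterB (λ π → hasDurfee π j) (w ∘ rank) (partitionsOf k) ⟩
    ΣI (w ∘ rank) (filterB (λ π → hasDurfee π j) (partitionsOf k))
      ≡⟨ ΣI-enum (w ∘ rank) enumDurfee (enum-image (assemble j) assemble-injective D) durfee⇒image image⇒durfee ⟩
    ΣI (w ∘ rank) (map (assemble j) (list D))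
      ≡⟨ trans (ΣI-map (w ∘ rank) (assemble j) (list D)) (ΣI-cong∈ (list D) (λ p∈ → cong w (rank-assemble (sound D p∈)))) ⟩
    ΣI (weight w) (list D)
      ≡⟨ ΣI-delayed (weight w) (j ℕ.* j) k (enumPair j j) ⟩
    delay (j ℕ.* j) (pairSeries j j w) k ∎
    where
    open ≡-Reasoning
    D = enum-delayed (j ℕ.* j) k (λ r _ → enumPair j j r)
    enumDurfee : Enum (HasDurfee j k)
    enumDurfee = record
      { list     = filterB (λ π → hasDurfee π j) (partitionsOf k)
      ; unique   = unique-filterB _ (unique-partitionsOf k)
      ; sound    = λ π∈ → let p , t = ∈-filterB⁻ _ (partitionsOf k) π∈ in ∈-partitionsOf⁻ k p , t
      ; complete = λ (p , t) → ∈-filterB⁺ _ (partitionsOf k) (∈-partitionsOf⁺ k p) t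
      }

open Partitions

-- Powers of q and reciprocals of power series.

module SeriesTools where
  open import Data.Integer using (_+_; _*_; -_)

  delay-⊛ : ∀ m f g → (delay m f ⊛ g) ≗ delay m (f ⊛ g)
  delay-⊛ zero    f g n       = refl
  delay-⊛ (suc m) f g zero    = ⊛-zero (delay (suc m) f) g
  delay-⊛ (suc m) f g (suc n) = trans (⊛-suc (delay (suc m) f) g n) (trans (ℤP.+-identityˡ _) (delay-⊛ m f g n))

  delay-+ : ∀ a b f → delay (a ℕ.+ b) f ≗ delay a (delay b f)
  delay-+ zero    b f n       = refl
  delay-+ (suc a) b f zero    = refl
  delay-+ (suc a) b f (suc n) = delay-+ a b f n

  delay-neg : ∀ m f → delay m (neg f) ≗ neg (delay m f)
  delay-neg zero    f n       = refl
  delay-neg (suc m) f zero    = refl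
  delay-neg (suc m) f (suc n) = delay-neg m f n

  q : ℕ → PS
  q n = delay n δ0

  q-⊛ : ∀ m f → (q m ⊛ f) ≗ delay m f
  q-⊛ m f n = trans (delay-⊛ m δ0 f n) (delay-cong m (⊛-identityˡ f) n)

  q-+ : ∀ a b → q (a ℕ.+ b) ≗ (q a ⊛ q b)
  q-+ a b n = trans (delay-+ a b δ0 n) (sym (q-⊛ a (q b) n))

  v : ℕ → PS
  v n = invPS (δ0 ⊞ neg (q (suc n)))

  -- `invPS` uses the constant term as its own inverse, which is correct exactly when its square is
  -- 1.
  UnitConstant : PS → Set
  UnitConstant f = f 0 * f 0 ≡ 1ℤ

  unit-⊛ : ∀ {f g} → UnitConstant f → UnitConstant g → UnitConstant (f ⊛ g)
  unit-⊛ {f} {g} hf hg = begin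
    (f ⊛ g) 0 * (f ⊛ g) 0          ≡⟨ cong₂ _*_ (⊛-zero f g) (⊛-zero f g) ⟩
    f 0 * g 0 * (f 0 * g 0)        ≡⟨ regroup (f 0) (g 0) ⟩
    f 0 * f 0 * (g 0 * g 0)        ≡⟨ cong₂ _*_ hf hg ⟩
    1ℤ                             ∎
    where
    open ≡-Reasoning
    regroup : ∀ a b → a * b * (a * b) ≡ a * a * (b * b)
    regroup = solve-∀

  -- The bound n only limits how far the recursion has run; coefficient k no longer changes once n
  -- reaches k.
  invUpTo≡invPS : ∀ f n k → k ≤ n → invUpTo f n k ≡ invPS f k
  invUpTo≡invPS f zero    zero z≤n = refl
  invUpTo≡invPS f (suc n) k p with ℕP.m≤n⇒m<n∨m≡n p
  ... | inj₂ refl      = refl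
  ... | inj₁ (s≤s k≤n) with k ℕ.≤ᵇ n in eq
  ...   | true  = invUpTo≡invPS f n k k≤n
  ...   | false = contradiction (subst T eq (ℕP.≤⇒≤ᵇ k≤n)) (λ ())

  invPS-suc : ∀ f n → invPS f (suc n) ≡ - (f 0 * (tail f ⊛ invPS f) n)
  invPS-suc f n with suc n ℕ.≤ᵇ n in eq
  ... | true  = contradiction (ℕP.≤ᵇ⇒≤ (suc n) n (subst T (sym eq) tt)) ℕP.1+n≰n
  ... | false = cong (λ z → - (f 0 * z)) (trans (ΣI-applyUpTo (λ i → f i * invUpTo f n (suc n ℕ.∸ i)) suc (suc n))
    (ΣI-cong (λ i → cong (f (suc i) *_) (invUpTo≡invPS f n (n ℕ.∸ i) (ℕP.m∸n≤m n i))) (upTo (suc n))))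

  invPS-inverse : ∀ f → UnitConstant f → (f ⊛ invPS f) ≗ δ0
  invPS-inverse f h zero    = trans (⊛-zero f (invPS f)) h
  invPS-inverse f h (suc n) = begin
    (f ⊛ invPS f) (suc n)                ≡⟨ ⊛-suc f (invPS f) n ⟩
    f 0 * invPS f (suc n) + S            ≡⟨ cong (λ z → f 0 * z + S) (invPS-suc f n) ⟩
    f 0 * - (f 0 * S) + S                ≡⟨ regroup (f 0) S ⟩
    - (f 0 * f 0 * S) + S                ≡⟨ cong (λ z → - (z * S) + S) h ⟩
    - (1ℤ * S) + S                       ≡⟨ vanish S ⟩
    0ℤ                                   ∎
    where
    open ≡-Reasoning
    S = (tail f ⊛ invPS f) n
    regroup : ∀ a s → a * - (a * s) + s ≡ - (a * a * s) + s
    regroup = solve-∀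
    vanish : ∀ s → - (1ℤ * s) + s ≡ 0ℤ
    vanish = solve-∀

  q-zero : q 0 ≗ δ0
  q-zero _ = refl

  1-q*v : ∀ n → ((δ0 ⊞ neg (q (suc n))) ⊛ v n) ≗ δ0
  1-q*v n = invPS-inverse (δ0 ⊞ neg (q (suc n))) refl

open SeriesTools

module R = CommutativeRing psRing
open QSeries psRing constHom
  using (ΣR; ΣR-*ˡ; inverse-unique; alt; tri; second-difference; unit-pow; pow-double; pow-double-neg; neg*neg; subtract-multiple; module Identities)
open Identities q v q-zero q-+ 1-q*v
  using (u; e; ē; ē-∸; poch; poch*e; prodU; prodU-from1To; prodU-top; Durfee-step; qTerm; middle-term; right-terms; module Recurrence)

-- The recurrence for the Durfee moments.

module DurfeeRecurrence where
  open import Data.Integer using (_+_; _*_; -_; _-_)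

  pairSeries-cong : ∀ j b {w w′ : ℤ → ℤ} → (∀ m → w m ≡ w′ m) → pairSeries j b w ≗ pairSeries j b w′
  pairSeries-cong j b h n = ΣI-cong (λ _ → h _) (list (enumPair j b n))

  pairSeries-+ : ∀ j b (w w′ : ℤ → ℤ) → pairSeries j b (λ m → w m + w′ m) ≗ (pairSeries j b w ⊞ pairSeries j b w′)
  pairSeries-+ j b w w′ n = ΣI-+ (weight w) (weight w′) (list (enumPair j b n))

  private
    up-down : ∀ m → m - 1ℤ + 1ℤ ≡ m
    up-down = solve-∀

  -- The bounds go from (j + 1, j + 1) to (j + 1, j) by removing parts and on to (j, j) by removing
  -- columns; both pieces have size j + 1, so both steps carry the same power of q. Applied to `w⁺`,
  -- the first step leads back to `w`.
  pairSeries-Δ : ∀ j w w′ → (∀ m → w (m + 1ℤ) + w (m - 1ℤ) ≡ w m + w m + w′ m) →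
    (u (suc j) ⊛ u (suc j)) ⊛ pairSeries (suc j) (suc j) w ≗ (pairSeries j j w ⊞ (q (suc j) ⊛ pairSeries (suc j) (suc j) w′))
  pairSeries-Δ j w w′ Δ = second-difference {q (suc j)} {Y w} {Y w⁺} {Y w⁻} {V w} {V w⁺} {pairSeries j j w} {Y w′}
    (λ n → trans (pairSeries-part (suc j) j w n) (cong (λ z → V w n + z) (sym (q-⊛ (suc j) (Y w⁻) n))))
    (λ n → trans (pairSeries-column j j w n) (cong (λ z → pairSeries j j w n + z) (sym (q-⊛ (suc j) (V w⁺) n))))
    (λ n → trans (pairSeries-part (suc j) j w⁺ n) (cong (λ z → V w⁺ n + z) (trans
      (delay-cong (suc j) (pairSeries-cong (suc j) (suc j) (λ m → cong w (up-down m))) n) (sym (q-⊛ (suc j) (Y w) n)))))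
    (λ n → trans (sym (pairSeries-+ (suc j) (suc j) w⁺ w⁻ n)) (trans (pairSeries-cong (suc j) (suc j) Δ n)
      (trans (pairSeries-+ (suc j) (suc j) (λ m → w m + w m) w′ n) (cong (_+ Y w′ n) (pairSeries-+ (suc j) (suc j) w w n)))))
    where
    w⁺ w⁻ : ℤ → ℤ
    w⁺ m = w (m + 1ℤ)
    w⁻ m = w (m - 1ℤ)
    Y V : (ℤ → ℤ) → PS
    Y = pairSeries (suc j) (suc j)
    V = pairSeries (suc j) j

  moment : ℕ → ℕ → PS
  moment j ν = durfeeSeries j (momentWeight ν)

  moment-pair : ∀ j ν → moment j ν ≗ (q (j ℕ.* j) ⊛ pairSeries j j (momentWeight ν))
  moment-pair j ν n = trans (durfeeSeries-pair j (momentWeight ν) n) (sym (q-⊛ (j ℕ.* j) (pairSeries j j (momentWeight ν)) n))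

  moment-0-0 : moment 0 0 ≗ δ0
  moment-0-0 n = trans (durfeeSeries-pair 0 (momentWeight 0) n)
    (trans (pairSeries-0-0 (momentWeight 0) n) (ℤP.*-identityˡ (δ0 n)))

  moment-0-suc : ∀ ν → moment 0 (suc ν) ≗ zeroPS
  moment-0-suc ν n = trans (durfeeSeries-pair 0 (momentWeight (suc ν)) n)
    (trans (pairSeries-0-0 (momentWeight (suc ν)) n) (cong (_* δ0 n) (momentWeight-suc-0 ν)))

  moment-step : ∀ j ν → (u (suc j) ⊛ u (suc j)) ⊛ moment (suc j) (suc ν)
    ≗ ((q (suc j) ⊛ moment (suc j) ν) ⊞ (q (suc (j ℕ.+ j)) ⊛ moment j (suc ν)))
  moment-step j ν n = trans
    (⊛-cong {f = u (suc j) ⊛ u (suc j)} (λ _ → refl) (moment-pair (suc j) (suc ν)) n)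
    (trans (Durfee-step j {pairSeries j j (momentWeight (suc ν))} {pairSeries (suc j) (suc j) (momentWeight (suc ν))} {pairSeries (suc j) (suc j) (momentWeight ν)}
      (pairSeries-Δ j (momentWeight (suc ν)) (momentWeight ν) (momentWeight-Δ ν)) n)
    (cong₂ _+_
      (⊛-cong {f = q (suc j)} (λ _ → refl) (λ k → sym (moment-pair (suc j) ν k)) n)
      (⊛-cong {f = q (suc (j ℕ.+ j))} (λ _ → refl) (λ k → sym (moment-pair j (suc ν) k)) n)))

  -- The weight for ν = 0 is the constant 1, whose second difference is 0, so the term of the lower
  -- moment is absent.
  moment-step-0 : ∀ j → (u (suc j) ⊛ u (suc j)) ⊛ moment (suc j) 0 ≗ (q (suc (j ℕ.+ j)) ⊛ moment j 0)
  moment-step-0 j n = trans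
    (⊛-cong {f = u (suc j) ⊛ u (suc j)} (λ _ → refl) (moment-pair (suc j) 0) n)
    (trans (Durfee-step j {pairSeries j j (momentWeight 0)} {pairSeries (suc j) (suc j) (momentWeight 0)} {zeroPS}
      (λ k → trans (pairSeries-Δ j (momentWeight 0) (λ _ → 0ℤ) (λ _ → refl) k)
        (cong (λ z → pairSeries j j (momentWeight 0) k + z)
          (⊛-cong {f = q (suc j)} (λ _ → refl) (λ i → ΣI-0 (list (enumPair (suc j) (suc j) i))) k))) n)
    (trans (cong₂ _+_
        (trans (⊛-cong {f = q (suc j)} (λ _ → refl) (R.zeroʳ (q (suc j ℕ.* suc j))) n) (R.zeroʳ (q (suc j)) n))
        (⊛-cong {f = q (suc (j ℕ.+ j))} (λ _ → refl) (λ k → sym (moment-pair j 0 k)) n))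
      (ℤP.+-identityˡ _)))

  Σmoment : ∀ N ν → ΣR N (λ j → ē N (suc j) ⊛ moment (suc j) (suc ν)) ≗ ΣR N (qTerm N (suc ν))
  Σmoment = Recurrence.ΣW moment moment-0-0 moment-0-suc moment-step-0 moment-step

open DurfeeRecurrence

-- From η to the Durfee moments.

module EtaSeries where
  open Algebra.Properties.AbelianGroup ℤP.+-0-abelianGroup using (∙-cancelʳ)
  open import Data.Integer using (_+_; _*_; -_; _-_; +_)

  eqℤ-refl : ∀ r → eqℤ r r ≡ true
  eqℤ-refl r = Equivalence.to T-≡ (Equivalence.from (T-∧ {r ℤ.≤ᵇ r}) (ℤP.≤⇒≤ᵇ (ℤP.≤-refl {r}) , ℤP.≤⇒≤ᵇ (ℤP.≤-refl {r})))

  eqℤ-≢ : ∀ {r m} → r ≢ m → eqℤ r m ≡ false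
  eqℤ-≢ {r} {m} r≢m with eqℤ r m in eq
  ... | false = refl
  ... | true with p , s ← Equivalence.to (T-∧ {r ℤ.≤ᵇ m}) (subst T (sym eq) tt) =
    contradiction (ℤP.≤-antisym (ℤP.≤ᵇ⇒≤ p) (ℤP.≤ᵇ⇒≤ s)) r≢m

  ΣI-pick-0 : ∀ (L : ℤ → ℤ) s r ms → All (r ≢_) ms → ΣI (λ m → L m * (if eqℤ r m then s else 0ℤ)) ms ≡ 0ℤ
  ΣI-pick-0 L s r []       []       = refl
  ΣI-pick-0 L s r (m ∷ ms) (h ∷ hs) rewrite eqℤ-≢ h = trans
    (cong₂ _+_ (ℤP.*-zeroʳ (L m)) (ΣI-pick-0 L s r ms hs)) refl

  ΣI-pick : ∀ (L : ℤ → ℤ) s {r ms} → Unique ms → r ∈ ms → ΣI (λ m → L m * (if eqℤ r m then s else 0ℤ)) ms ≡ L r * s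
  ΣI-pick L s {r} {m ∷ ms} (h ∷ u) (here refl) rewrite eqℤ-refl r =
    trans (cong (λ z → L r * s + z) (ΣI-pick-0 L s r ms h)) (ℤP.+-identityʳ _)
  ΣI-pick L s {r} {m ∷ ms} (h ∷ u) (there r∈) rewrite eqℤ-≢ {r} {m} (λ { refl → All.lookup h r∈ refl }) =
    trans (cong₂ _+_ (ℤP.*-zeroʳ (L m)) (ΣI-pick L s u r∈)) (ℤP.+-identityˡ _)

  unique-intRange : ∀ n → Unique (intRange n)
  unique-intRange n = Unique.map⁺ (λ {a} {b} eq → ℤP.+-injective (∙-cancelʳ (- (+ n)) (+ a) (+ b) eq)) (Unique.upTo⁺ (suc (n ℕ.+ n)))

  -- Largest part and number of parts are at most k ≤ n, so the range -n to n in `η` misses no rank.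
  rank∈intRange : ∀ {n k π} → k ≤ n → IsPartition k π → rank π ∈ intRange n
  -- The witness is the index top π + n ∸ length π, that is rank plus n; nothing is truncated
  -- because length π ≤ n.
  rank∈intRange {n} {k} {π} k≤n (d , pos , sm) = subst (_∈ intRange n) (eq π l≤n)
    (∈-map⁺ (λ i → + i - + n) (∈-upTo⁺ (s≤s (ℕP.≤-trans (ℕP.m∸n≤m _ (length π)) (ℕP.+-monoˡ-≤ n (top≤n d k≤n))))))
    where
    l≤n : length π ≤ n
    l≤n = ℕP.≤-trans (subst (length π ≤_) sm (length≤sum pos)) k≤n
    top≤n : ∀ {k π} → Desc k π → k ≤ n → top π ≤ n
    top≤n []      p = z≤n
    top≤n (r ∷ _) p = ℕP.≤-trans r p
    eq : ∀ π → length π ≤ n → + (top π ℕ.+ n ℕ.∸ length π) - + n ≡ rank π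
    eq π l≤n = trans (cong (_- + n) (trans (sym (ℤP.⊖-≥ (ℕP.≤-trans l≤n (ℕP.m≤n+m n (top π))))) (sym (ℤP.m-n≡m⊖n (top π ℕ.+ n) (length π)))))
      (trans (cancel (+ top π) (+ n) (+ length π)) (rank≡ π))
      where
      cancel : ∀ t n l → t + n - l - n ≡ t - l
      cancel = solve-∀
      rank≡ : ∀ π → + top π - + length π ≡ rank π
      rank≡ []      = refl
      rank≡ (x ∷ π) = refl

  ΣI-weighted-swap : {A : Set} (L : ℤ → ℤ) (h : ℤ → A → ℤ) (ms : List ℤ) (xs : List A) →
    ΣI (λ m → L m * ΣI (h m) xs) ms ≡ ΣI (λ a → ΣI (λ m → L m * h m a) ms) xs
  ΣI-weighted-swap L h ms xs = trans (ΣI-cong (λ m → sym (ΣI-*ˡ (L m) (h m) xs)) ms) (ΣI-swap (λ m a → L m * h m a) ms xs)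

  ΣI-if : {A : Set} (b : Bool) (f : A → ℤ) (xs : List A) →
    ΣI (λ a → if b then f a else 0ℤ) xs ≡ (if b then ΣI f xs else 0ℤ)
  ΣI-if true  f xs = refl
  ΣI-if false f xs = ΣI-0 xs

  -- Only k = n - s can contribute, and n ≤ B keeps it in range. The bound B is separate from n
  -- because lowering s lowers n but not B.
  ΣI-delay : ∀ s n B (f : ℕ → ℤ) → n ≤ B → ΣI (λ k → if (s ℕ.+ k) ℕ.≡ᵇ n then f k else 0ℤ) (from0To B) ≡ delay s f n
  ΣI-delay zero zero B f p = trans (cong (λ z → f 0 + z) (trans (ΣI-applyUpTo (λ k → if k ℕ.≡ᵇ 0 then f k else 0ℤ) suc B) (ΣI-0 (upTo B)))) (ℤP.+-identityʳ _)
  ΣI-delay zero (suc n) (suc B) f (s≤s p) = trans (ℤP.+-identityˡ _)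
    (trans (ΣI-applyUpTo (λ k → if k ℕ.≡ᵇ suc n then f k else 0ℤ) suc (suc B)) (ΣI-delay zero n B (f ∘ suc) p))
  ΣI-delay (suc s) zero    B f p = ΣI-0 (from0To B)
  ΣI-delay (suc s) (suc n) B f p = ΣI-delay s n B f (ℕP.≤-trans (ℕP.n≤1+n n) p)

  sgn-suc : ∀ k → sgn (suc k) ≡ - sgn k
  sgn-suc zero          = refl
  sgn-suc (suc zero)    = refl
  sgn-suc (suc (suc k)) = sgn-suc k

  signedSublists : List ℕ → PS → PS
  signedSublists ns f n = ΣI (λ π → sgn (length π) * delay (sum π) f n) (sublists ns)

  -- Sublists with m contribute the factor -qᵐ, those without it the factor 1. The induction needs
  -- all `f`, because the former lead to the sum for `delay m f`.
  signedSublists≗prodU : ∀ ns f → signedSublists ns f ≗ (prodU ns ⊛ f)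
  signedSublists≗prodU []       f n = trans (ℤP.+-identityʳ _) (trans (ℤP.*-identityˡ _) (sym (⊛-identityˡ f n)))
  signedSublists≗prodU (m ∷ ns) f n = begin
    ΣI F (map (m ∷_) (sublists ns) ++ sublists ns)
      ≡⟨ trans (ΣI-++ F (map (m ∷_) (sublists ns)) (sublists ns)) (ℤP.+-comm (ΣI F (map (m ∷_) (sublists ns))) _) ⟩
    signedSublists ns f n + ΣI F (map (m ∷_) (sublists ns))
      ≡⟨ cong (λ z → signedSublists ns f n + z) (trans (ΣI-map F (m ∷_) (sublists ns)) (trans
           (ΣI-cong flip (sublists ns)) (trans (ΣI-*ˡ (- 1ℤ) _ (sublists ns)) (ℤP.-1*i≡-i _)))) ⟩
    signedSublists ns f n - signedSublists ns (delay m f) n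
      ≡⟨ cong₂ _-_ (signedSublists≗prodU ns f n) (signedSublists≗prodU ns (delay m f) n) ⟩
    (prodU ns ⊛ f) n - (prodU ns ⊛ delay m f) n
      ≡⟨ cong (λ z → (prodU ns ⊛ f) n - z) (⊛-cong {f = prodU ns} (λ _ → refl) (q-⊛ m f) n) ⟨
    (prodU ns ⊛ f) n - (prodU ns ⊛ (q m ⊛ f)) n
      ≡⟨ subtract-multiple (prodU ns) f (q m) n ⟩
    ((u m ⊛ prodU ns) ⊛ f) n ∎
    where
    open ≡-Reasoning
    F : List ℕ → ℤ
    F π = sgn (length π) * delay (sum π) f n
    regroup : ∀ s d → - s * d ≡ - 1ℤ * (s * d)
    regroup = solve-∀
    flip : ∀ π → F (m ∷ π) ≡ - 1ℤ * (sgn (length π) * delay (sum π) (delay m f) n)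
    flip π = trans (cong₂ _*_ (sgn-suc (length π)) (trans (cong (λ z → delay z f n) (ℕP.+-comm m (sum π))) (delay-+ (sum π) m f n)))
      (regroup (sgn (length π)) _)

  durfeeTerm : ∀ ν n s σ j →
    ΣI (λ k → ΣI (λ π → ΣI (λ m → momentWeight ν m * (if ((s ℕ.+ k) ℕ.≡ᵇ n) ∧ hasDurfee π j ∧ eqℤ (rank π) m then σ else 0ℤ)) (intRange n))
      (partitionsOf k)) (from0To n) ≡ σ * delay s (moment j ν) n
  durfeeTerm ν n s σ j = begin
    ΣI (λ k → ΣI (λ π → ΣI (λ m → momentWeight ν m * (if ((s ℕ.+ k) ℕ.≡ᵇ n) ∧ hasDurfee π j ∧ eqℤ (rank π) m then σ else 0ℤ)) (intRange n))
      (partitionsOf k)) (from0To n)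
      ≡⟨ ΣI-cong∈ (from0To n) (λ {k} k∈ → trans
           (ΣI-cong∈ (partitionsOf k) (λ {π} π∈ → pick ((s ℕ.+ k) ℕ.≡ᵇ n) (hasDurfee π j) (rank∈intRange (ℕP.≤-pred (∈-upTo⁻ k∈)) (∈-partitionsOf⁻ k π∈))))
           (trans (ΣI-if ((s ℕ.+ k) ℕ.≡ᵇ n) (λ π → σ * (if hasDurfee π j then momentWeight ν (rank π) else 0ℤ)) (partitionsOf k))
             (trans (cong (λ z → if (s ℕ.+ k) ℕ.≡ᵇ n then z else 0ℤ) (ΣI-*ˡ σ _ (partitionsOf k))) (factor ((s ℕ.+ k) ℕ.≡ᵇ n) (moment j ν k))))) ⟩
    ΣI (λ k → σ * (if (s ℕ.+ k) ℕ.≡ᵇ n then moment j ν k else 0ℤ)) (from0To n)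
      ≡⟨ ΣI-*ˡ σ _ (from0To n) ⟩
    σ * ΣI (λ k → if (s ℕ.+ k) ℕ.≡ᵇ n then moment j ν k else 0ℤ) (from0To n)
      ≡⟨ cong (σ *_) (ΣI-delay s n n (moment j ν) ℕP.≤-refl) ⟩
    σ * delay s (moment j ν) n ∎
    where
    open ≡-Reasoning
    zeros : ∀ ms → ΣI (λ m → momentWeight ν m * 0ℤ) ms ≡ 0ℤ
    zeros ms = trans (ΣI-cong (λ m → ℤP.*-zeroʳ (momentWeight ν m)) ms) (ΣI-0 ms)
    pick : ∀ a b {r} → r ∈ intRange n →
      ΣI (λ m → momentWeight ν m * (if a ∧ b ∧ eqℤ r m then σ else 0ℤ)) (intRange n)
      ≡ (if a then σ * (if b then momentWeight ν r else 0ℤ) else 0ℤ)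
    pick false b     _  = zeros (intRange n)
    pick true  false _  = trans (zeros (intRange n)) (sym (ℤP.*-zeroʳ σ))
    pick true  true {r} r∈ = trans (ΣI-pick (momentWeight ν) σ (unique-intRange n) r∈) (ℤP.*-comm (momentWeight ν r) σ)
    factor : ∀ b z → (if b then σ * z else 0ℤ) ≡ σ * (if b then z else 0ℤ)
    factor true  z = refl
    factor false z = sym (ℤP.*-zeroʳ σ)

  -- The sum over m is moved inside all sums of `NS1`, where the test for the rank leaves just the
  -- weight at the rank of `π₂`.
  η-moment : ∀ ν N n → η ν N n ≡ ΣI (λ j → signedSublists (map (λ i → N ℕ.∸ i) (upTo j)) (moment j ν) n) (from1To N)
  η-moment ν N n = begin
    η ν N n
      ≡⟨ ΣI-weighted-swap L _ (intRange n) (from1To N) ⟩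
    ΣI (λ j → ΣI (λ m → L m * ΣI (λ π₁ → ΣI (λ k → ΣI (body j m π₁ k) (partitionsOf k)) (from0To n)) (distinctIn N j)) (intRange n)) (from1To N)
      ≡⟨ ΣI-cong (λ j → trans (ΣI-weighted-swap L _ (intRange n) (distinctIn N j))
           (ΣI-cong (λ π₁ → trans (ΣI-weighted-swap L (λ m k → ΣI (body j m π₁ k) (partitionsOf k)) (intRange n) (from0To n))
             (trans (ΣI-cong (λ k → ΣI-weighted-swap L (λ m → body j m π₁ k) (intRange n) (partitionsOf k)) (from0To n))
               (durfeeTerm ν n (sum π₁) (sgn (length π₁)) j))) (distinctIn N j))) (from1To N) ⟩
    ΣI (λ j → signedSublists (map (λ i → N ℕ.∸ i) (upTo j)) (moment j ν) n) (from1To N) ∎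
    where
    open ≡-Reasoning
    L = momentWeight ν
    body : ℕ → ℤ → List ℕ → ℕ → List ℕ → ℤ
    body j m π₁ k π₂ = if ((sum π₁ ℕ.+ k) ℕ.≡ᵇ n) ∧ hasDurfee π₂ j ∧ eqℤ (rank π₂) m then sgn (length π₁) else 0ℤ

  ΣR-eval : ∀ N (f : ℕ → PS) n → ΣR N f n ≡ ΣI (λ j → f j n) (upTo N)
  ΣR-eval zero    f n = refl
  ΣR-eval (suc N) f n = cong (λ z → f 0 n + z) (trans (ΣR-eval N (f ∘ suc) n) (sym (ΣI-applyUpTo (λ j → f j n) suc N)))

  map-upTo : ∀ (f g : ℕ → ℕ) n → map f (applyUpTo g n) ≡ applyUpTo (f ∘ g) n
  map-upTo f g zero    = refl
  map-upTo f g (suc n) = cong (f (g 0) ∷_) (map-upTo f (g ∘ suc) n)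

  η-series : ∀ ν N n → η (suc ν) N n ≡ (poch N ⊛ ΣR N (qTerm N (suc ν))) n
  η-series ν N n = begin
    η (suc ν) N n
      ≡⟨ η-moment (suc ν) N n ⟩
    ΣI (λ j → signedSublists (map (λ i → N ℕ.∸ i) (upTo j)) (moment j (suc ν)) n) (from1To N)
      ≡⟨ ΣI-applyUpTo (λ j → signedSublists (map (λ i → N ℕ.∸ i) (upTo j)) (moment j (suc ν)) n) suc N ⟩
    ΣI (λ j → signedSublists (map (λ i → N ℕ.∸ i) (upTo (suc j))) (moment (suc j) (suc ν)) n) (upTo N)
      ≡⟨ ΣI-cong∈ (upTo N) (λ {j} j∈ → term j (∈-upTo⁻ j∈)) ⟩
    ΣI (λ j → (poch N ⊛ (ē N (suc j) ⊛ moment (suc j) (suc ν))) n) (upTo N)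
      ≡⟨ ΣR-eval N (λ j → poch N ⊛ (ē N (suc j) ⊛ moment (suc j) (suc ν))) n ⟨
    ΣR N (λ j → poch N ⊛ (ē N (suc j) ⊛ moment (suc j) (suc ν))) n
      ≡⟨ ΣR-*ˡ N (poch N) (λ j → ē N (suc j) ⊛ moment (suc j) (suc ν)) n ⟩
    (poch N ⊛ ΣR N (λ j → ē N (suc j) ⊛ moment (suc j) (suc ν))) n
      ≡⟨ ⊛-cong {f = poch N} (λ _ → refl) (Σmoment N ν) n ⟩
    (poch N ⊛ ΣR N (qTerm N (suc ν))) n ∎
    where
    open ≡-Reasoning
    term : ∀ j → j < N → signedSublists (map (λ i → N ℕ.∸ i) (upTo (suc j))) (moment (suc j) (suc ν)) n
      ≡ (poch N ⊛ (ē N (suc j) ⊛ moment (suc j) (suc ν))) n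
    term j j<N = trans (signedSublists≗prodU (map (λ i → N ℕ.∸ i) (upTo (suc j))) (moment (suc j) (suc ν)) n)
      (trans (⊛-cong {g = moment (suc j) (suc ν)}
          (λ k → trans (cong (λ l → prodU l k) (map-upTo (N ℕ.∸_) id (suc j))) (prodU-top N (suc j) j<N k)) (λ _ → refl) n)
        (⊛-assoc (poch N) (ē N (suc j)) (moment (suc j) (suc ν)) n))

  -- `etaSeries` starts at n = 1 and has constant coefficient 0 by definition; this makes it agree
  -- with the formula for η at n = 0.
  η-zero : ∀ ν N → η ν N 0 ≡ 0ℤ
  η-zero ν N = trans (η-moment ν N 0) (trans
    (ΣI-applyUpTo (λ j → signedSublists (map (λ i → N ℕ.∸ i) (upTo j)) (moment j ν) 0) suc N)
    (trans (ΣI-cong (λ j → trans (signedSublists≗prodU (tops j) (moment (suc j) ν) 0)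
      -- The constant coefficient of the moment computes to 0: the empty partition has no Durfee
      -- square of positive size.
      (trans (⊛-zero (prodU (tops j)) (moment (suc j) ν)) (ℤP.*-zeroʳ (prodU (tops j) 0)))) (upTo N)) (ΣI-0 (upTo N))))
    where
    tops : ℕ → List ℕ
    tops j = map (λ i → N ℕ.∸ i) (upTo (suc j))

open EtaSeries

-- The finite sums as Laurent series.

module LaurentSeries where
  open import Data.Integer using (_+_; _*_; -_; _-_; +_; -[1+_]; _⊖_; ∣_∣; _⊓_; _/ℕ_)
  open import Algebra.Properties.Semiring.Exp R.semiring using (_^_)

  infix 4 _≅_
  -- Finer than equality of all coefficients, since a Laurent series has several representations.
  -- Products and inverses are computed from the representation, so this relation passes through
  -- them.
  record _≅_ (x y : Laurent) : Set where
    constructor _,_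
    field
      shift≡  : shift x ≡ shift y
      series≗ : series x ≗ series y
  open _≅_

  coefficient : PS → ℤ → ℤ
  coefficient f (+ k)    = f k
  coefficient f -[1+ _ ] = 0ℤ

  coeff≡coefficient : ∀ x m → coeff x m ≡ coefficient (series x) (m - shift x)
  coeff≡coefficient (f ·q^ s) m with m - s
  ... | + k      = refl
  ... | -[1+ _ ] = refl

  coefficient-cong : ∀ {f g} → f ≗ g → ∀ z → coefficient f z ≡ coefficient g z
  coefficient-cong h (+ k)    = h k
  coefficient-cong h -[1+ _ ] = refl

  coeff-cong : ∀ {x y} → x ≅ y → ∀ m → coeff x m ≡ coeff y m
  coeff-cong {x} {y} (p , h) m = trans (coeff≡coefficient x m) (trans (cong (λ s → coefficient (series x) (m - s)) p)
    (trans (coefficient-cong h (m - shift y)) (sym (coeff≡coefficient y m))))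

  coefficient-⊖ : ∀ f a k → coefficient f (k ⊖ a) ≡ delay a f k
  coefficient-⊖ f zero    k       = refl
  coefficient-⊖ f (suc a) zero    = refl
  coefficient-⊖ f (suc a) (suc k) = trans (cong (coefficient f) (ℤP.[1+m]⊖[1+n]≡m⊖n k a)) (coefficient-⊖ f a k)

  coeff-delay : ∀ {x f a} → x ≅ (f ·q^ (+ a)) → ∀ k → coeff x (+ k) ≡ delay a f k
  coeff-delay {x} {f} {a} h k = trans (coeff-cong {x} {f ·q^ (+ a)} h (+ k)) (trans (coeff≡coefficient (f ·q^ (+ a)) (+ k))
    (trans (cong (coefficient f) (ℤP.m-n≡m⊖n k a)) (coefficient-⊖ f a k)))

  ⊗-cong : ∀ {x x′ y y′} → x ≅ x′ → y ≅ y′ → (x ⊗ y) ≅ (x′ ⊗ y′)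
  ⊗-cong (p , h) (p′ , h′) = cong₂ _+_ p p′ , ⊛-cong h h′

  -- `⊕` starts at the smaller shift. If that is 0, the sum has shift 0 and both operands become
  -- delayed power series. In the sums below one operand always has shift 0, since every `ΣL` ends
  -- in `0L`.
  ⊕-nonneg : ∀ {x y f g a b} → x ≅ (f ·q^ (+ a)) → y ≅ (g ·q^ (+ b)) → a ℕ.⊓ b ≡ 0 →
    (x ⊕ y) ≅ ((delay a f ⊞ delay b g) ·q^ 0ℤ)
  ⊕-nonneg {x} {y} {f} {g} {a} {b} hx hy a⊓b = s≡0 , λ k → trans
    (cong (λ s → coeff x (s + + k) + coeff y (s + + k)) s≡0) (cong₂ _+_ (coeff-delay {x} hx k) (coeff-delay {y} hy k))
    where
    s≡0 : shift x ⊓ shift y ≡ 0ℤ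
    s≡0 = trans (cong₂ _⊓_ (shift≡ hx) (shift≡ hy)) (cong +_ a⊓b)

  ΣL-nonneg : {A : Set} {f : A → Laurent} {g : A → PS} {a : A → ℕ} (xs : List A) → (∀ {x} → x ∈ xs → f x ≅ (g x ·q^ (+ a x))) →
    ΣL f xs ≅ ((λ n → ΣI (λ x → delay (a x) (g x) n) xs) ·q^ 0ℤ)
  ΣL-nonneg []       h = refl , λ n → ℤP.*-zeroˡ (δ0 n)
  ΣL-nonneg {f = f} {a = a} (x ∷ xs) h = ⊕-nonneg {f x} {ΣL f xs} (h (here refl)) (ΣL-nonneg xs (h ∘ there)) (ℕP.⊓-zeroʳ (a x))

  one≅ : 1L ≅ (δ0 ·q^ 0ℤ)
  one≅ = refl , λ k → ℤP.*-identityˡ (δ0 k)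

  oneMinus≅ : ∀ n → oneMinus (+ n) ≅ (u n ·q^ 0ℤ)
  oneMinus≅ n with p , h ← ⊕-nonneg {1L} {⊖ qpow (+ n)} {a = 0} {b = n} one≅ (refl , λ _ → refl) refl =
    p , λ k → trans (h k) (cong (λ z → δ0 k + z) (delay-neg n δ0 k))

  onePlus≅ : ∀ n → (1L ⊕ qpow (+ n)) ≅ ((δ0 ⊞ q n) ·q^ 0ℤ)
  onePlus≅ n = ⊕-nonneg {1L} {qpow (+ n)} {a = 0} {b = n} one≅ (refl , λ _ → refl) refl

  -- With k = n + 1 this is 1 - q⁻ᵏ = -q⁻ᵏ(1 - qᵏ), which exposes a power series with constant term
  -- -1.
  oneMinus-neg≅ : ∀ n → oneMinus -[1+ n ] ≅ (neg (u (suc n)) ·q^ -[1+ n ])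
  oneMinus-neg≅ n = refl , λ k → trans (cong₂ _+_
      (trans (coeff≡coefficient 1L (k ⊖ suc n)) (trans (cong (coefficient (series 1L)) (ℤP.+-identityʳ (k ⊖ suc n)))
        (trans (coefficient-⊖ (series 1L) (suc n) k) (delay-cong (suc n) (λ i → ℤP.*-identityˡ (δ0 i)) k))))
      (trans (coeff≡coefficient (⊖ qpow -[1+ n ]) (k ⊖ suc n)) (cong (coefficient (neg δ0)) (cancel -[1+ n ] (+ k)))))
    (flip (q (suc n) k) (δ0 k))
    where
    cancel : ∀ s k → (s + k) - s ≡ k
    cancel = solve-∀
    flip : ∀ a d → a + - d ≡ - (d + - a)
    flip = solve-∀

  invL≅ : ∀ {x f g s} → x ≅ (f ·q^ s) → UnitConstant f → (f ⊛ g) ≗ δ0 → invL x ≅ (g ·q^ (- s))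
  invL≅ {x} {f} {g} (p , h) unit fg = cong -_ p , inverse-unique {f} {invPS (series x)} {g}
    (λ n → trans (⊛-cong {g = invPS (series x)} (λ k → sym (h k)) (λ _ → refl) n)
      (invPS-inverse (series x) (trans (cong (λ z → z * z) (h 0)) unit) n)) fg

  unit-poch : ∀ k → UnitConstant (poch k)
  unit-poch zero    = refl
  unit-poch (suc k) = unit-⊛ {u (suc k)} {poch k} refl (unit-poch k)

  qPoch≅ : ∀ k → qPoch k ≅ (poch k ·q^ 0ℤ)
  qPoch≅ k = shift≡ (go (from1To k)) , λ n → trans (series≗ (go (from1To k)) n) (prodU-from1To k n)
    where
    go : ∀ ns → ΠL (λ i → oneMinus (+ i)) ns ≅ (prodU ns ·q^ 0ℤ)
    go []       = one≅
    go (n ∷ ns) = ⊗-cong {oneMinus (+ n)} {u n ·q^ 0ℤ} (oneMinus≅ n) (go ns)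

  pow≅ : ∀ {x f s} → x ≅ (f ·q^ s) → ∀ k → (x ^L k) ≅ ((f ^ k) ·q^ (+ k * s))
  pow≅ {s = s} h zero = sym (ℤP.*-zeroˡ s) , series≗ one≅
  pow≅ {x} {f} {s} h (suc k) = trans (shift≡ h′) (sym (suc-* (+ k) s)) , series≗ h′
    where
    h′ : (x ⊗ (x ^L k)) ≅ ((f ·q^ s) ⊗ ((f ^ k) ·q^ (+ k * s)))
    h′ = ⊗-cong {x} {f ·q^ s} {x ^L k} {(f ^ k) ·q^ (+ k * s)} h (pow≅ {x} {f} {s} h k)
    suc-* : ∀ k s → (1ℤ + k) * s ≡ s + k * s
    suc-* = solve-∀

  unit-pow₀ : ∀ {f} → UnitConstant f → ∀ k → UnitConstant (f ^ k)
  unit-pow₀     h zero    = refl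
  unit-pow₀ {f} h (suc k) = unit-⊛ {f} {f ^ k} h (unit-pow₀ h k)

  inv-qPoch≅ : ∀ k → invL (qPoch k) ≅ (e k ·q^ 0ℤ)
  inv-qPoch≅ k = invL≅ {qPoch k} {poch k} {e k} {0ℤ} (qPoch≅ k) (unit-poch k) (poch*e k)

  inv-qPoch-ē≅ : ∀ {N n} → n ≤ N → invL (qPoch (N ℕ.∸ n)) ≅ (ē N n ·q^ 0ℤ)
  inv-qPoch-ē≅ {N} {n} p = shift≡ h , λ k → trans (series≗ h k) (cong (λ f → f k) (sym (ē-∸ p)))
    where
    h : invL (qPoch (N ℕ.∸ n)) ≅ (e (N ℕ.∸ n) ·q^ 0ℤ)
    h = inv-qPoch≅ (N ℕ.∸ n)

  inv-pow≅ : ∀ n k → invL (oneMinus (+ suc n) ^L k) ≅ ((v n ^ k) ·q^ 0ℤ)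
  inv-pow≅ n k = trans (shift≡ h) (cong -_ (ℤP.*-zeroʳ (+ k))) , series≗ h
    where
    h : invL (oneMinus (+ suc n) ^L k) ≅ ((v n ^ k) ·q^ (- (+ k * 0ℤ)))
    h = invL≅ {oneMinus (+ suc n) ^L k} {u (suc n) ^ k} {v n ^ k} {+ k * 0ℤ} (pow≅ {oneMinus (+ suc n)} {u (suc n)} {0ℤ} (oneMinus≅ (suc n)) k)
      (unit-pow₀ {u (suc n)} refl k) (unit-pow {u (suc n)} {v n} (1-q*v n) k)

  inv-pow-neg≅ : ∀ n k → invL (oneMinus -[1+ n ] ^L k) ≅ ((neg (v n) ^ k) ·q^ (- (+ k * -[1+ n ])))
  inv-pow-neg≅ n k = invL≅ {oneMinus -[1+ n ] ^L k} {neg (u (suc n)) ^ k} {neg (v n) ^ k} {+ k * -[1+ n ]} (pow≅ {oneMinus -[1+ n ]} {neg (u (suc n))} { -[1+ n ]} (oneMinus-neg≅ n) k)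
    (unit-pow₀ {neg (u (suc n))} refl k)
    (unit-pow {neg (u (suc n))} {neg (v n)} (λ i → trans (neg*neg (u (suc n)) (v n) i) (1-q*v n i)) k)

  const-sgn : ∀ n → const (sgn n) ≗ alt n
  const-sgn zero    k = ℤP.*-identityˡ (δ0 k)
  const-sgn (suc n) k = trans (cong (_* δ0 k) (sgn-suc n)) (trans (sym (ℤP.neg-distribˡ-* (sgn n) (δ0 k))) (cong -_ (const-sgn n k)))

  tri-double : ∀ m → tri (suc m) ℕ.* 2 ≡ suc m ℕ.* m
  tri-double zero    = refl
  tri-double (suc m) = trans (ℕP.*-distribʳ-+ 2 (suc m) (tri (suc m))) (trans (cong (suc m ℕ.* 2 ℕ.+_) (tri-double m)) (ring m))
    where
    ring : ∀ m → suc m ℕ.* 2 ℕ.+ suc m ℕ.* m ≡ suc (suc m) ℕ.* suc m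
    ring = solveℕ-∀

  -- n(3n - 1)/2 at n = m + 1.
  pent : ℕ → ℕ
  pent m = tri (suc m) ℕ.+ suc m ℕ.* suc m

  pent-double : ∀ m → suc m ℕ.* (3 ℕ.* suc m ℕ.∸ 1) ≡ pent m ℕ.* 2
  pent-double m = sym (trans (ℕP.*-distribʳ-+ 2 (tri (suc m)) (suc m ℕ.* suc m)) (trans (cong (ℕ._+ suc m ℕ.* suc m ℕ.* 2) (tri-double m)) (ring m)))
    where
    ring : ∀ m → suc m ℕ.* m ℕ.+ suc m ℕ.* suc m ℕ.* 2 ≡ suc m ℕ.* (m ℕ.+ (suc m ℕ.+ (suc m ℕ.+ 0)))
    ring = solveℕ-∀

  pent≡ : ∀ m → (suc m ℕ.* (3 ℕ.* suc m ℕ.∸ 1)) ℕ./ 2 ≡ pent m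
  pent≡ m = trans (cong (ℕ._/ 2) (pent-double m)) (m*n/n≡m (pent m) 2)

  pent⁺≡ : ∀ m → (+ suc m * (+ 3 * + suc m + 1ℤ)) /ℕ 2 ≡ + (pent m ℕ.+ suc m)
  pent⁺≡ m = trans (cong (_/ℕ 2) (trans (sym (ℤP.pos-* (suc m) (3 ℕ.* suc m ℕ.+ 1))) (cong +_ eq))) (cong +_ (m*n/n≡m (pent m ℕ.+ suc m) 2))
    where
    ring : ∀ m → suc m ℕ.* (3 ℕ.* suc m ℕ.+ 1) ≡ suc m ℕ.* (m ℕ.+ (suc m ℕ.+ (suc m ℕ.+ 0))) ℕ.+ suc m ℕ.* 2
    ring = solveℕ-∀
    eq : suc m ℕ.* (3 ℕ.* suc m ℕ.+ 1) ≡ (pent m ℕ.+ suc m) ℕ.* 2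
    eq = trans (ring m) (trans (cong (ℕ._+ suc m ℕ.* 2) (pent-double m)) (sym (ℕP.*-distribʳ-+ 2 (pent m) (suc m))))

  -- Changing the sign of n turns n(3n + 1)/2 into n(3n - 1)/2, so `pent` serves both signs.
  pent⁻≡ : ∀ m → (-[1+ m ] * (+ 3 * -[1+ m ] + 1ℤ)) /ℕ 2 ≡ + pent m
  pent⁻≡ m = trans (cong (_/ℕ 2) (trans (ring (+ suc m)) (trans (expand (+ m)) (trans
      (sym (ℤP.pos-* (suc m) (m ℕ.+ (suc m ℕ.+ (suc m ℕ.+ 0))))) (cong +_ (pent-double m))))))
    (cong +_ (m*n/n≡m (pent m) 2))
    where
    ring : ∀ n → - n * (+ 3 * - n + 1ℤ) ≡ n * (+ 3 * n - 1ℤ)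
    ring = solve-∀
    expand : ∀ m → (1ℤ + m) * (+ 3 * (1ℤ + m) - 1ℤ) ≡ (1ℤ + m) * (m + (1ℤ + m + (1ℤ + m + 0ℤ)))
    expand = solve-∀

  -- This and `rightTerm` repeat the local summands of `middleSeries` and `rightSeries`, with which
  -- they agree by definition, to give them names.
  middleTerm : ℕ → ℕ → ℕ → Laurent
  middleTerm ν N n = constL (sgn (n ℕ.∸ 1)) ⊗ (qpow (+ ((n ℕ.* (3 ℕ.* n ℕ.∸ 1)) ℕ./ 2 ℕ.+ ν ℕ.* n)) ⊗ ((1L ⊕ qpow (+ n))
    ⊗ (invL (qPoch (N ℕ.+ n)) ⊗ (invL (qPoch (N ℕ.∸ n)) ⊗ invL (oneMinus (+ n) ^L (2 ℕ.* ν))))))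

  rightTerm : ℕ → ℕ → ℤ → Laurent
  rightTerm ν N n = constL (sgnℤ (n - 1ℤ)) ⊗ (qpow ((n * (+ 3 * n + 1ℤ)) /ℕ 2 + + ν * n)
    ⊗ (invL (qPoch ∣ + N + n ∣) ⊗ (invL (qPoch ∣ + N - n ∣) ⊗ invL (oneMinus n ^L (2 ℕ.* ν)))))

  middleShift : ℕ → ℕ → ℕ
  middleShift ν m = pent m ℕ.+ ν ℕ.* suc m

  -- The `m + 0` in `rightFactor⁻` is what remains of |n - 1| = m + 2 at n = -(m + 1) after `sgn`
  -- has dropped 2.
  middleFactor rightFactor⁺ rightFactor⁻ : ℕ → ℕ → ℕ → PS
  middleFactor ν N m = const (sgn m) ⊛ (δ0 ⊛ ((δ0 ⊞ q (suc m)) ⊛ (e (N ℕ.+ suc m) ⊛ (ē N (suc m) ⊛ (v m ^ (2 ℕ.* ν))))))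
  rightFactor⁺ ν N m = const (sgn m) ⊛ (δ0 ⊛ (e (N ℕ.+ suc m) ⊛ (ē N (suc m) ⊛ (v m ^ (2 ℕ.* ν)))))
  rightFactor⁻ ν N m = const (sgn (m ℕ.+ 0)) ⊛ (δ0 ⊛ (ē N (suc m) ⊛ (e (N ℕ.+ suc m) ⊛ (neg (v m) ^ (2 ℕ.* ν)))))

  middleTerm≅ : ∀ ν N m → suc m ≤ N →
    middleTerm ν N (suc m)
    ≅ (middleFactor ν N m ·q^ (+ middleShift ν m))
  middleTerm≅ ν N m p = trans (shift≡ all) (cong +_ (trans (ℕP.+-identityʳ _) (cong (ℕ._+ ν ℕ.* suc m) (pent≡ m)))) , series≗ all
    where
    E = (suc m ℕ.* (3 ℕ.* suc m ℕ.∸ 1)) ℕ./ 2 ℕ.+ ν ℕ.* suc m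
    all = ⊗-cong {constL (sgn m)} {const (sgn m) ·q^ 0ℤ} (refl , λ _ → refl)
      (⊗-cong {qpow (+ E)} {δ0 ·q^ (+ E)} (refl , λ _ → refl)
      (⊗-cong {1L ⊕ qpow (+ suc m)} (onePlus≅ (suc m))
      (⊗-cong {invL (qPoch (N ℕ.+ suc m))} (inv-qPoch≅ (N ℕ.+ suc m))
      (⊗-cong {invL (qPoch (N ℕ.∸ suc m))} (inv-qPoch-ē≅ p) (inv-pow≅ m (2 ℕ.* ν))))))

  rightTerm⁺≅ : ∀ ν N m → suc m ≤ N →
    rightTerm ν N (+ suc m)
    ≅ (rightFactor⁺ ν N m ·q^ (+ (middleShift ν m ℕ.+ suc m)))
  rightTerm⁺≅ ν N m p = trans (shift≡ all) total , series≗ all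
    where
    E = (+ suc m * (+ 3 * + suc m + 1ℤ)) /ℕ 2 + + ν * + suc m
    abs≡ : ∣ + N - + suc m ∣ ≡ N ℕ.∸ suc m
    abs≡ = cong ∣_∣ (ℤP.⊖-≥ p)
    all = ⊗-cong {constL (sgn m)} {const (sgn m) ·q^ 0ℤ} (refl , λ _ → refl)
      (⊗-cong {qpow E} {δ0 ·q^ E} (refl , λ _ → refl)
      (⊗-cong {invL (qPoch (N ℕ.+ suc m))} (inv-qPoch≅ (N ℕ.+ suc m))
      (⊗-cong {invL (qPoch ∣ + N - + suc m ∣)} (subst (λ z → invL (qPoch z) ≅ (ē N (suc m) ·q^ 0ℤ)) (sym abs≡) (inv-qPoch-ē≅ p)) (inv-pow≅ m (2 ℕ.* ν)))))
    drop0 : ∀ z → 0ℤ + (z + 0ℤ) ≡ z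
    drop0 = solve-∀
    reorder : ∀ a b c → a ℕ.+ b ℕ.+ c ≡ a ℕ.+ c ℕ.+ b
    reorder = solveℕ-∀
    total : 0ℤ + (E + 0ℤ) ≡ + (pent m ℕ.+ ν ℕ.* suc m ℕ.+ suc m)
    total = trans (drop0 E) (trans (cong₂ _+_ (pent⁺≡ m) (sym (ℤP.pos-* ν (suc m)))) (cong +_ (reorder (pent m) (suc m) (ν ℕ.* suc m))))

  rightTerm⁻≅ : ∀ ν N m → suc m ≤ N →
    rightTerm ν N -[1+ m ]
    ≅ (rightFactor⁻ ν N m ·q^ (+ middleShift ν m))
  rightTerm⁻≅ ν N m p = trans (shift≡ all) total , series≗ all
    where
    E = (-[1+ m ] * (+ 3 * -[1+ m ] + 1ℤ)) /ℕ 2 + + ν * -[1+ m ]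
    abs≡ : ∣ + N + -[1+ m ] ∣ ≡ N ℕ.∸ suc m
    abs≡ = cong ∣_∣ (ℤP.⊖-≥ p)
    all = ⊗-cong {constL (sgn (m ℕ.+ 0))} {const (sgn (m ℕ.+ 0)) ·q^ 0ℤ} (refl , λ _ → refl)
      (⊗-cong {qpow E} {δ0 ·q^ E} (refl , λ _ → refl)
      (⊗-cong {invL (qPoch ∣ + N + -[1+ m ] ∣)} (subst (λ z → invL (qPoch z) ≅ (ē N (suc m) ·q^ 0ℤ)) (sym abs≡) (inv-qPoch-ē≅ p))
      (⊗-cong {invL (qPoch (N ℕ.+ suc m))} (inv-qPoch≅ (N ℕ.+ suc m)) (inv-pow-neg≅ m (2 ℕ.* ν)))))
    -- The exponent -νn of the numerator and the 2νn coming from the inverted power of 1 - q⁻ⁿ add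
    -- up to νn, so the shift is nonnegative.
    ring : ∀ a ν n → 0ℤ + ((a + ν * - n) + (0ℤ + (0ℤ + - (+ 2 * ν * - n)))) ≡ a + ν * n
    ring = solve-∀
    total : 0ℤ + (E + (0ℤ + (0ℤ + - (+ (2 ℕ.* ν) * -[1+ m ])))) ≡ + (pent m ℕ.+ ν ℕ.* suc m)
    total = trans (cong₂ (λ a b → 0ℤ + ((a + + ν * -[1+ m ]) + (0ℤ + (0ℤ + - (b * -[1+ m ]))))) (pent⁻≡ m) (ℤP.pos-* 2 ν))
      (trans (ring (+ pent m) (+ ν) (+ suc m)) (cong (λ z → + pent m + z) (sym (ℤP.pos-* ν (suc m)))))

  middle≗qTerm : ∀ ν N m → delay (middleShift ν m) (middleFactor ν N m) ≗ qTerm N ν m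
  middle≗qTerm ν N m n = trans (sym (q-⊛ (middleShift ν m) (middleFactor ν N m) n))
    (middle-term ν m {const (sgn m)} {e (N ℕ.+ suc m)} {ē N (suc m)} {v m ^ (2 ℕ.* ν)} (const-sgn m) (pow-double (v m) ν) n)

  right≗qTerm : ∀ ν N m → (delay (middleShift ν m ℕ.+ suc m) (rightFactor⁺ ν N m) ⊞ delay (middleShift ν m) (rightFactor⁻ ν N m)) ≗ qTerm N ν m
  right≗qTerm ν N m n = trans (cong₂ _+_ (sym (q-⊛ (E ℕ.+ suc m) (rightFactor⁺ ν N m) n)) (sym (q-⊛ E (rightFactor⁻ ν N m) n)))
    (trans (right-terms E m {const (sgn m)} {const (sgn (m ℕ.+ 0))} {e (N ℕ.+ suc m)} {ē N (suc m)} {v m ^ (2 ℕ.* ν)} {neg (v m) ^ (2 ℕ.* ν)}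
      (λ k → cong (λ z → const (sgn z) k) (ℕP.+-identityʳ m)) (pow-double-neg (v m) ν) n)
    (trans (q-⊛ E (middleFactor ν N m) n) (middle≗qTerm ν N m n)))
    where E = middleShift ν m

  common : ℕ → ℕ → Laurent
  common ν N = (poch N ⊛ ΣR N (qTerm N ν)) ·q^ 0ℤ

  Σ-qTerm : ∀ ν N (h : ℕ → ℤ) n → (∀ m → h (suc m) ≡ qTerm N ν m n) → ΣI h (from1To N) ≡ ΣR N (qTerm N ν) n
  Σ-qTerm ν N h n eq = trans (ΣI-applyUpTo h suc N) (trans (ΣI-cong eq (upTo N)) (sym (ΣR-eval N (qTerm N ν) n)))

  sumSeries≅ : ∀ {x h} ν N → x ≅ (h ·q^ 0ℤ) → h ≗ ΣR N (qTerm N ν) → (qPoch N ⊗ x) ≅ common ν N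
  sumSeries≅ {x} {h} ν N hx hh = ⊗-cong {qPoch N} {poch N ·q^ 0ℤ} {x} {ΣR N (qTerm N ν) ·q^ 0ℤ} (qPoch≅ N)
    (shift≡ hx , λ n → trans (series≗ hx n) (hh n))

  middleSum≅ : ∀ ν N → ΣL (middleTerm ν N) (from1To N)
    ≅ ((λ i → ΣI (λ n → delay (middleShift ν (ℕ.pred n)) (middleFactor ν N (ℕ.pred n)) i) (from1To N)) ·q^ 0ℤ)
  middleSum≅ ν N = ΣL-nonneg {f = middleTerm ν N} {middleFactor ν N ∘ ℕ.pred} {middleShift ν ∘ ℕ.pred} (from1To N)
    (λ n∈ → term (∈-applyUpTo⁻ suc n∈))
    where
    term : ∀ {n} → (∃ λ m → m < N × n ≡ suc m) → middleTerm ν N n ≅ (middleFactor ν N (ℕ.pred n) ·q^ (+ middleShift ν (ℕ.pred n)))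
    term (m , m<N , refl) = middleTerm≅ ν N m m<N

  middle≅ : ∀ ν N → middleSeries ν N ≅ common ν N
  middle≅ ν N = sumSeries≅ {ΣL (middleTerm ν N) (from1To N)} ν N (middleSum≅ ν N)
    (λ i → Σ-qTerm ν N (λ n → delay (middleShift ν (ℕ.pred n)) (middleFactor ν N (ℕ.pred n)) i) i (λ m → middle≗qTerm ν N m i))

  rightPair : ℕ → ℕ → ℕ → PS
  rightPair ν N m = delay (middleShift ν m ℕ.+ suc m) (rightFactor⁺ ν N m) ⊞ delay (middleShift ν m) (rightFactor⁻ ν N m)

  -- Stated for any list of indices between 1 and N so that induction on the list applies; each k
  -- brings the adjacent terms at k and -k.
  rightSum≅ : ∀ ν N ns → (∀ {n} → n ∈ ns → ∃ λ m → m < N × n ≡ suc m) →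
    ΣL (rightTerm ν N) (concatMap (λ k → + k ∷ - (+ k) ∷ []) ns) ≅ ((λ i → ΣI (λ n → rightPair ν N (ℕ.pred n) i) ns) ·q^ 0ℤ)
  rightSum≅ ν N []       h = refl , λ n → ℤP.*-zeroˡ (δ0 n)
  rightSum≅ ν N (n ∷ ns) h = step (h (here refl)) (rightSum≅ ν N ns (h ∘ there))
    where
    step : ∀ {n x H} → (∃ λ m → m < N × n ≡ suc m) → x ≅ (H ·q^ 0ℤ) →
      (rightTerm ν N (+ n) ⊕ (rightTerm ν N (- (+ n)) ⊕ x)) ≅ ((rightPair ν N (ℕ.pred n) ⊞ H) ·q^ 0ℤ)
    step {_} {x} {H} (m , m<N , refl) hx = shift≡ both , λ i → trans (series≗ both i) (sym (ℤP.+-assoc (delay E⁺ G⁺ i) (delay E⁻ G⁻ i) (H i)))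
      where
      E⁻ = middleShift ν m
      E⁺ = middleShift ν m ℕ.+ suc m
      G⁻ = rightFactor⁻ ν N m
      G⁺ = rightFactor⁺ ν N m
      both : (rightTerm ν N (+ suc m) ⊕ (rightTerm ν N -[1+ m ] ⊕ x)) ≅ ((delay E⁺ G⁺ ⊞ (delay E⁻ G⁻ ⊞ H)) ·q^ 0ℤ)
      both = ⊕-nonneg {rightTerm ν N (+ suc m)} {rightTerm ν N -[1+ m ] ⊕ x} {G⁺} {delay E⁻ G⁻ ⊞ H} {E⁺} {0} (rightTerm⁺≅ ν N m m<N)
        (⊕-nonneg {rightTerm ν N -[1+ m ]} {x} {G⁻} {H} {E⁻} {0} (rightTerm⁻≅ ν N m m<N) hx (ℕP.⊓-zeroʳ E⁻)) (ℕP.⊓-zeroʳ E⁺)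

  right≅ : ∀ ν N → rightSeries ν N ≅ common ν N
  right≅ ν N = sumSeries≅ {ΣL (rightTerm ν N) (concatMap (λ k → + k ∷ - (+ k) ∷ []) (from1To N))} ν N
    (rightSum≅ ν N (from1To N) (∈-applyUpTo⁻ suc))
    (λ i → Σ-qTerm ν N (λ n → rightPair ν N (ℕ.pred n) i) i (λ m → right≗qTerm ν N m i))

  eta≅ : ∀ ν N → etaSeries (suc ν) N ≅ common (suc ν) N
  eta≅ ν N = refl , λ { zero → trans (sym (η-zero (suc ν) N)) (η-series ν N 0) ; (suc n) → η-series ν N (suc n) }

open LaurentSeries

theorem2p2 : (N ν : ℕ) → 1 ≤ N → 1 ≤ ν →
    ((m : ℤ) → coeff (etaSeries ν N) m ≡ coeff (middleSeries ν N) m)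
    × ((m : ℤ) → coeff (middleSeries ν N) m ≡ coeff (rightSeries ν N) m)
theorem2p2 N (suc ν) _ _ =
    (λ m → trans (coeff-cong {etaSeries (suc ν) N} {common (suc ν) N} (eta≅ ν N) m)
                 (sym (coeff-cong {middleSeries (suc ν) N} {common (suc ν) N} (middle≅ (suc ν) N) m)))
  , (λ m → trans (coeff-cong {middleSeries (suc ν) N} {common (suc ν) N} (middle≅ (suc ν) N) m)
                 (sym (coeff-cong {rightSeries (suc ν) N} {common (suc ν) N} (right≅ (suc ν) N) m)))
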